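{- Let $m\le 153$ be a positive integer and let $C$ be an extremal binary doubly even self-dual $[24m,12m,4m+4]$ code. Then for no weight $w$ is the support design $D_w$ of $C$ an $8$-design.
   Context: A binary doubly even self-dual code of length $n$ is a binary linear code $C\subseteq\mathbb{F}_2^n$ with $C=C^\perp$ such that every codeword has Hamming weight divisible by $4$; it is extremal if its minimum nonzero weight equals $4\lfloor n/24\rfloor+4$. A $t$-design on a point set $X$ is a collection of $k$-subsets (blocks) of $X$ such that every $t$-subset of $X$ lies in the same number of blocks. For a weight $w$ (with $w\equiv0\pmod 4$ and $4m+4\le w\le 24m-(4m+4)$), the support design $D_w$ of $C$ has point set $\{1,\dots,24m\}$ and as blocks the supports $\{i:c_i\ne0\}$ of all codewords $c\in C$ of weight $w$. -}

module Defs where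

open import Data.Bool using (Bool; true; false; _∧_; _xor_; if_then_else_)
open import Data.Nat using (ℕ; zero; suc; _+_; _*_; _≤_; _≡ᵇ_)
open import Data.Nat.Divisibility using (_∣_)
open import Data.Vec using (Vec; []; _∷_; replicate; zipWith; map; foldr)
open import Data.List using (List; filter; length) renaming ([] to []ᴸ; _∷_ to _∷ᴸ_; map to mapᴸ; _++_ to _++ᴸ_)
open import Data.Fin.Subset using (Subset; inside; outside; ∣_∣; _⊆_)
open import Data.Fin.Subset.Properties using (_⊆?_)
open import Data.Product using (Σ; ∃; _×_)
open import Function.Bundles using (_⇔_)
open import Relation.Binary.PropositionalEquality using (_≡_; _≢_)
open import Relation.Nullary.Decidable using (Dec)

Word : ℕ → Set
Word n = Vec Bool n

0w : (n : ℕ) → Word n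
0w n = replicate n false

_⊕_ : {n : ℕ} → Word n → Word n → Word n
_⊕_ = zipWith _xor_

_·_ : {n : ℕ} → Word n → Word n → Bool
x · y = foldr (λ _ → Bool) _xor_ false (zipWith _∧_ x y)

support : {n : ℕ} → Word n → Subset n
support = map (λ b → if b then inside else outside)

wt : {n : ℕ} → Word n → ℕ
wt c = ∣ support c ∣

allWords : (n : ℕ) → List (Word n)
allWords zero = [] ∷ᴸ []ᴸ
allWords (suc n) = mapᴸ (false ∷_) (allWords n) ++ᴸ mapᴸ (true ∷_) (allWords n)

Code : ℕ → Set
Code n = Word n → Bool

_∈C_ : {n : ℕ} → Word n → Code n → Set
x ∈C C = C x ≡ true

record IsLinear {n : ℕ} (C : Code n) : Set where
  field
    zero∈ : 0w n ∈C C
    ⊕-closed : ∀ x y → x ∈C C → y ∈C C → (x ⊕ y) ∈C C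

IsSelfDual : {n : ℕ} → Code n → Set
IsSelfDual C = ∀ x → (x ∈C C) ⇔ (∀ y → y ∈C C → x · y ≡ false)

IsDoublyEven : {n : ℕ} → Code n → Set
IsDoublyEven C = ∀ x → x ∈C C → 4 ∣ wt x

MinWeight : {n : ℕ} → Code n → ℕ → Set
MinWeight {n} C d =
  (∀ x → x ∈C C → x ≢ 0w n → d ≤ wt x) ×
  (Σ (Word n) λ x → x ∈C C × x ≢ 0w n × wt x ≡ d)

record IsDoublyEvenSelfDual {n : ℕ} (C : Code n) : Set where
  field
    linear : IsLinear C
    selfDual : IsSelfDual C
    doublyEven : IsDoublyEven C

-- Extremal: minimum weight 4⌊n/24⌋+4; for length n = 24m this is 4m+4.
IsExtremalDESD : (m : ℕ) → Code (24 * m) → Set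
IsExtremalDESD m C = IsDoublyEvenSelfDual C × MinWeight C (4 * m + 4)

-- Support design D_w: blocks = supports of the codewords of weight w
-- (distinct codewords have distinct supports, so this is a set of blocks).
supportDesign : {n : ℕ} → Code n → ℕ → List (Subset n)
supportDesign {n} C w =
  mapᴸ support (filter (λ c → Data.Bool._≟_ (C c ∧ (wt c ≡ᵇ w)) true) (allWords n))
  where import Data.Bool

blocksContaining : {n : ℕ} → List (Subset n) → Subset n → ℕ
blocksContaining B T = length (filter (T ⊆?_) B)

IsTDesign : {n : ℕ} → ℕ → List (Subset n) → Set
IsTDesign {n} t B = ∃ λ (λ′ : ℕ) → ∀ (T : Subset n) → ∣ T ∣ ≡ t → blocksContaining B T ≡ λ′

{-# OPTIONS --safe #-}
module Submission where

-- Let n = 24 m, d = 4 m + 4, N = 4 m - 2, and let λ_v(T) be the number of codewords of weight v containing the set T. By the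
-- MacWilliams identity, fewer than d coordinates of C are independent, and d coordinates satisfy one relation exactly when they
-- support a codeword. Hence, for a polynomial P, the sum of P(wt c) over the codewords c ⊇ T depends only on |T| if
-- |T| + deg P < d, up to the term 4^N (deg P)! λ_d(T) if |T| + deg P = d and P is monic. The weights other than 0 and n are
-- d, d + 4, …, d + 4 N = n - d.
--
-- (1) If D_w is an 8-design, so is D_d. For t = 1, …, 8 take P vanishing at all weights but d (t ≤ 5), but d and w (t = 6), but d
-- and n - d (t = 7), or but d, n - d, w, n - w (t = 8), and subtract the identities for two t-sets. Inclusion-exclusion gives the
-- difference at n - d as (-1)^t times that at d; the remaining coefficient is nonzero, for t = 8 by a parity argument.
--
-- (2) λ_5 = 4 C(5m-1, m-1) - C(5m-2, 4m-2) at weight d. In Σ_{c ⊇ T} (1 + z)^{wt c - 5} (1 - z)^{n - wt c}, |T| = 5, the coefficients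
-- of z, …, z^N vanish. Multiplying by a suitable series and taking the coefficient of z^N kills every weight but d and n: up to a
-- constant this is the residue at u = 1 of u^{j-1} / (u - 1)^{N+1} du, where u = ((1 + z) / (1 - z))^4.
--
-- (3) Integrality of λ_8 at weight d then leaves m = 8, 42, 63, 75, 130. There a codeword u meets every c in an even number
-- of points, so 2^8 8! divides the sum of Π_{r<8} (|c ∩ u| - 2 r) over the blocks c of D_d, which fails if |u| ≡ 4 mod 8. But C cannot
-- have all its weights divisible by 8.

open import Defs
open import Data.Bool using (Bool; true; false; _∧_; _xor_; _∨_; not)
open import Data.Empty using (⊥; ⊥-elim)
open import Data.Integer.Base as ℤ using (ℤ; +_; -[1+_]; 0ℤ; 1ℤ; -1ℤ)
import Data.Integer.Properties as ℤP
open import Data.Integer.Tactic.RingSolver using (solve-∀)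
open import Data.Nat.Base as ℕ using (ℕ; zero; suc; z≤n; s≤s; _≡ᵇ_)
import Data.Nat.Properties as ℕP
open import Data.List.Base as List using (List)
open import Data.Product using (Σ; ∃; _×_; _,_; proj₁; proj₂)
open import Data.Sum using (_⊎_; inj₁; inj₂)
open import Data.Vec as Vec using (Vec; []; _∷_; replicate; zipWith)
open import Relation.Binary.PropositionalEquality using (_≡_; _≢_; refl; sym; trans; cong; cong₂; subst; subst₂; module ≡-Reasoning)
open import Relation.Nullary using (¬_; Dec; yes; no; does)
import Data.Bool.Properties as BoolP
open import Function.Bundles using (Equivalence)
open import Algebra.Bundles using (CommutativeRing)
open import Algebra.Structures using (IsCommutativeRing)
open import Level using (0ℓ)
import Algebra.Solver.Ring.NaturalCoefficients.Default as SemiringSolver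
import Algebra.Properties.Group as GroupProperties
open import Data.Nat.Combinatorics renaming (_C_ to _choose_) using (nCk≡nC[n∸k]; nCk+nC[k+1]≡[n+1]C[k+1]; nCn≡1)
import Relation.Binary.Reasoning.Setoid as SetoidReasoning
import Algebra.Properties.Ring as RingProperties
open import Data.Nat.Divisibility using (_∣_; _∣?_; divides; *-cancelˡ-∣; ∣m+n∣m⇒∣n; ∣m∣n⇒∣m+n)
open import Data.Nat.Tactic.RingSolver using () renaming (solve-∀ to solveℕ-∀)
open import Data.List.Membership.Propositional using (_∈_)
open import Data.List.Relation.Unary.Any using (here; there; _─_)
open import Data.Nat.DivMod using (_/_; m*n/n≡m)
open import Data.Fin.Subset using (∣_∣; _⊆_)
open import Data.Fin.Subset.Properties using (_⊆?_; drop-there)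
open import Data.Nat using (_+_; _*_; _∸_; _≤_)

-- Sums over all words

-- The degrees dictate (1). Besides 0, d and n there are N weights, and for a t-set a polynomial of
-- degree below d - t = N + 6 - t produces no term in λ_d. Five points leave room for all N roots;
-- each further point costs one. The missing roots are bought with the hypothesis at w, its mirror
-- image at n - w, the relation between d and n - d and, for t = 7 and 8, the identity of top
-- degree, whose extra term again involves λ_d alone. So each step ends in an equation c x = 0 for
-- the deviation x of λ_d, and the point is c ≠ 0. For t = 8, with w = d + 4 j and n - w = d + 4 l,
-- c is a nonzero multiple of the odd number (N - 1)(N / 2) - 8 j l. In (2) the size 5 is the one
-- for which the dual series of a nonzero codeword starts no earlier than z^{N+1}. The difference of
-- binomials found there equals C(5m - 2, m - 1); its two terms come from the constant term and from
-- the all-one word. In (3) the even roots 2 r are chosen because at 2 h the product is 2^8 8! C(h,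
-- 8).

infixl 6 _⊹_
infixl 7 _⋆_

_⊹_ _⋆_ : ℤ → ℤ → ℤ
_⊹_ = ℤ._+_
_⋆_ = ℤ._*_

⟦_⟧ : Bool → ℤ
⟦ false ⟧ = 0ℤ
⟦ true ⟧ = 1ℤ

⟦∧⟧ : ∀ a b → ⟦ a ∧ b ⟧ ≡ ⟦ a ⟧ ⋆ ⟦ b ⟧
⟦∧⟧ false b = refl
⟦∧⟧ true b = sym (ℤP.*-identityˡ ⟦ b ⟧)

opaque
  ∑ : ∀ {n} → (Word n → ℤ) → ℤ
  ∑ {zero} f = f []
  ∑ {suc n} f = ∑ (λ x → f (false ∷ x)) ⊹ ∑ (λ x → f (true ∷ x))

  ∑-[] : (f : Word 0 → ℤ) → ∑ f ≡ f []
  ∑-[] f = refl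

  ∑-∷ : ∀ {n} (f : Word (suc n) → ℤ) → ∑ f ≡ ∑ (λ x → f (false ∷ x)) ⊹ ∑ (λ x → f (true ∷ x))
  ∑-∷ f = refl

interchange : ∀ a b c d → (a ⊹ b) ⊹ (c ⊹ d) ≡ (a ⊹ c) ⊹ (b ⊹ d)
interchange = solve-∀

opaque
  unfolding ∑

  ∑-cong : ∀ {n} {f g : Word n → ℤ} → (∀ x → f x ≡ g x) → ∑ f ≡ ∑ g
  ∑-cong {zero} p = p []
  ∑-cong {suc n} p = cong₂ _⊹_ (∑-cong (λ x → p (false ∷ x))) (∑-cong (λ x → p (true ∷ x)))

  ∑-+ : ∀ {n} (f g : Word n → ℤ) → ∑ (λ x → f x ⊹ g x) ≡ ∑ f ⊹ ∑ g
  ∑-+ {zero} f g = refl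
  ∑-+ {suc n} f g = trans (cong₂ _⊹_ (∑-+ (λ x → f (false ∷ x)) (λ x → g (false ∷ x))) (∑-+ (λ x → f (true ∷ x)) (λ x → g (true ∷ x))))
    (interchange (∑ (λ x → f (false ∷ x))) (∑ (λ x → g (false ∷ x))) (∑ (λ x → f (true ∷ x))) (∑ (λ x → g (true ∷ x))))

  ∑-*ˡ : ∀ {n} (a : ℤ) (f : Word n → ℤ) → ∑ (λ x → a ⋆ f x) ≡ a ⋆ ∑ f
  ∑-*ˡ {zero} a f = refl
  ∑-*ˡ {suc n} a f = trans (cong₂ _⊹_ (∑-*ˡ a (λ x → f (false ∷ x))) (∑-*ˡ a (λ x → f (true ∷ x))))
    (sym (ℤP.*-distribˡ-+ a _ _))

  ∑-*ʳ : ∀ {n} (a : ℤ) (f : Word n → ℤ) → ∑ (λ x → f x ⋆ a) ≡ ∑ f ⋆ a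
  ∑-*ʳ a f = trans (∑-cong (λ x → ℤP.*-comm (f x) a)) (trans (∑-*ˡ a f) (ℤP.*-comm a (∑ f)))

  ∑-0 : ∀ {n} {f : Word n → ℤ} → (∀ x → f x ≡ 0ℤ) → ∑ f ≡ 0ℤ
  ∑-0 {zero} p = p []
  ∑-0 {suc n} p = cong₂ _⊹_ (∑-0 (λ x → p (false ∷ x))) (∑-0 (λ x → p (true ∷ x)))

  ∑-swap : ∀ {m n} (f : Word m → Word n → ℤ) → ∑ (λ x → ∑ (f x)) ≡ ∑ (λ y → ∑ (λ x → f x y))
  ∑-swap {zero} f = refl
  ∑-swap {suc m} f = trans (cong₂ _⊹_ (∑-swap (λ x → f (false ∷ x))) (∑-swap (λ x → f (true ∷ x))))
    (sym (∑-+ (λ y → ∑ (λ x → f (false ∷ x) y)) (λ y → ∑ (λ x → f (true ∷ x) y))))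

  ∑-⊕ : ∀ {n} (v : Word n) (f : Word n → ℤ) → ∑ (λ x → f (x ⊕ v)) ≡ ∑ f
  ∑-⊕ [] f = refl
  ∑-⊕ (false ∷ v) f = cong₂ _⊹_ (∑-⊕ v (λ x → f (false ∷ x))) (∑-⊕ v (λ x → f (true ∷ x)))
  ∑-⊕ (true ∷ v) f = trans (cong₂ _⊹_ (∑-⊕ v (λ x → f (true ∷ x))) (∑-⊕ v (λ x → f (false ∷ x)))) (ℤP.+-comm (∑ (λ x → f (true ∷ x))) _)

  ∑-single : ∀ {n} (a : Word n) (f : Word n → ℤ) → (∀ x → x ≢ a → f x ≡ 0ℤ) → ∑ f ≡ f a
  ∑-single [] f h = refl
  ∑-single (false ∷ a) f h = trans (cong₂ _⊹_ (∑-single a (λ x → f (false ∷ x)) (λ x x≢a → h (false ∷ x) (λ { refl → x≢a refl })))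
    (∑-0 (λ x → h (true ∷ x) (λ ())))) (ℤP.+-identityʳ _)
  ∑-single (true ∷ a) f h = trans (cong₂ _⊹_ (∑-0 (λ x → h (false ∷ x) (λ ())))
    (∑-single a (λ x → f (true ∷ x)) (λ x x≢a → h (true ∷ x) (λ { refl → x≢a refl })))) (ℤP.+-identityˡ _)

# : ∀ {n} → Word n → ℕ
# [] = 0
# (false ∷ x) = # x
# (true ∷ x) = suc (# x)

#-wt : ∀ {n} (x : Word n) → wt x ≡ # x
#-wt [] = refl
#-wt (false ∷ x) = #-wt x
#-wt (true ∷ x) = cong suc (#-wt x)

_⊑_ : ∀ {n} → Word n → Word n → Bool
[] ⊑ [] = true
(false ∷ t) ⊑ (_ ∷ c) = t ⊑ c
(true ∷ t) ⊑ (b ∷ c) = b ∧ (t ⊑ c)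

1w : ∀ n → Word n
1w n = replicate n true

⊑-1w : ∀ {n} (t : Word n) → (t ⊑ 1w n) ≡ true
⊑-1w [] = refl
⊑-1w (false ∷ t) = ⊑-1w t
⊑-1w (true ∷ t) = ⊑-1w t

#-1w : ∀ n → # (1w n) ≡ n
#-1w zero = refl
#-1w (suc n) = cong suc (#-1w n)

#≤n : ∀ {n} (x : Word n) → # x ℕ.≤ n
#≤n [] = z≤n
#≤n (false ∷ x) = ℕP.m≤n⇒m≤1+n (#≤n x)
#≤n (true ∷ x) = s≤s (#≤n x)

#≡0 : ∀ {n} (x : Word n) → # x ≡ 0 → x ≡ 0w n
#≡0 [] p = refl
#≡0 (false ∷ x) p = cong (false ∷_) (#≡0 x p)

#-0w : ∀ n → # (0w n) ≡ 0
#-0w zero = refl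
#-0w (suc n) = #-0w n

#≡n : ∀ {n} (x : Word n) → # x ≡ n → x ≡ 1w n
#≡n [] p = refl
#≡n {suc n} (false ∷ x) p = ⊥-elim (ℕP.<-irrefl p (s≤s (#≤n x)))
#≡n (true ∷ x) p = cong (true ∷_) (#≡n x (ℕP.suc-injective p))

⊑⇒#≤ : ∀ {n} (t c : Word n) → (t ⊑ c) ≡ true → # t ℕ.≤ # c
⊑⇒#≤ [] [] p = z≤n
⊑⇒#≤ (false ∷ t) (false ∷ c) p = ⊑⇒#≤ t c p
⊑⇒#≤ (false ∷ t) (true ∷ c) p = ℕP.m≤n⇒m≤1+n (⊑⇒#≤ t c p)
⊑⇒#≤ (true ∷ t) (true ∷ c) p = s≤s (⊑⇒#≤ t c p)

⊑-antisym-# : ∀ {n} (t c : Word n) → (t ⊑ c) ≡ true → # c ℕ.≤ # t → t ≡ c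
⊑-antisym-# [] [] p q = refl
⊑-antisym-# (false ∷ t) (false ∷ c) p q = cong (false ∷_) (⊑-antisym-# t c p q)
⊑-antisym-# (false ∷ t) (true ∷ c) p q = ⊥-elim (ℕP.<-irrefl refl (ℕP.≤-trans q (⊑⇒#≤ t c p)))
⊑-antisym-# (true ∷ t) (true ∷ c) p (s≤s q) = cong (true ∷_) (⊑-antisym-# t c p q)

-- The MacWilliams identity with respect to a set of coordinates

sg : Bool → ℤ
sg false = 1ℤ
sg true = -1ℤ

sg-xor : ∀ a b → sg (a xor b) ≡ sg a ⋆ sg b
sg-xor false b = sym (ℤP.*-identityˡ (sg b))
sg-xor true false = refl
sg-xor true true = refl

·-comm : ∀ {n} (x y : Word n) → x · y ≡ y · x
·-comm [] [] = refl
·-comm (a ∷ x) (b ∷ y) = cong₂ _xor_ (BoolP.∧-comm a b) (·-comm x y)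

sg-·-⊕ : ∀ {n} (u v x : Word n) → sg ((u ⊕ v) · x) ≡ sg (u · x) ⋆ sg (v · x)
sg-·-⊕ [] [] [] = refl
sg-·-⊕ (a ∷ u) (b ∷ v) (c ∷ x) = begin
  sg (((a xor b) ∧ c) xor ((u ⊕ v) · x))                           ≡⟨ sg-xor ((a xor b) ∧ c) _ ⟩
  sg ((a xor b) ∧ c) ⋆ sg ((u ⊕ v) · x)                            ≡⟨ cong₂ _⋆_ (bits a b c) (sg-·-⊕ u v x) ⟩
  (sg (a ∧ c) ⋆ sg (b ∧ c)) ⋆ (sg (u · x) ⋆ sg (v · x))            ≡⟨ *-interchange (sg (a ∧ c)) _ _ _ ⟩
  (sg (a ∧ c) ⋆ sg (u · x)) ⋆ (sg (b ∧ c) ⋆ sg (v · x))            ≡⟨ sym (cong₂ _⋆_ (sg-xor (a ∧ c) _) (sg-xor (b ∧ c) _)) ⟩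
  sg ((a ∧ c) xor (u · x)) ⋆ sg ((b ∧ c) xor (v · x))              ∎
  where
  open ≡-Reasoning
  *-interchange : ∀ p q r s → (p ⋆ q) ⋆ (r ⋆ s) ≡ (p ⋆ r) ⋆ (q ⋆ s)
  *-interchange = solve-∀
  bits : ∀ a b c → sg ((a xor b) ∧ c) ≡ sg (a ∧ c) ⋆ sg (b ∧ c)
  bits false false c = refl
  bits false true c = sym (ℤP.*-identityˡ (sg c))
  bits true false false = refl
  bits true false true = refl
  bits true true false = refl
  bits true true true = refl

⊕-cancelʳ : ∀ {n} (u v : Word n) → (u ⊕ v) ⊕ v ≡ u
⊕-cancelʳ [] [] = refl
⊕-cancelʳ (false ∷ u) (false ∷ v) = cong (false ∷_) (⊕-cancelʳ u v)
⊕-cancelʳ (false ∷ u) (true ∷ v) = cong (false ∷_) (⊕-cancelʳ u v)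
⊕-cancelʳ (true ∷ u) (false ∷ v) = cong (true ∷_) (⊕-cancelʳ u v)
⊕-cancelʳ (true ∷ u) (true ∷ v) = cong (true ∷_) (⊕-cancelʳ u v)

-- A Boolean search through all words stands in for excluded middle: it finds a codeword that is not
-- orthogonal to a given word outside C, and later decides whether a weight occurs.
all⊎counterexample : ∀ {n} (P : Word n → Bool) → (∀ x → P x ≡ true) ⊎ (∃ λ x → P x ≡ false)
all⊎counterexample {zero} P with P [] in eq
... | true = inj₁ (λ { [] → eq })
... | false = inj₂ ([] , eq)
all⊎counterexample {suc n} P with all⊎counterexample (λ x → P (false ∷ x)) | all⊎counterexample (λ x → P (true ∷ x))
... | inj₂ (x , p) | _ = inj₂ (_ , p)
... | inj₁ _ | inj₂ (x , p) = inj₂ (_ , p)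
... | inj₁ p | inj₁ q = inj₁ (λ { (false ∷ x) → p x ; (true ∷ x) → q x })

Series : Set
Series = ℕ → ℤ

z∙_ : Series → Series
(z∙ f) zero = 0ℤ
(z∙ f) (suc i) = f i

δ₀ : Series
δ₀ zero = 1ℤ
δ₀ (suc i) = 0ℤ

-- weightSeries T c is [T ⊆ c] (1 + z)^{|c ∖ T|} (1 - z)^{n - |c|}; as a function of c it is a product over the
-- coordinates, and dualSeries T is its Fourier transform.
weightSeries dualSeries : ∀ {n} → Word n → Word n → Series
weightSeries [] [] = δ₀
weightSeries (true ∷ t) (false ∷ c) i = 0ℤ
weightSeries (true ∷ t) (true ∷ c) = weightSeries t c
weightSeries (false ∷ t) (false ∷ c) i = weightSeries t c i ℤ.- (z∙ weightSeries t c) i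
weightSeries (false ∷ t) (true ∷ c) i = weightSeries t c i ⊹ (z∙ weightSeries t c) i

dualSeries [] [] = δ₀
dualSeries (true ∷ t) (false ∷ u) = dualSeries t u
dualSeries (true ∷ t) (true ∷ u) i = -1ℤ ⋆ dualSeries t u i
dualSeries (false ∷ t) (false ∷ u) i = + 2 ⋆ dualSeries t u i
dualSeries (false ∷ t) (true ∷ u) i = -[1+ 1 ] ⋆ (z∙ dualSeries t u) i

-- Both sides factor over the coordinates. Off T the values 1 - z and 1 + z have sum 2 and
-- difference -2 z; on T only the value at 1 survives, with the sign given by u.
fourier : ∀ {n} (t u : Word n) i → ∑ (λ x → sg (u · x) ⋆ weightSeries t x i) ≡ dualSeries t u i
fourier-z : ∀ {n} (t u : Word n) i → ∑ (λ x → sg (u · x) ⋆ (z∙ weightSeries t x) i) ≡ (z∙ dualSeries t u) i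

fourier-z t u zero = ∑-0 (λ x → ℤP.*-zeroʳ (sg (u · x)))
fourier-z t u (suc i) = fourier t u i

∑-sub : ∀ {n} (s f g : Word n → ℤ) → ∑ (λ x → s x ⋆ (f x ℤ.- g x)) ≡ ∑ (λ x → s x ⋆ f x) ℤ.- ∑ (λ x → s x ⋆ g x)
∑-sub s f g = trans (∑-cong (λ x → dist (s x) (f x) (g x))) (trans (∑-+ _ _) (cong (∑ (λ x → s x ⋆ f x) ⊹_) (trans (∑-*ˡ -1ℤ _) (ℤP.-1*i≡-i _))))
  where
  dist : ∀ a b c → a ⋆ (b ℤ.- c) ≡ a ⋆ b ⊹ -1ℤ ⋆ (a ⋆ c)
  dist = solve-∀

∑-add : ∀ {n} (s f g : Word n → ℤ) → ∑ (λ x → s x ⋆ (f x ⊹ g x)) ≡ ∑ (λ x → s x ⋆ f x) ⊹ ∑ (λ x → s x ⋆ g x)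
∑-add s f g = trans (∑-cong (λ x → ℤP.*-distribˡ-+ (s x) (f x) (g x))) (∑-+ _ _)

∑-negate : ∀ {n} (s : Word n → Bool) (f : Word n → ℤ) → ∑ (λ x → sg (true xor s x) ⋆ f x) ≡ -1ℤ ⋆ ∑ (λ x → sg (s x) ⋆ f x)
∑-negate s f = trans (∑-cong (λ x → trans (cong (_⋆ f x) (sg-xor true (s x))) (ℤP.*-assoc -1ℤ (sg (s x)) (f x)))) (∑-*ˡ -1ℤ _)

fourier [] [] i = trans (∑-[] _) (ℤP.*-identityˡ _)
fourier (true ∷ t) (false ∷ u) i = trans (∑-∷ _) (trans (cong₂ _⊹_ (∑-0 (λ x → ℤP.*-zeroʳ (sg (u · x)))) (fourier t u i)) (ℤP.+-identityˡ _))
fourier (true ∷ t) (true ∷ u) i = trans (∑-∷ _) (trans (cong₂ _⊹_ (∑-0 (λ x → ℤP.*-zeroʳ (sg (u · x))))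
  (trans (∑-negate (u ·_) (λ x → weightSeries t x i)) (cong (-1ℤ ⋆_) (fourier t u i)))) (ℤP.+-identityˡ _))
fourier (false ∷ t) (false ∷ u) i = trans (∑-∷ _) (trans (cong₂ _⊹_
    (trans (∑-sub (λ x → sg (u · x)) (λ x → weightSeries t x i) (λ x → (z∙ weightSeries t x) i)) (cong₂ ℤ._-_ (fourier t u i) (fourier-z t u i)))
    (trans (∑-add (λ x → sg (u · x)) (λ x → weightSeries t x i) (λ x → (z∙ weightSeries t x) i)) (cong₂ _⊹_ (fourier t u i) (fourier-z t u i))))
  (double (dualSeries t u i) ((z∙ dualSeries t u) i)))
  where
  double : ∀ a b → (a ℤ.- b) ⊹ (a ⊹ b) ≡ + 2 ⋆ a
  double = solve-∀
fourier (false ∷ t) (true ∷ u) i = trans (∑-∷ _) (trans (cong₂ _⊹_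
    (trans (∑-sub (λ x → sg (u · x)) (λ x → weightSeries t x i) (λ x → (z∙ weightSeries t x) i)) (cong₂ ℤ._-_ (fourier t u i) (fourier-z t u i)))
    (trans (∑-negate (u ·_) (λ x → weightSeries t x i ⊹ (z∙ weightSeries t x) i))
      (cong (-1ℤ ⋆_) (trans (∑-add (λ x → sg (u · x)) (λ x → weightSeries t x i) (λ x → (z∙ weightSeries t x) i)) (cong₂ _⊹_ (fourier t u i) (fourier-z t u i))))))
  (double (dualSeries t u i) ((z∙ dualSeries t u) i)))
  where
  double : ∀ a b → (a ℤ.- b) ⊹ -1ℤ ⋆ (a ⊹ b) ≡ -[1+ 1 ] ⋆ b
  double = solve-∀

_∖_ : ∀ {n} → Word n → Word n → ℕ
[] ∖ [] = 0
(false ∷ u) ∖ (_ ∷ t) = u ∖ t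
(true ∷ u) ∖ (false ∷ t) = suc (u ∖ t)
(true ∷ u) ∖ (true ∷ t) = u ∖ t

#≤∖+# : ∀ {n} (u t : Word n) → # u ℕ.≤ u ∖ t ℕ.+ # t
#≤∖+# [] [] = z≤n
#≤∖+# (false ∷ u) (false ∷ t) = #≤∖+# u t
#≤∖+# (false ∷ u) (true ∷ t) = ℕP.≤-trans (#≤∖+# u t) (ℕP.+-monoʳ-≤ (u ∖ t) (ℕP.n≤1+n (# t)))
#≤∖+# (true ∷ u) (false ∷ t) = s≤s (#≤∖+# u t)
#≤∖+# (true ∷ u) (true ∷ t) = ℕP.≤-trans (s≤s (#≤∖+# u t)) (ℕP.≤-reflexive (sym (ℕP.+-suc (u ∖ t) (# t))))

∖-⊑ : ∀ {n} (u t : Word n) → u ∖ t ≡ 0 → (u ⊑ t) ≡ true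
∖-⊑ [] [] p = refl
∖-⊑ (false ∷ u) (_ ∷ t) p = ∖-⊑ u t p
∖-⊑ (true ∷ u) (true ∷ t) p = ∖-⊑ u t p

0w-⊑ : ∀ {n} (t : Word n) → (0w n ⊑ t) ≡ true
0w-⊑ [] = refl
0w-⊑ (_ ∷ t) = 0w-⊑ t

-- Each coordinate of u outside t contributes a factor z.
dual-low : ∀ {n} (t u : Word n) i → i ℕ.< u ∖ t → dualSeries t u i ≡ 0ℤ
dual-low [] [] i ()
dual-low (true ∷ t) (false ∷ u) i p = dual-low t u i p
dual-low (true ∷ t) (true ∷ u) i p = cong (-1ℤ ⋆_) (dual-low t u i p)
dual-low (false ∷ t) (false ∷ u) i p = cong (+ 2 ⋆_) (dual-low t u i p)
dual-low (false ∷ t) (true ∷ u) zero p = refl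
dual-low (false ∷ t) (true ∷ u) (suc i) (s≤s p) = cong (-[1+ 1 ] ⋆_) (dual-low t u i p)

-1^_ 2^_ : ℕ → ℤ
-1^ zero = 1ℤ
-1^ suc k = -1ℤ ⋆ (-1^ k)
2^ zero = 1ℤ
2^ suc k = + 2 ⋆ (2^ k)

co# : ∀ {n} → Word n → ℕ
co# [] = 0
co# (false ∷ t) = suc (co# t)
co# (true ∷ t) = co# t

#+co# : ∀ {n} (t : Word n) → # t ℕ.+ co# t ≡ n
#+co# [] = refl
#+co# (false ∷ t) = trans (ℕP.+-suc (# t) (co# t)) (cong suc (#+co# t))
#+co# (true ∷ t) = cong suc (#+co# t)

dual-⊑ : ∀ {n} (t u : Word n) i → (u ⊑ t) ≡ true → dualSeries t u i ≡ (-1^ # u) ⋆ ((2^ co# t) ⋆ δ₀ i)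
dual-⊑ [] [] i p = sym (trans (ℤP.*-identityˡ _) (ℤP.*-identityˡ _))
dual-⊑ (true ∷ t) (false ∷ u) i p = dual-⊑ t u i p
dual-⊑ (true ∷ t) (true ∷ u) i p = trans (cong (-1ℤ ⋆_) (dual-⊑ t u i p)) (sym (ℤP.*-assoc -1ℤ (-1^ # u) _))
dual-⊑ (false ∷ t) (false ∷ u) i p = trans (cong (+ 2 ⋆_) (dual-⊑ t u i p)) (perm (+ 2) (-1^ # u) (2^ co# t) (δ₀ i))
  where
  perm : ∀ a b c d → a ⋆ (b ⋆ (c ⋆ d)) ≡ b ⋆ ((a ⋆ c) ⋆ d)
  perm = solve-∀

weight₀ : ∀ {n} (t c : Word n) → weightSeries t c 0 ≡ ⟦ t ⊑ c ⟧
weight₀ [] [] = refl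
weight₀ (true ∷ t) (false ∷ c) = refl
weight₀ (true ∷ t) (true ∷ c) = weight₀ t c
weight₀ (false ∷ t) (false ∷ c) = trans (ℤP.+-identityʳ _) (weight₀ t c)
weight₀ (false ∷ t) (true ∷ c) = trans (ℤP.+-identityʳ _) (weight₀ t c)

module SelfDual {n} (C : Code n) (lin : IsLinear C) (sd : IsSelfDual C) where
  open IsLinear lin
  open Equivalence using (to; from)

  ∑C : (Word n → ℤ) → ℤ
  ∑C f = ∑ (λ c → ⟦ C c ⟧ ⋆ f c)

  ∑C-cong : {f g : Word n → ℤ} → (∀ c → c ∈C C → f c ≡ g c) → ∑C f ≡ ∑C g
  ∑C-cong {f} {g} p = ∑-cong λ c → go c (C c) refl
    where
    go : ∀ c b → C c ≡ b → ⟦ b ⟧ ⋆ f c ≡ ⟦ b ⟧ ⋆ g c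
    go c false _ = refl
    go c true q = cong (1ℤ ⋆_) (p c q)

  ∑C-linear : ∀ a b (f g : Word n → ℤ) → ∑C (λ c → f c ⋆ a ⊹ g c ⋆ b) ≡ ∑C f ⋆ a ⊹ ∑C g ⋆ b
  ∑C-linear a b f g = trans (∑-cong (λ c → factor ⟦ C c ⟧ (f c) a (g c) b)) (trans (∑-+ (λ c → ⟦ C c ⟧ ⋆ f c ⋆ a) (λ c → ⟦ C c ⟧ ⋆ g c ⋆ b))
    (cong₂ _⊹_ (∑-*ʳ a (λ c → ⟦ C c ⟧ ⋆ f c)) (∑-*ʳ b (λ c → ⟦ C c ⟧ ⋆ g c))))
    where
    factor : ∀ a b c d e → a ⋆ (b ⋆ c ⊹ d ⋆ e) ≡ a ⋆ b ⋆ c ⊹ a ⋆ d ⋆ e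
    factor = solve-∀

  ∑C-⊕ : ∀ v → v ∈C C → (f : Word n → ℤ) → ∑C (λ c → f (c ⊕ v)) ≡ ∑C f
  ∑C-⊕ v v∈ f = trans (∑-cong (λ c → cong (λ b → ⟦ b ⟧ ⋆ f (c ⊕ v)) (sym (same c)))) (∑-⊕ v (λ c → ⟦ C c ⟧ ⋆ f c))
    where
    same : ∀ c → C (c ⊕ v) ≡ C c
    same c with C c in eq | C (c ⊕ v) in eq′
    ... | true | true = refl
    ... | false | false = refl
    ... | true | false = trans (sym eq′) (⊕-closed c v eq v∈)
    ... | false | true = trans (sym (subst (_∈C C) (⊕-cancelʳ c v) (⊕-closed _ v eq′ v∈))) eq

  ∣C∣ : ℤ
  ∣C∣ = ∑C (λ _ → 1ℤ)

  not-codeword : ∀ x → C x ≡ false → ∃ λ v → v ∈C C × x · v ≡ true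
  not-codeword x x∉ with all⊎counterexample (λ v → not (C v ∧ (x · v)))
  ... | inj₂ (v , p) = v , split (C v) (x · v) p
    where
    split : ∀ a b → not (a ∧ b) ≡ false → a ≡ true × b ≡ true
    split true true p = refl , refl
  ... | inj₁ p = ⊥-elim (true≢false (trans (sym (from (sd x) (λ y y∈ → orth (C y) (x · y) y∈ (p y)))) x∉))
    where
    true≢false : true ≢ false
    true≢false ()
    orth : ∀ a b → a ≡ true → not (a ∧ b) ≡ true → b ≡ false
    orth true false _ _ = refl

  -- If x lies outside C, some codeword v has x · v = 1; translating the sum by v changes its sign,
  -- so it vanishes.
  orthogonality : ∀ x → ∑C (λ u → sg (u · x)) ≡ ⟦ C x ⟧ ⋆ ∣C∣
  orthogonality x with C x in eq
  ... | true = trans (∑C-cong (λ c c∈ → cong sg (to (sd c) c∈ x eq))) (sym (ℤP.*-identityˡ ∣C∣))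
  ... | false with not-codeword x eq
  ...   | v , v∈ , xv = ℤP.*-cancelˡ-≡ (+ 2) _ 0ℤ (trans (double (∑C χ)) (trans (cong (∑C χ ⊹_) negated) (ℤP.+-inverseʳ (∑C χ))))
    where
    χ : Word n → ℤ
    χ u = sg (u · x)
    double : ∀ a → + 2 ⋆ a ≡ a ⊹ a
    double = solve-∀
    pull : ∀ a b → a ⋆ (b ⋆ -1ℤ) ≡ -1ℤ ⋆ (a ⋆ b)
    pull = solve-∀
    negated : ∑C χ ≡ ℤ.- ∑C χ
    negated = trans (sym (∑C-⊕ v v∈ χ)) (trans (∑-cong (λ c → trans
        (cong (⟦ C c ⟧ ⋆_) (trans (sg-·-⊕ c v x) (cong (χ c ⋆_) (cong sg (trans (·-comm v x) xv)))))
        (pull ⟦ C c ⟧ (χ c))))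
      (trans (∑-*ˡ -1ℤ _) (ℤP.-1*i≡-i _)))

  -- Write each dual series as a Fourier transform and sum over the codewords first: by
  -- `orthogonality` only the words x of C survive, each with factor |C|.
  poisson : ∀ t i → ∑C (λ u → dualSeries t u i) ≡ ∣C∣ ⋆ ∑C (λ c → weightSeries t c i)
  poisson t i = begin
    ∑ (λ u → ⟦ C u ⟧ ⋆ dualSeries t u i)                                     ≡⟨ ∑-cong (λ u → trans (cong (⟦ C u ⟧ ⋆_) (sym (fourier t u i))) (sym (∑-*ˡ ⟦ C u ⟧ _))) ⟩
    ∑ (λ u → ∑ (λ x → ⟦ C u ⟧ ⋆ (sg (u · x) ⋆ W x)))                         ≡⟨ ∑-swap (λ u x → ⟦ C u ⟧ ⋆ (sg (u · x) ⋆ W x)) ⟩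
    ∑ (λ x → ∑ (λ u → ⟦ C u ⟧ ⋆ (sg (u · x) ⋆ W x)))                         ≡⟨ ∑-cong (λ x → trans (∑-cong (λ u → sym (ℤP.*-assoc ⟦ C u ⟧ _ (W x)))) (∑-*ʳ (W x) _)) ⟩
    ∑ (λ x → ∑C (λ u → sg (u · x)) ⋆ W x)                                    ≡⟨ ∑-cong (λ x → trans (cong (_⋆ W x) (orthogonality x)) (perm ⟦ C x ⟧ ∣C∣ (W x))) ⟩
    ∑ (λ x → ∣C∣ ⋆ (⟦ C x ⟧ ⋆ W x))                                          ≡⟨ ∑-*ˡ ∣C∣ _ ⟩
    ∣C∣ ⋆ ∑C W                                                               ∎
    where
    open ≡-Reasoning
    W : Word n → ℤ
    W x = weightSeries t x i
    perm : ∀ a b c → (a ⋆ b) ⋆ c ≡ b ⋆ (a ⋆ c)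
    perm = solve-∀

∑-nonneg : ∀ {n} {f : Word n → ℤ} → (∀ x → 0ℤ ℤ.≤ f x) → 0ℤ ℤ.≤ ∑ f
∑-nonneg {zero} {f} p = subst (0ℤ ℤ.≤_) (sym (∑-[] f)) (p [])
∑-nonneg {suc n} {f} p = subst (0ℤ ℤ.≤_) (sym (∑-∷ f))
  (ℤP.+-mono-≤ (∑-nonneg (λ x → p (false ∷ x))) (∑-nonneg (λ x → p (true ∷ x))))

2^-+ : ∀ a b → 2^ (a ℕ.+ b) ≡ (2^ a) ⋆ (2^ b)
2^-+ zero b = sym (ℤP.*-identityˡ _)
2^-+ (suc a) b = trans (cong (+ 2 ⋆_) (2^-+ a b)) (sym (ℤP.*-assoc (+ 2) (2^ a) (2^ b)))

2^≢0 : ∀ a → 2^ a ≢ 0ℤ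
2^≢0 (suc a) p with ℤP.i*j≡0⇒i≡0∨j≡0 (+ 2) {2^ a} p
... | inj₂ q = 2^≢0 a q

2^-nonneg : ∀ a → 0ℤ ℤ.≤ 2^ a
2^-nonneg zero = ℤ.+≤+ z≤n
2^-nonneg (suc a) = subst (ℤ._≤ (2^ suc a)) (ℤP.*-zeroʳ (+ 2)) (ℤP.*-monoˡ-≤-nonNeg (+ 2) (2^-nonneg a))

*-cancelˡ : ∀ a {b c} → a ≢ 0ℤ → a ⋆ b ≡ a ⋆ c → b ≡ c
*-cancelˡ a {b} {c} a≢0 = ℤP.*-cancelˡ-≡ a b c {{ℤ.≢-nonZero a≢0}}

square-injective : ∀ {a b} → 0ℤ ℤ.≤ a → 0ℤ ℤ.≤ b → a ⋆ a ≡ b ⋆ b → a ≡ b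
square-injective {a} {b} 0≤a 0≤b p with ℤP.i*j≡0⇒i≡0∨j≡0 (a ℤ.- b) {a ⊹ b} (trans (factor a b) (ℤP.i≡j⇒i-j≡0 p))
  where
  factor : ∀ a b → (a ℤ.- b) ⋆ (a ⊹ b) ≡ a ⋆ a ℤ.- b ⋆ b
  factor = solve-∀
... | inj₁ q = ℤP.i-j≡0⇒i≡j a b q
... | inj₂ q = ℤP.≤-antisym
  (ℤP.≤-trans (subst (a ℤ.≤_) q (subst (ℤ._≤ a ⊹ b) (ℤP.+-identityʳ a) (ℤP.+-monoʳ-≤ a 0≤b))) 0≤b)
  (ℤP.≤-trans (subst (b ℤ.≤_) q (subst (ℤ._≤ a ⊹ b) (ℤP.+-identityˡ b) (ℤP.+-monoˡ-≤ b 0≤a))) 0≤a)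

⟦⟧-nonneg : ∀ b → 0ℤ ℤ.≤ ⟦ b ⟧
⟦⟧-nonneg false = ℤ.+≤+ z≤n
⟦⟧-nonneg true = ℤ.+≤+ z≤n

≡ᵇ-refl : ∀ a → (a ≡ᵇ a) ≡ true
≡ᵇ-refl zero = refl
≡ᵇ-refl (suc a) = ≡ᵇ-refl a

≡ᵇ-≢ : ∀ {a b} → a ≢ b → (a ≡ᵇ b) ≡ false
≡ᵇ-≢ {zero} {zero} p = ⊥-elim (p refl)
≡ᵇ-≢ {zero} {suc b} p = refl
≡ᵇ-≢ {suc a} {zero} p = refl
≡ᵇ-≢ {suc a} {suc b} p = ≡ᵇ-≢ (λ q → p (cong suc q))

≡ᵇ-sound : ∀ a b → (a ≡ᵇ b) ≡ true → a ≡ b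
≡ᵇ-sound zero zero p = refl
≡ᵇ-sound (suc a) (suc b) p = cong suc (≡ᵇ-sound a b p)

module Counting {n} (C : Code n) (lin : IsLinear C) (sd : IsSelfDual C)
  (even : ∀ x → x ∈C C → -1^ # x ≡ 1ℤ)
  (d : ℕ) (0<d : 0 ℕ.< d) (min : ∀ x → x ∈C C → x ≢ 0w n → d ℕ.≤ # x)
  (k : ℕ) (n≡k+k : n ≡ k ℕ.+ k) where
  open SelfDual C lin sd public

  -- The number λ_v(t) of blocks of the support design D_v that contain t.
  count : ℕ → Word n → ℤ
  count v t = ∑C (λ c → ⟦ t ⊑ c ⟧ ⋆ ⟦ # c ≡ᵇ v ⟧)

  dual-codeword : ∀ t u → u ∈C C → dualSeries t u 0 ≡ ⟦ u ⊑ t ⟧ ⋆ (2^ co# t)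
  dual-codeword t u u∈ with u ⊑ t in eq
  ... | true = trans (dual-⊑ t u 0 eq) (trans (cong (_⋆ ((2^ co# t) ⋆ 1ℤ)) (even u u∈)) (cong (1ℤ ⋆_) (ℤP.*-identityʳ _)))
  ... | false = dual-low t u 0 (ℕP.n≢0⇒n>0 (λ p → false≢true (trans (sym eq) (∖-⊑ u t p))))
    where
    false≢true : false ≢ true
    false≢true ()

  -- The constant term of `poisson`. A codeword not contained in t has no constant term, and the
  -- sign of the others is 1 because their weight is even.
  poisson₀ : ∀ t → ∣C∣ ⋆ ∑C (λ c → ⟦ t ⊑ c ⟧) ≡ ∑C (λ u → ⟦ u ⊑ t ⟧) ⋆ (2^ co# t)
  poisson₀ t = begin
    ∣C∣ ⋆ ∑C (λ c → ⟦ t ⊑ c ⟧)              ≡⟨ cong (∣C∣ ⋆_) (∑C-cong (λ c _ → sym (weight₀ t c))) ⟩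
    ∣C∣ ⋆ ∑C (λ c → weightSeries t c 0)     ≡⟨ sym (poisson t 0) ⟩
    ∑C (λ u → dualSeries t u 0)             ≡⟨ ∑C-cong (dual-codeword t) ⟩
    ∑C (λ u → ⟦ u ⊑ t ⟧ ⋆ (2^ co# t))       ≡⟨ trans (∑-cong (λ u → sym (ℤP.*-assoc ⟦ C u ⟧ ⟦ u ⊑ t ⟧ _))) (∑-*ʳ (2^ co# t) _) ⟩
    ∑C (λ u → ⟦ u ⊑ t ⟧) ⋆ (2^ co# t)       ∎
    where open ≡-Reasoning

  ∑C-0w : ∑C (λ u → ⟦ # u ≡ᵇ 0 ⟧) ≡ 1ℤ
  ∑C-0w = trans (∑-single (0w n) _ (λ x x≢0 → trans (cong (λ b → ⟦ C x ⟧ ⋆ ⟦ b ⟧) (≡ᵇ-≢ (λ p → x≢0 (#≡0 x p)))) (ℤP.*-zeroʳ ⟦ C x ⟧)))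
    (cong₂ (λ a b → ⟦ a ⟧ ⋆ ⟦ b ≡ᵇ 0 ⟧) (IsLinear.zero∈ lin) (#-0w n))

  below : ∀ t → # t ℕ.< d → ∑C (λ u → ⟦ u ⊑ t ⟧) ≡ 1ℤ
  below t t<d = trans (∑C-cong point) ∑C-0w
    where
    point : ∀ u → u ∈C C → ⟦ u ⊑ t ⟧ ≡ ⟦ # u ≡ᵇ 0 ⟧
    point u u∈ with # u ℕP.≟ 0
    ... | yes p rewrite #≡0 u p = trans (cong ⟦_⟧ (0w-⊑ t)) (sym (cong (λ a → ⟦ a ≡ᵇ 0 ⟧) (#-0w n)))
    ... | no p with u ⊑ t in eq
    ...   | false = sym (cong ⟦_⟧ (≡ᵇ-≢ p))
    ...   | true = ⊥-elim (ℕP.<-irrefl refl (ℕP.<-≤-trans t<d (ℕP.≤-trans (min u u∈ (λ { refl → p (#-0w n) })) (⊑⇒#≤ u t eq))))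

  -- A word of weight d contained in t, or containing t, is t itself. Hence `count d t` is the
  -- indicator of t being a codeword, and it can be read in either direction.
  at-distance : ∀ t → # t ≡ d → ∑C (λ u → ⟦ u ⊑ t ⟧) ≡ 1ℤ ⊹ count d t
  at-distance t t≡d = trans (∑C-cong point) (trans (∑-cong (λ u → ℤP.*-distribˡ-+ ⟦ C u ⟧ _ _)) (trans (∑-+ _ _) (cong (_⊹ count d t) ∑C-0w)))
    where
    point : ∀ u → u ∈C C → ⟦ u ⊑ t ⟧ ≡ ⟦ # u ≡ᵇ 0 ⟧ ⊹ ⟦ t ⊑ u ⟧ ⋆ ⟦ # u ≡ᵇ d ⟧
    point u u∈ with # u ℕP.≟ 0
    ... | yes p rewrite #≡0 u p | #-0w n | 0w-⊑ t | ≡ᵇ-≢ (ℕP.<⇒≢ 0<d) = cong (1ℤ ⊹_) (sym (ℤP.*-zeroʳ ⟦ t ⊑ 0w n ⟧))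
    ... | no p rewrite ≡ᵇ-≢ p with # u ℕP.≟ d
    ...   | yes q rewrite q | ≡ᵇ-refl d = trans (cong ⟦_⟧ (swap (u ⊑ t) (t ⊑ u) refl refl)) (sym (trans (ℤP.+-identityˡ _) (ℤP.*-identityʳ _)))
      where
      swap : ∀ a b → (u ⊑ t) ≡ a → (t ⊑ u) ≡ b → a ≡ b
      swap false false _ _ = refl
      swap true true _ _ = refl
      swap true false e f with ⊑-antisym-# u t e (ℕP.≤-reflexive (trans t≡d (sym q)))
      ... | refl = trans (sym e) f
      swap false true e f with ⊑-antisym-# t u f (ℕP.≤-reflexive (trans q (sym t≡d)))
      ... | refl = trans (sym e) f
    ...   | no q rewrite ≡ᵇ-≢ q with u ⊑ t in eq
    ...     | false = sym (trans (ℤP.+-identityˡ _) (ℤP.*-zeroʳ ⟦ t ⊑ u ⟧))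
    ...     | true = ⊥-elim (q (ℕP.≤-antisym (subst (# u ℕ.≤_) t≡d (⊑⇒#≤ u t eq)) (min u u∈ (λ { refl → p (#-0w n) }))))

  -- `poisson₀` at the empty set says |C|² = 2^n.
  ∣C∣≡ : ∣C∣ ≡ 2^ k
  ∣C∣≡ = square-injective (∑-nonneg (λ x → subst (0ℤ ℤ.≤_) (sym (ℤP.*-identityʳ ⟦ C x ⟧)) (⟦⟧-nonneg (C x)))) (2^-nonneg k) (begin
    ∣C∣ ⋆ ∣C∣                                         ≡⟨ cong (∣C∣ ⋆_) (∑C-cong (λ c _ → sym (cong ⟦_⟧ (0w-⊑ c)))) ⟩
    ∣C∣ ⋆ ∑C (λ c → ⟦ 0w n ⊑ c ⟧)                     ≡⟨ poisson₀ (0w n) ⟩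
    ∑C (λ u → ⟦ u ⊑ 0w n ⟧) ⋆ (2^ co# (0w n))         ≡⟨ cong₂ _⋆_ (below (0w n) (subst (ℕ._< d) (sym (#-0w n)) 0<d)) (cong 2^_ (trans (cong (ℕ._+ co# (0w n)) (sym (#-0w n))) (#+co# (0w n)))) ⟩
    1ℤ ⋆ (2^ n)                                       ≡⟨ ℤP.*-identityˡ _ ⟩
    2^ n                                              ≡⟨ cong 2^_ n≡k+k ⟩
    2^ (k ℕ.+ k)                                      ≡⟨ 2^-+ k k ⟩
    (2^ k) ⋆ (2^ k)                                   ∎)
    where open ≡-Reasoning

  incidence : ∀ t → # t ℕ.≤ k → ∑C (λ c → ⟦ t ⊑ c ⟧) ≡ (2^ (k ℕ.∸ # t)) ⋆ ∑C (λ u → ⟦ u ⊑ t ⟧)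
  incidence t t≤k = *-cancelˡ (2^ k) (2^≢0 k) (begin
    (2^ k) ⋆ ∑C (λ c → ⟦ t ⊑ c ⟧)                     ≡⟨ cong (_⋆ _) (sym ∣C∣≡) ⟩
    ∣C∣ ⋆ ∑C (λ c → ⟦ t ⊑ c ⟧)                        ≡⟨ poisson₀ t ⟩
    E ⋆ (2^ co# t)                                    ≡⟨ cong (λ a → E ⋆ (2^ a)) exponent ⟩
    E ⋆ (2^ (k ℕ.+ (k ℕ.∸ # t)))                      ≡⟨ cong (E ⋆_) (2^-+ k (k ℕ.∸ # t)) ⟩
    E ⋆ ((2^ k) ⋆ (2^ (k ℕ.∸ # t)))                   ≡⟨ perm E (2^ k) _ ⟩
    (2^ k) ⋆ ((2^ (k ℕ.∸ # t)) ⋆ E)                   ∎)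
    where
    open ≡-Reasoning
    E : ℤ
    E = ∑C (λ u → ⟦ u ⊑ t ⟧)
    perm : ∀ a b c → a ⋆ (b ⋆ c) ≡ b ⋆ (c ⋆ a)
    perm = solve-∀
    exponent : co# t ≡ k ℕ.+ (k ℕ.∸ # t)
    exponent = ℕP.+-cancelˡ-≡ (# t) _ _ (trans (#+co# t) (trans n≡k+k (trans (cong (k ℕ.+_) (sym (ℕP.m+[n∸m]≡n t≤k)))
      (trans (sym (ℕP.+-assoc k (# t) _)) (trans (cong (ℕ._+ (k ℕ.∸ # t)) (ℕP.+-comm k (# t))) (ℕP.+-assoc (# t) k _))))))

-- Moments of intersection numbers

-- extend u t f = Σ f(t ∪ {i}) over i ∈ u ∖ t.
extend : ∀ {n} → Word n → Word n → (Word n → ℤ) → ℤ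
extend [] [] f = 0ℤ
extend (_ ∷ u) (true ∷ t) f = extend u t (λ x → f (true ∷ x))
extend (false ∷ u) (false ∷ t) f = extend u t (λ x → f (false ∷ x))
extend (true ∷ u) (false ∷ t) f = f (true ∷ t) ⊹ extend u t (λ x → f (false ∷ x))

_∩#_ : ∀ {n} → Word n → Word n → ℕ
[] ∩# [] = 0
(true ∷ c) ∩# (true ∷ u) = suc (c ∩# u)
(true ∷ c) ∩# (false ∷ u) = c ∩# u
(false ∷ c) ∩# (_ ∷ u) = c ∩# u

∩#-1w : ∀ {n} (c : Word n) → c ∩# 1w n ≡ # c
∩#-1w [] = refl
∩#-1w (false ∷ c) = ∩#-1w c
∩#-1w (true ∷ c) = cong suc (∩#-1w c)

extend-cong : ∀ {n} (u t : Word n) {f g : Word n → ℤ} → (t ⊑ u) ≡ true →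
  (∀ x → (x ⊑ u) ≡ true → # x ≡ suc (# t) → f x ≡ g x) → extend u t f ≡ extend u t g
extend-cong [] [] _ p = refl
extend-cong (true ∷ u) (true ∷ t) q p = extend-cong u t q (λ x r s → p (true ∷ x) r (cong suc s))
extend-cong (false ∷ u) (false ∷ t) q p = extend-cong u t q (λ x r s → p (false ∷ x) r s)
extend-cong (true ∷ u) (false ∷ t) q p = cong₂ _⊹_ (p (true ∷ t) q refl) (extend-cong u t q (λ x r s → p (false ∷ x) r s))

extend-const : ∀ {n} (u t : Word n) (a : ℤ) → (t ⊑ u) ≡ true → extend u t (λ _ → a) ≡ (+ # u ℤ.- + # t) ⋆ a
extend-const [] [] a q = refl
extend-const (true ∷ u) (true ∷ t) a q = trans (extend-const u t a q) (shift (+ # u) (+ # t) a)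
  where
  shift : ∀ m t a → (m ℤ.- t) ⋆ a ≡ ((1ℤ ⊹ m) ℤ.- (1ℤ ⊹ t)) ⋆ a
  shift = solve-∀
extend-const (false ∷ u) (false ∷ t) a q = extend-const u t a q
extend-const (true ∷ u) (false ∷ t) a q = trans (cong (a ⊹_) (extend-const u t a q)) (shift (+ # u) (+ # t) a)
  where
  shift : ∀ m t a → a ⊹ (m ℤ.- t) ⋆ a ≡ ((1ℤ ⊹ m) ℤ.- t) ⋆ a
  shift = solve-∀

extend-0 : ∀ {n} (u t : Word n) → extend u t (λ _ → 0ℤ) ≡ 0ℤ
extend-0 [] [] = refl
extend-0 (_ ∷ u) (true ∷ t) = extend-0 u t
extend-0 (false ∷ u) (false ∷ t) = extend-0 u t
extend-0 (true ∷ u) (false ∷ t) = trans (ℤP.+-identityˡ _) (extend-0 u t)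

extend-+ : ∀ {n} (u t : Word n) (f g : Word n → ℤ) → extend u t (λ x → f x ⊹ g x) ≡ extend u t f ⊹ extend u t g
extend-+ [] [] f g = refl
extend-+ (_ ∷ u) (true ∷ t) f g = extend-+ u t (λ x → f (true ∷ x)) (λ x → g (true ∷ x))
extend-+ (false ∷ u) (false ∷ t) f g = extend-+ u t (λ x → f (false ∷ x)) (λ x → g (false ∷ x))
extend-+ (true ∷ u) (false ∷ t) f g = trans (cong (f (true ∷ t) ⊹ g (true ∷ t) ⊹_) (extend-+ u t (λ x → f (false ∷ x)) (λ x → g (false ∷ x))))
  (interchange (f (true ∷ t)) (g (true ∷ t)) _ _)

extend-*ˡ : ∀ {n} (u t : Word n) (a : ℤ) (f : Word n → ℤ) → extend u t (λ x → a ⋆ f x) ≡ a ⋆ extend u t f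
extend-*ˡ [] [] a f = sym (ℤP.*-zeroʳ a)
extend-*ˡ (_ ∷ u) (true ∷ t) a f = extend-*ˡ u t a (λ x → f (true ∷ x))
extend-*ˡ (false ∷ u) (false ∷ t) a f = extend-*ˡ u t a (λ x → f (false ∷ x))
extend-*ˡ (true ∷ u) (false ∷ t) a f = trans (cong (a ⋆ f (true ∷ t) ⊹_) (extend-*ˡ u t a (λ x → f (false ∷ x)))) (sym (ℤP.*-distribˡ-+ a _ _))

extend-∑ : ∀ {m n} (u t : Word n) (f : Word n → Word m → ℤ) → extend u t (λ x → ∑ (f x)) ≡ ∑ (λ c → extend u t (λ x → f x c))
extend-∑ [] [] f = sym (∑-0 (λ _ → refl))
extend-∑ (_ ∷ u) (true ∷ t) f = extend-∑ u t (λ x → f (true ∷ x))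
extend-∑ (false ∷ u) (false ∷ t) f = extend-∑ u t (λ x → f (false ∷ x))
extend-∑ (true ∷ u) (false ∷ t) f = trans (cong (∑ (f (true ∷ t)) ⊹_) (extend-∑ u t (λ x → f (false ∷ x)))) (sym (∑-+ _ _))

extend-⊑ : ∀ {n} (u t c : Word n) → (t ⊑ u) ≡ true → extend u t (λ x → ⟦ x ⊑ c ⟧) ≡ ⟦ t ⊑ c ⟧ ⋆ (+ (c ∩# u) ℤ.- + # t)
extend-⊑ [] [] [] q = refl
extend-⊑ (true ∷ u) (true ∷ t) (false ∷ c) q = extend-0 u t
extend-⊑ (true ∷ u) (true ∷ t) (true ∷ c) q = trans (extend-⊑ u t c q) (shift (+ (c ∩# u)) (+ # t) ⟦ t ⊑ c ⟧)
  where
  shift : ∀ m t a → a ⋆ (m ℤ.- t) ≡ a ⋆ ((1ℤ ⊹ m) ℤ.- (1ℤ ⊹ t))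
  shift = solve-∀
extend-⊑ (false ∷ u) (false ∷ t) (false ∷ c) q = extend-⊑ u t c q
extend-⊑ (false ∷ u) (false ∷ t) (true ∷ c) q = extend-⊑ u t c q
extend-⊑ (true ∷ u) (false ∷ t) (false ∷ c) q = trans (ℤP.+-identityˡ _) (extend-⊑ u t c q)
extend-⊑ (true ∷ u) (false ∷ t) (true ∷ c) q = trans (cong (⟦ t ⊑ c ⟧ ⊹_) (extend-⊑ u t c q)) (shift (+ (c ∩# u)) (+ # t) ⟦ t ⊑ c ⟧)
  where
  shift : ∀ m t a → a ⊹ a ⋆ (m ℤ.- t) ≡ a ⋆ ((1ℤ ⊹ m) ℤ.- t)
  shift = solve-∀

Π : List ℤ → ℤ → ℤ
Π List.[] x = 1ℤ
Π (ρ List.∷ ρs) x = (x ℤ.- ρ) ⋆ Π ρs x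

fact : ℕ → ℤ
fact zero = 1ℤ
fact (suc k) = + suc k ⋆ fact k

-- The value of Σ_{c ⊇ t} Π ρs |c ∩ u| when the number of c containing a given i-subset of u is L i and s = |u|.
momentValue : (L : ℕ → ℤ) (s : ℤ) → ℕ → List ℤ → ℤ
momentValue L s t List.[] = L t
momentValue L s t (ρ List.∷ ρs) = (s ℤ.- + t) ⋆ momentValue L s (suc t) ρs ⊹ (+ t ℤ.- ρ) ⋆ momentValue L s t ρs

module Moments {n} (u : Word n) (g : Word n → ℤ) where

  moment : Word n → List ℤ → ℤ
  moment t ρs = ∑ (λ c → g c ⋆ (⟦ t ⊑ c ⟧ ⋆ Π ρs (+ (c ∩# u))))

  extend-moment : ∀ t ρs → (t ⊑ u) ≡ true →
    extend u t (λ x → moment x ρs) ≡ ∑ (λ c → g c ⋆ (⟦ t ⊑ c ⟧ ⋆ ((+ (c ∩# u) ℤ.- + # t) ⋆ Π ρs (+ (c ∩# u)))))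
  extend-moment t ρs q = trans (extend-∑ u t (λ x c → g c ⋆ (⟦ x ⊑ c ⟧ ⋆ P c))) (∑-cong λ c → begin
    extend u t (λ x → g c ⋆ (⟦ x ⊑ c ⟧ ⋆ P c))                  ≡⟨ extend-cong u t q (λ x _ _ → perm (g c) ⟦ x ⊑ c ⟧ (P c)) ⟩
    extend u t (λ x → (g c ⋆ P c) ⋆ ⟦ x ⊑ c ⟧)                  ≡⟨ extend-*ˡ u t (g c ⋆ P c) (λ x → ⟦ x ⊑ c ⟧) ⟩
    (g c ⋆ P c) ⋆ extend u t (λ x → ⟦ x ⊑ c ⟧)                  ≡⟨ cong ((g c ⋆ P c) ⋆_) (extend-⊑ u t c q) ⟩
    (g c ⋆ P c) ⋆ (⟦ t ⊑ c ⟧ ⋆ (+ (c ∩# u) ℤ.- + # t))          ≡⟨ perm′ (g c) (P c) ⟦ t ⊑ c ⟧ (+ (c ∩# u) ℤ.- + # t) ⟩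
    g c ⋆ (⟦ t ⊑ c ⟧ ⋆ ((+ (c ∩# u) ℤ.- + # t) ⋆ P c))          ∎)
    where
    open ≡-Reasoning
    P : Word n → ℤ
    P c = Π ρs (+ (c ∩# u))
    perm : ∀ a b c → a ⋆ (b ⋆ c) ≡ (a ⋆ c) ⋆ b
    perm = solve-∀
    perm′ : ∀ a b c d → (a ⋆ b) ⋆ (c ⋆ d) ≡ a ⋆ (c ⋆ (d ⋆ b))
    perm′ = solve-∀

  -- Split the factor as (|c ∩ u| - |t|) + (|t| - ρ). For c containing t the first part counts the
  -- points of u that can be added to t inside c, so it turns a sum over c into a sum over larger
  -- sets.
  moment-∷ : ∀ t ρ ρs → (t ⊑ u) ≡ true → moment t (ρ List.∷ ρs) ≡ extend u t (λ x → moment x ρs) ⊹ (+ # t ℤ.- ρ) ⋆ moment t ρs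
  moment-∷ t ρ ρs q = sym (trans (cong₂ _⊹_ (extend-moment t ρs q) (sym (∑-*ˡ (+ # t ℤ.- ρ) _)))
    (trans (sym (∑-+ _ _)) (∑-cong (λ c → split (g c) ⟦ t ⊑ c ⟧ (+ (c ∩# u)) (+ # t) ρ (Π ρs (+ (c ∩# u)))))))
    where
    split : ∀ g a m t ρ p → g ⋆ (a ⋆ ((m ℤ.- t) ⋆ p)) ⊹ (t ℤ.- ρ) ⋆ (g ⋆ (a ⋆ p)) ≡ g ⋆ (a ⋆ ((m ℤ.- ρ) ⋆ p))
    split = solve-∀

  -- `K` is the size at which the count may first deviate from a function of |t|, by `κ` times `λ′`.
  -- There are two uses: all codewords against the all-one word, with `K` = d and `λ′` = `count d`,
  -- and the blocks of D_d against a codeword, with `κ` = 0.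
  module Values (L : ℕ → ℤ) (K : ℕ) (κ : ℤ) (λ′ : Word n → ℤ)
    (low : ∀ t → (t ⊑ u) ≡ true → # t ℕ.< K → moment t List.[] ≡ L (# t))
    (top : ∀ t → (t ⊑ u) ≡ true → # t ≡ K → moment t List.[] ≡ L K ⊹ κ ⋆ λ′ t)
    (λ-extend : ∀ t → (t ⊑ u) ≡ true → # t ℕ.< K → extend u t λ′ ≡ (+ K ℤ.- + # t) ⋆ λ′ t) where

    V : ℕ → List ℤ → ℤ
    V = momentValue L (+ # u)

    moment-low : ∀ t ρs → (t ⊑ u) ≡ true → # t ℕ.+ List.length ρs ℕ.< K → moment t ρs ≡ V (# t) ρs
    moment-low t List.[] q p = low t q (subst (ℕ._< K) (ℕP.+-identityʳ (# t)) p)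
    moment-low t (ρ List.∷ ρs) q p = trans (moment-∷ t ρ ρs q) (cong₂ _⊹_
      (trans (extend-cong u t q (λ x r s → trans (moment-low x ρs r (subst (λ a → a ℕ.+ List.length ρs ℕ.< K) (sym s) p′)) (cong (λ a → V a ρs) s)))
             (extend-const u t _ q))
      (cong ((+ # t ℤ.- ρ) ⋆_) (moment-low t ρs q (ℕP.<-trans (ℕP.n<1+n _) p′))))
      where
      p′ : suc (# t ℕ.+ List.length ρs) ℕ.< K
      p′ = subst (ℕ._< K) (ℕP.+-suc (# t) _) p

    -- Only the branch that enlarges t at every root reaches sets of size `K`, so it alone carries
    -- the extra term. Each enlargement contributes `K` - |t|, the number of roots still to be
    -- treated; these numbers multiply to the factorial.
    moment-top : ∀ t ρs → (t ⊑ u) ≡ true → # t ℕ.+ List.length ρs ≡ K →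
      moment t ρs ≡ V (# t) ρs ⊹ κ ⋆ (fact (List.length ρs) ⋆ λ′ t)
    moment-top t List.[] q p = trans (top t q t≡K) (cong₂ (λ a b → L a ⊹ κ ⋆ b) (sym t≡K) (sym (ℤP.*-identityˡ _)))
      where
      t≡K : # t ≡ K
      t≡K = trans (sym (ℕP.+-identityʳ (# t))) p
    moment-top t (ρ List.∷ ρs) q p = begin
      moment t (ρ List.∷ ρs)
        ≡⟨ moment-∷ t ρ ρs q ⟩
      extend u t (λ x → moment x ρs) ⊹ (+ # t ℤ.- ρ) ⋆ moment t ρs
        ≡⟨ cong₂ _⊹_ (extend-cong u t q (λ x r s → trans (moment-top x ρs r (trans (cong (ℕ._+ List.length ρs) s) p′))
                                                        (cong (λ a → V a ρs ⊹ κ ⋆ (F ⋆ λ′ x)) s)))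
             (cong ((+ # t ℤ.- ρ) ⋆_) (moment-low t ρs q (ℕP.≤-reflexive p′))) ⟩
      extend u t (λ x → V (suc (# t)) ρs ⊹ κ ⋆ (F ⋆ λ′ x)) ⊹ W
        ≡⟨ cong (_⊹ W) (trans (extend-+ u t _ (λ x → κ ⋆ (F ⋆ λ′ x))) (cong₂ _⊹_ (extend-const u t _ q)
             (trans (extend-*ˡ u t κ (λ x → F ⋆ λ′ x)) (cong (κ ⋆_) (trans (extend-*ˡ u t F λ′) (cong (F ⋆_) (λ-extend t q t<K))))))) ⟩
      ((+ # u ℤ.- + # t) ⋆ V (suc (# t)) ρs ⊹ κ ⋆ (F ⋆ ((+ K ℤ.- + # t) ⋆ λ′ t))) ⊹ W
        ≡⟨ cong (λ a → ((+ # u ℤ.- + # t) ⋆ V (suc (# t)) ρs ⊹ κ ⋆ (F ⋆ (a ⋆ λ′ t))) ⊹ W) K-t ⟩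
      ((+ # u ℤ.- + # t) ⋆ V (suc (# t)) ρs ⊹ κ ⋆ (F ⋆ (+ suc (List.length ρs) ⋆ λ′ t))) ⊹ W
        ≡⟨ perm ((+ # u ℤ.- + # t) ⋆ V (suc (# t)) ρs) κ F (+ suc (List.length ρs)) (λ′ t) W ⟩
      V (# t) (ρ List.∷ ρs) ⊹ κ ⋆ ((+ suc (List.length ρs) ⋆ F) ⋆ λ′ t) ∎
      where
      open ≡-Reasoning
      F W : ℤ
      F = fact (List.length ρs)
      W = (+ # t ℤ.- ρ) ⋆ V (# t) ρs
      p′ : suc (# t) ℕ.+ List.length ρs ≡ K
      p′ = trans (sym (ℕP.+-suc (# t) _)) p
      t<K : # t ℕ.< K
      t<K = ℕP.≤-trans (ℕP.m≤m+n _ _) (ℕP.≤-reflexive p′)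
      K-t : + K ℤ.- + # t ≡ + suc (List.length ρs)
      K-t = trans (cong (λ a → + a ℤ.- + # t) (sym p)) (cancel (+ # t) (+ suc (List.length ρs)))
        where
        cancel : ∀ a b → (a ⊹ b) ℤ.- a ≡ b
        cancel = solve-∀
      perm : ∀ a k f s l w → (a ⊹ k ⋆ (f ⋆ (s ⋆ l))) ⊹ w ≡ (a ⊹ w) ⊹ k ⋆ ((s ⋆ f) ⋆ l)
      perm = solve-∀

-- Power series with integer coefficients

infix 4 _≋_
record _≋_ (f g : Series) : Set where
  constructor pointwise
  field at : ∀ i → f i ≡ g i
open _≋_ public

infixl 6 _⊞_
infixl 7 _⊠_
infix 8 ⊟_

tail : Series → Series
tail f i = f (suc i)

0ₛ : Series
0ₛ _ = 0ℤ

opaque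
  _⊞_ _⊠_ : Series → Series → Series
  (f ⊞ g) i = f i ⊹ g i
  (f ⊠ g) zero = f 0 ⋆ g 0
  (f ⊠ g) (suc i) = f 0 ⋆ g (suc i) ⊹ (tail f ⊠ g) i

  ⊟_ : Series → Series
  (⊟ f) i = ℤ.- f i

  ⊞-at : ∀ f g i → (f ⊞ g) i ≡ f i ⊹ g i
  ⊞-at f g i = refl

  ⊠-zero : ∀ f g → (f ⊠ g) 0 ≡ f 0 ⋆ g 0
  ⊠-zero f g = refl

  ⊟-at : ∀ f i → (⊟ f) i ≡ ℤ.- f i
  ⊟-at f i = refl

  ⊠-cong : ∀ {f f′ g g′} → (∀ i → f i ≡ f′ i) → (∀ i → g i ≡ g′ i) → ∀ i → (f ⊠ g) i ≡ (f′ ⊠ g′) i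
  ⊠-cong p q zero = cong₂ _⋆_ (p 0) (q 0)
  ⊠-cong p q (suc i) = cong₂ _⊹_ (cong₂ _⋆_ (p 0) (q (suc i))) (⊠-cong (λ j → p (suc j)) q i)

  ⊠-distribʳ : ∀ h f g i → ((f ⊞ g) ⊠ h) i ≡ (f ⊠ h) i ⊹ (g ⊠ h) i
  ⊠-distribʳ h f g zero = ℤP.*-distribʳ-+ (h 0) (f 0) (g 0)
  ⊠-distribʳ h f g (suc i) = trans (cong₂ _⊹_ (ℤP.*-distribʳ-+ (h (suc i)) (f 0) (g 0)) (⊠-distribʳ h (tail f) (tail g) i))
    (interchange (f 0 ⋆ h (suc i)) (g 0 ⋆ h (suc i)) _ _)

  ⊠-zeroˡ : ∀ f i → (0ₛ ⊠ f) i ≡ 0ℤ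
  ⊠-zeroˡ f zero = refl
  ⊠-zeroˡ f (suc i) = trans (ℤP.+-identityˡ _) (⊠-zeroˡ f i)

  ⊠-identityˡ : ∀ f i → (δ₀ ⊠ f) i ≡ f i
  ⊠-identityˡ f zero = ℤP.*-identityˡ (f 0)
  ⊠-identityˡ f (suc i) = trans (cong₂ _⊹_ (ℤP.*-identityˡ (f (suc i))) (⊠-zeroˡ f i)) (ℤP.+-identityʳ _)

  -- The product is defined by peeling its left factor; commutativity rests on peeling the right
  -- one.
  ⊠-sucʳ : ∀ f g i → (f ⊠ g) (suc i) ≡ f (suc i) ⋆ g 0 ⊹ (f ⊠ tail g) i
  ⊠-sucʳ f g zero = ℤP.+-comm (f 0 ⋆ g 1) (f 1 ⋆ g 0)
  ⊠-sucʳ f g (suc i) = trans (cong (f 0 ⋆ g (suc (suc i)) ⊹_) (⊠-sucʳ (tail f) g i)) (swap (f 0 ⋆ g (suc (suc i))) (f (suc (suc i)) ⋆ g 0) _)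
    where
    swap : ∀ a b c → a ⊹ (b ⊹ c) ≡ b ⊹ (a ⊹ c)
    swap = solve-∀

  ⊠-comm : ∀ f g i → (f ⊠ g) i ≡ (g ⊠ f) i
  ⊠-comm f g zero = ℤP.*-comm (f 0) (g 0)
  ⊠-comm f g (suc i) = trans (cong₂ _⊹_ (ℤP.*-comm (f 0) (g (suc i))) (⊠-comm (tail f) g i)) (sym (⊠-sucʳ g f i))

  ⊠-scale : ∀ a f g i → ((λ j → a ⋆ f j) ⊠ g) i ≡ a ⋆ (f ⊠ g) i
  ⊠-scale a f g zero = ℤP.*-assoc a (f 0) (g 0)
  ⊠-scale a f g (suc i) = trans (cong₂ _⊹_ (ℤP.*-assoc a (f 0) (g (suc i))) (⊠-scale a (tail f) g i)) (sym (ℤP.*-distribˡ-+ a _ _))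

  ⊠-assoc : ∀ f g h i → ((f ⊠ g) ⊠ h) i ≡ (f ⊠ (g ⊠ h)) i
  ⊠-assoc f g h zero = ℤP.*-assoc (f 0) (g 0) (h 0)
  ⊠-assoc f g h (suc i) = trans
    (cong (f 0 ⋆ g 0 ⋆ h (suc i) ⊹_) (trans (⊠-distribʳ h (λ j → f 0 ⋆ tail g j) (tail f ⊠ g) i)
      (cong₂ _⊹_ (⊠-scale (f 0) (tail g) h i) (⊠-assoc (tail f) g h i))))
    (regroup (f 0) (g 0) (h (suc i)) _ _)
    where
    regroup : ∀ a b c d e → a ⋆ b ⋆ c ⊹ (a ⋆ d ⊹ e) ≡ a ⋆ (b ⋆ c ⊹ d) ⊹ e
    regroup = solve-∀

  series-isCommutativeRing : IsCommutativeRing _≋_ _⊞_ _⊠_ ⊟_ 0ₛ δ₀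
  series-isCommutativeRing = record
      { isRing = record
        { +-isAbelianGroup = record
          { isGroup = record
            { isMonoid = record
              { isSemigroup = record
                { isMagma = record
                  { isEquivalence = record
                    { refl = pointwise (λ _ → refl)
                    ; sym = λ p → pointwise (λ i → sym (at p i))
                    ; trans = λ p q → pointwise (λ i → trans (at p i) (at q i)) }
                  ; ∙-cong = λ p q → pointwise (λ i → cong₂ _⊹_ (at p i) (at q i)) }
                ; assoc = λ f g h → pointwise (λ i → ℤP.+-assoc (f i) (g i) (h i)) }
              ; identity = (λ f → pointwise (λ i → ℤP.+-identityˡ (f i))) , (λ f → pointwise (λ i → ℤP.+-identityʳ (f i))) }
            ; inverse = (λ f → pointwise (λ i → ℤP.+-inverseˡ (f i))) , (λ f → pointwise (λ i → ℤP.+-inverseʳ (f i)))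
            ; ⁻¹-cong = λ p → pointwise (λ i → cong ℤ.-_ (at p i)) }
          ; comm = λ f g → pointwise (λ i → ℤP.+-comm (f i) (g i)) }
        ; *-cong = λ p q → pointwise (⊠-cong (at p) (at q))
        ; *-assoc = λ f g h → pointwise (⊠-assoc f g h)
        ; *-identity = (λ f → pointwise (⊠-identityˡ f)) , (λ f → pointwise (λ i → trans (⊠-comm f δ₀ i) (⊠-identityˡ f i)))
        ; distrib = (λ f g h → pointwise (λ i → trans (⊠-comm f (g ⊞ h) i) (trans (⊠-distribʳ f g h i) (cong₂ _⊹_ (⊠-comm g f i) (⊠-comm h f i)))))
                  , (λ h f g → pointwise (⊠-distribʳ h f g)) }
      ; *-comm = λ f g → pointwise (⊠-comm f g) }

seriesRing : CommutativeRing 0ℓ 0ℓ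
seriesRing = record { isCommutativeRing = series-isCommutativeRing }

module S = CommutativeRing seriesRing
open SemiringSolver S.commutativeSemiring using (solve; con; _:=_; _:+_; _:*_) public
module ≋R = SetoidReasoning S.setoid

infixr 9 _↑_
_↑_ : Series → ℕ → Series
f ↑ zero = δ₀
f ↑ suc n = f ⊠ f ↑ n

↑-+ : ∀ f a b → f ↑ (a ℕ.+ b) ≋ f ↑ a ⊠ f ↑ b
↑-+ f zero b = S.sym (S.*-identityˡ _)
↑-+ f (suc a) b = S.trans (S.*-congˡ (↑-+ f a b)) (S.sym (S.*-assoc f (f ↑ a) (f ↑ b)))

↑-⊠ : ∀ f g n → (f ⊠ g) ↑ n ≋ f ↑ n ⊠ g ↑ n
↑-⊠ f g zero = S.sym (S.*-identityˡ δ₀)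
↑-⊠ f g (suc n) = S.trans (S.*-congˡ (↑-⊠ f g n)) (solve 4 (λ a b c d → (a :* b) :* (c :* d) := (a :* c) :* (b :* d)) S.refl f g _ _)

↑-cong : ∀ {f g} n → f ≋ g → f ↑ n ≋ g ↑ n
↑-cong zero p = S.refl
↑-cong (suc n) p = S.*-cong p (↑-cong n p)

δ₀-↑ : ∀ n → δ₀ ↑ n ≋ δ₀
δ₀-↑ zero = S.refl
δ₀-↑ (suc n) = S.trans (S.*-identityˡ _) (δ₀-↑ n)

inverse-↑ : ∀ {f g} n → f ⊠ g ≋ δ₀ → f ↑ n ⊠ g ↑ n ≋ δ₀
inverse-↑ {f} {g} n p = S.trans (S.sym (↑-⊠ f g n)) (S.trans (↑-cong n p) (δ₀-↑ n))

↑-zero : ∀ {f} n → f 0 ≡ 1ℤ → (f ↑ n) 0 ≡ 1ℤ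
↑-zero zero p = refl
↑-zero {f} (suc n) p = trans (⊠-zero f (f ↑ n)) (cong₂ _⋆_ p (↑-zero n p))

z : Series
z zero = 0ℤ
z (suc i) = δ₀ i

opaque
  unfolding _⊞_

  z⊠ : ∀ f → z ⊠ f ≋ z∙ f
  z⊠ f = pointwise λ { zero → refl ; (suc i) → trans (ℤP.+-identityˡ _) (⊠-identityˡ f i) }

  ⊠-linear : ∀ {n} (κ : Series) (g : Word n → ℤ) (F : Word n → Series) i →
    ∑ (λ c → g c ⋆ (κ ⊠ F c) i) ≡ (κ ⊠ (λ j → ∑ (λ c → g c ⋆ F c j))) i
  ⊠-linear κ g F zero = trans (∑-cong (λ c → perm (g c) (κ 0) (F c 0))) (∑-*ˡ (κ 0) (λ c → g c ⋆ F c 0))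
    where
    perm : ∀ a b c → a ⋆ (b ⋆ c) ≡ b ⋆ (a ⋆ c)
    perm = solve-∀
  ⊠-linear κ g F (suc i) = trans (∑-cong (λ c → perm (g c) (κ 0) (F c (suc i)) ((tail κ ⊠ F c) i)))
    (trans (∑-+ (λ c → κ 0 ⋆ (g c ⋆ F c (suc i))) (λ c → g c ⋆ (tail κ ⊠ F c) i))
      (cong₂ _⊹_ (∑-*ˡ (κ 0) (λ c → g c ⋆ F c (suc i))) (⊠-linear (tail κ) g F i)))
    where
    perm : ∀ a b c d → a ⋆ (b ⋆ c ⊹ d) ≡ b ⋆ (a ⋆ c) ⊹ a ⋆ d
    perm = solve-∀

  ⊠-constant : ∀ κ H i → (∀ j → j ℕ.< i → H (suc j) ≡ 0ℤ) → (κ ⊠ H) i ≡ κ i ⋆ H 0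
  ⊠-constant κ H zero p = refl
  ⊠-constant κ H (suc i) p = trans (cong₂ _⊹_ (trans (cong (κ 0 ⋆_) (p i ℕP.≤-refl)) (ℤP.*-zeroʳ (κ 0)))
    (⊠-constant (tail κ) H i (λ j j<i → p j (ℕP.m<n⇒m<1+n j<i)))) (ℤP.+-identityˡ _)

  -- The derivation z d/dz.
  θ : Series → Series
  θ f i = + i ⋆ f i

  θ-at : ∀ f i → θ f i ≡ + i ⋆ f i
  θ-at f i = refl

  θ-⊠-at : ∀ f g i → θ (f ⊠ g) i ≡ (θ f ⊠ g) i ⊹ (f ⊠ θ g) i
  θ-⊠-at f g zero = sym (trans (ℤP.+-identityˡ _) (ℤP.*-zeroʳ (f 0)))
  θ-⊠-at f g (suc i) = begin
    + suc i ⋆ (f 0 ⋆ g (suc i) ⊹ (tail f ⊠ g) i)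
      ≡⟨ expand (+ i) (f 0) (g (suc i)) ((tail f ⊠ g) i) ⟩
    f 0 ⋆ ((1ℤ ⊹ + i) ⋆ g (suc i)) ⊹ ((tail f ⊠ g) i ⊹ θ (tail f ⊠ g) i)
      ≡⟨ cong (λ a → f 0 ⋆ (+ suc i ⋆ g (suc i)) ⊹ ((tail f ⊠ g) i ⊹ a)) (θ-⊠-at (tail f) g i) ⟩
    f 0 ⋆ (+ suc i ⋆ g (suc i)) ⊹ ((tail f ⊠ g) i ⊹ ((θ (tail f) ⊠ g) i ⊹ (tail f ⊠ θ g) i))
      ≡⟨ regroup (f 0 ⋆ (+ suc i ⋆ g (suc i))) ((tail f ⊠ g) i) ((θ (tail f) ⊠ g) i) ((tail f ⊠ θ g) i) (g (suc i)) ⟩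
    (0ℤ ⋆ g (suc i) ⊹ ((tail f ⊠ g) i ⊹ (θ (tail f) ⊠ g) i)) ⊹ (f 0 ⋆ (+ suc i ⋆ g (suc i)) ⊹ (tail f ⊠ θ g) i)
      ≡⟨ cong (λ a → (0ℤ ⋆ g (suc i) ⊹ a) ⊹ (f 0 ⋆ (+ suc i ⋆ g (suc i)) ⊹ (tail f ⊠ θ g) i))
           (trans (sym (⊠-distribʳ g (tail f) (θ (tail f)) i)) (⊠-cong (λ j → sym (tail-θ (+ j) (f (suc j)))) (λ _ → refl) i)) ⟩
    (θ f ⊠ g) (suc i) ⊹ (f ⊠ θ g) (suc i) ∎
    where
    open ≡-Reasoning
    expand : ∀ i a b c → (1ℤ ⊹ i) ⋆ (a ⋆ b ⊹ c) ≡ a ⋆ ((1ℤ ⊹ i) ⋆ b) ⊹ (c ⊹ i ⋆ c)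
    expand = solve-∀
    regroup : ∀ a b c d g → a ⊹ (b ⊹ (c ⊹ d)) ≡ (0ℤ ⋆ g ⊹ (b ⊹ c)) ⊹ (a ⊹ d)
    regroup = solve-∀
    tail-θ : ∀ j a → (1ℤ ⊹ j) ⋆ a ≡ a ⊹ j ⋆ a
    tail-θ = solve-∀

  θ-⊠ : ∀ f g → θ (f ⊠ g) ≋ θ f ⊠ g ⊞ f ⊠ θ g
  θ-⊠ f g = pointwise (θ-⊠-at f g)

  θ-⊞ : ∀ f g → θ (f ⊞ g) ≋ θ f ⊞ θ g
  θ-⊞ f g = pointwise λ i → ℤP.*-distribˡ-+ (+ i) (f i) (g i)

  θ-cong : ∀ {f g} → f ≋ g → θ f ≋ θ g
  θ-cong p = pointwise λ i → cong (+ i ⋆_) (at p i)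

  θ-δ₀ : θ δ₀ ≋ 0ₛ
  θ-δ₀ = pointwise λ { zero → refl ; (suc i) → ℤP.*-zeroʳ (+ suc i) }

  θ-z : θ z ≋ z
  θ-z = pointwise λ { zero → refl ; (suc zero) → refl ; (suc (suc i)) → ℤP.*-zeroʳ (+ suc (suc i)) }

θ-↑ : ∀ g M i → θ (g ↑ suc M) i ≡ + suc M ⋆ (g ↑ M ⊠ θ g) i
θ-↑ g zero i = trans (at (θ-cong (S.*-identityʳ g)) i) (sym (trans (ℤP.*-identityˡ _) (at (S.*-identityˡ (θ g)) i)))
θ-↑ g (suc M) i = begin
  θ (g ⊠ g ↑ suc M) i                                              ≡⟨ at (θ-⊠ g (g ↑ suc M)) i ⟩
  (θ g ⊠ g ↑ suc M ⊞ g ⊠ θ (g ↑ suc M)) i                          ≡⟨ ⊞-at (θ g ⊠ g ↑ suc M) _ i ⟩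
  (θ g ⊠ g ↑ suc M) i ⊹ (g ⊠ θ (g ↑ suc M)) i                      ≡⟨ cong₂ _⊹_ (at (S.*-comm (θ g) (g ↑ suc M)) i) step ⟩
  (g ↑ suc M ⊠ θ g) i ⊹ + suc M ⋆ (g ↑ suc M ⊠ θ g) i              ≡⟨ collect (+ suc M) _ ⟩
  + suc (suc M) ⋆ (g ↑ suc M ⊠ θ g) i                              ∎
  where
  open ≡-Reasoning
  collect : ∀ a b → b ⊹ a ⋆ b ≡ (1ℤ ⊹ a) ⋆ b
  collect = solve-∀
  step : (g ⊠ θ (g ↑ suc M)) i ≡ + suc M ⋆ (g ↑ suc M ⊠ θ g) i
  step = begin
    (g ⊠ θ (g ↑ suc M)) i                              ≡⟨ at (S.*-comm g _) i ⟩
    (θ (g ↑ suc M) ⊠ g) i                              ≡⟨ at (S.*-congʳ (pointwise {g = λ j → + suc M ⋆ (g ↑ M ⊠ θ g) j} (θ-↑ g M))) i ⟩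
    ((λ j → + suc M ⋆ (g ↑ M ⊠ θ g) j) ⊠ g) i          ≡⟨ ⊠-scale (+ suc M) (g ↑ M ⊠ θ g) g i ⟩
    + suc M ⋆ ((g ↑ M ⊠ θ g) ⊠ g) i                    ≡⟨ cong (+ suc M ⋆_) (at (solve 3 (λ a b c → (a :* b) :* c := (c :* a) :* b) S.refl (g ↑ M) (θ g) g) i) ⟩
    + suc M ⋆ (g ↑ suc M ⊠ θ g) i                      ∎

-- 4 k with its successors exposed, so that coefficient functions compute.
four : ℕ → ℕ
four zero = 0
four (suc k) = suc (suc (suc (suc (four k))))

four≡ : ∀ k → four k ≡ 4 ℕ.* k
four≡ zero = refl
four≡ (suc k) = trans (cong (4 ℕ.+_) (four≡ k)) (sym (ℕP.*-suc 4 k))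

-- As (1 - z)(1 + z)(1 + z²) = 1 - z⁴, each factor is inverted by the other two times `G`; `e` is 1
-- / (1 + z²). Fourth powers appear because the weights advance in steps of four.
p q s G e p⁻¹ q⁻¹ X Y X⁻¹ : Series
p = δ₀ ⊞ z
q = δ₀ ⊞ ⊟ z
s = δ₀ ⊞ z ⊠ z
-- 1 / (1 - z⁴)
G zero = 1ℤ
G (suc zero) = 0ℤ
G (suc (suc zero)) = 0ℤ
G (suc (suc (suc zero))) = 0ℤ
G (suc (suc (suc (suc i)))) = G i
e = p ⊠ q ⊠ G
p⁻¹ = q ⊠ s ⊠ G
q⁻¹ = p ⊠ s ⊠ G
X = q ⊠ q ⊠ q ⊠ q
Y = p ⊠ p ⊠ p ⊠ p
X⁻¹ = q⁻¹ ⊠ q⁻¹ ⊠ q⁻¹ ⊠ q⁻¹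

-- Replacing 1 by (1 - z) + z turns identities between 1 + z, 1 - z and 1 + z² into subtraction-free
-- ones in `q` and `z`, which can be normalised as semiring identities.
q⊞z : q ⊞ z ≋ δ₀
q⊞z = S.trans (S.+-assoc δ₀ (⊟ z) z) (S.trans (S.+-congˡ (S.-‿inverseˡ z)) (S.+-identityʳ δ₀))

p≋ : p ≋ q ⊞ z ⊞ z
p≋ = S.+-congʳ (S.sym q⊞z)

s≋ : s ≋ (q ⊞ z) ⊠ (q ⊞ z) ⊞ z ⊠ z
s≋ = S.+-congʳ (S.sym (S.trans (S.*-cong q⊞z q⊞z) (S.*-identityˡ δ₀)))

z⊠-suc : ∀ f i → (z ⊠ f) (suc i) ≡ f i
z⊠-suc f i = at (z⊠ f) (suc i)

z⁴ : ∀ f → Series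
z⁴ f = z ⊠ (z ⊠ (z ⊠ (z ⊠ f)))

G≋ : G ≋ δ₀ ⊞ z⁴ G
G≋ = pointwise go
  where
  v : ∀ f → (z ⊠ f) 0 ≡ 0ℤ
  v f = at (z⊠ f) 0
  go : ∀ i → G i ≡ (δ₀ ⊞ z⁴ G) i
  go zero = sym (trans (⊞-at δ₀ _ 0) (cong (1ℤ ⊹_) (v _)))
  go (suc zero) = sym (trans (⊞-at δ₀ _ 1) (cong (0ℤ ⊹_) (trans (z⊠-suc _ 0) (v _))))
  go (suc (suc zero)) = sym (trans (⊞-at δ₀ _ 2) (cong (0ℤ ⊹_) (trans (z⊠-suc _ 1) (trans (z⊠-suc _ 0) (v _)))))
  go (suc (suc (suc zero))) = sym (trans (⊞-at δ₀ _ 3) (cong (0ℤ ⊹_) (trans (z⊠-suc _ 2) (trans (z⊠-suc _ 1) (trans (z⊠-suc _ 0) (v _))))))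
  go (suc (suc (suc (suc i)))) = sym (trans (⊞-at δ₀ _ (4 ℕ.+ i)) (trans (ℤP.+-identityˡ _)
    (trans (z⊠-suc _ (3 ℕ.+ i)) (trans (z⊠-suc _ (2 ℕ.+ i)) (trans (z⊠-suc _ (1 ℕ.+ i)) (z⊠-suc _ i))))))

-- After adding z⁴ G on both sides, the left is (1 - z⁴) G + z⁴ G = ((1 - z) + z)⁴ G = G, and the
-- right is the recursion of `G`.
pqsG : p ⊠ q ⊠ s ⊠ G ≋ δ₀
pqsG = GroupProperties.∙-cancelʳ S.+-group (z⁴ G) _ _ (begin
  p ⊠ q ⊠ s ⊠ G ⊞ z⁴ G                                                             ≈⟨ S.+-congʳ (S.*-congʳ (S.*-cong (S.*-congʳ p≋) s≋)) ⟩
  (q ⊞ z ⊞ z) ⊠ q ⊠ ((q ⊞ z) ⊠ (q ⊞ z) ⊞ z ⊠ z) ⊠ G ⊞ z⁴ G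
    ≈⟨ solve 3 (λ q z g → (q :+ z :+ z) :* q :* ((q :+ z) :* (q :+ z) :+ z :* z) :* g :+ z :* (z :* (z :* (z :* g)))
                  := (q :+ z) :* (q :+ z) :* (q :+ z) :* (q :+ z) :* g) S.refl q z G ⟩
  (q ⊞ z) ⊠ (q ⊞ z) ⊠ (q ⊞ z) ⊠ (q ⊞ z) ⊠ G                                        ≈⟨ S.*-congʳ (S.*-cong (S.*-cong (S.*-cong q⊞z q⊞z) q⊞z) q⊞z) ⟩
  δ₀ ⊠ δ₀ ⊠ δ₀ ⊠ δ₀ ⊠ G                                                            ≈⟨ solve 1 (λ g → con 1 :* con 1 :* con 1 :* con 1 :* g := g) S.refl G ⟩
  G                                                                                ≈⟨ G≋ ⟩
  δ₀ ⊞ z⁴ G                                                                        ∎)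
  where
  open ≋R

se : s ⊠ e ≋ δ₀
se = S.trans (solve 4 (λ p q s g → s :* (p :* q :* g) := p :* q :* s :* g) S.refl p q s G) pqsG

pp⁻¹ : p ⊠ p⁻¹ ≋ δ₀
pp⁻¹ = S.trans (solve 4 (λ p q s g → p :* (q :* s :* g) := p :* q :* s :* g) S.refl p q s G) pqsG

qq⁻¹ : q ⊠ q⁻¹ ≋ δ₀
qq⁻¹ = S.trans (solve 4 (λ p q s g → q :* (p :* s :* g) := p :* q :* s :* g) S.refl p q s G) pqsG

XX⁻¹ : X ⊠ X⁻¹ ≋ δ₀
XX⁻¹ = S.trans (solve 2 (λ q r → (q :* q :* q :* q) :* (r :* r :* r :* r) := (q :* r) :* (q :* r) :* (q :* r) :* (q :* r)) S.refl q q⁻¹)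
  (S.trans (S.*-cong (S.*-cong (S.*-cong qq⁻¹ qq⁻¹) qq⁻¹) qq⁻¹) (solve 0 (con 1 :* con 1 :* con 1 :* con 1 := con 1) S.refl))

twice : Series → Series
twice f = f ⊞ f

-- For u = Y / X this is u - 1 = 8 z (1 + z²) / X, so powers of z (1 + z²) serve as powers of u - 1.
Y≋ : Y ≋ X ⊞ twice (twice (twice (z ⊠ s)))
Y≋ = begin
  p ⊠ p ⊠ p ⊠ p
    ≈⟨ S.*-cong (S.*-cong (S.*-cong p≋ p≋) p≋) p≋ ⟩
  P ⊠ P ⊠ P ⊠ P
    ≈⟨ solve 2 (λ q z → let P = q :+ z :+ z ; t = (q :+ z) :* (z :* ((q :+ z) :* (q :+ z) :+ z :* z)) ; t₂ = t :+ t ; t₄ = t₂ :+ t₂ in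
         P :* P :* P :* P := q :* q :* q :* q :+ (t₄ :+ t₄)) S.refl q z ⟩
  X ⊞ twice (twice (twice ((q ⊞ z) ⊠ (z ⊠ ((q ⊞ z) ⊠ (q ⊞ z) ⊞ z ⊠ z)))))
    ≈⟨ S.+-congˡ (twice-cong (twice-cong (twice-cong (S.trans (S.*-cong q⊞z (S.*-congˡ (S.sym s≋))) (S.*-identityˡ _))))) ⟩
  X ⊞ twice (twice (twice (z ⊠ s))) ∎
  where
  open ≋R
  P : Series
  P = q ⊞ z ⊞ z
  twice-cong : ∀ {f g} → f ≋ g → twice f ≋ twice g
  twice-cong r = S.+-cong r r

-- Residues

twice-at : ∀ f i → twice f i ≡ + 2 ⋆ f i
twice-at f i = trans (⊞-at f f i) (double (f i))
  where
  double : ∀ a → a ⊹ a ≡ + 2 ⋆ a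
  double = solve-∀

-- (1 - z²)³ = (X² / 8) du/dz for u = Y / X: the numerator of a differential in the variable u.
p³q³ : Series
p³q³ = p ⊠ p ⊠ p ⊠ (q ⊠ q ⊠ q)

θp : θ p ≋ z
θp = S.trans (θ-⊞ δ₀ z) (S.trans (S.+-cong θ-δ₀ θ-z) (S.+-identityˡ z))

θ-⊠p : ∀ {f F} → θ f ≋ F → θ (f ⊠ p) ≋ F ⊠ p ⊞ f ⊠ z
θ-⊠p r = S.trans (θ-⊠ _ p) (S.+-cong (S.*-congʳ r) (S.*-congˡ θp))

θY : θ Y ≋ p ⊠ p ⊠ p ⊠ (z ⊞ z ⊞ z ⊞ z)
θY = S.trans (θ-⊠p (θ-⊠p (θ-⊠p θp)))
  (solve 2 (λ p z → ((z :* p :+ p :* z) :* p :+ p :* p :* z) :* p :+ p :* p :* p :* z := p :* p :* p :* (z :+ z :+ z :+ z)) S.refl p z)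

θs : θ s ≋ z ⊠ z ⊞ z ⊠ z
θs = S.trans (θ-⊞ δ₀ (z ⊠ z)) (S.trans (S.+-cong θ-δ₀ (S.trans (θ-⊠ z z) (S.+-cong (S.*-congʳ θ-z) (S.*-congˡ θ-z)))) (S.+-identityˡ _))

θe : θ e ⊞ e ⊠ e ⊠ (z ⊠ z ⊞ z ⊠ z) ≋ 0ₛ
θe = begin
  θ e ⊞ e ⊠ e ⊠ (z ⊠ z ⊞ z ⊠ z)                    ≈⟨ S.+-cong (S.sym (S.trans (S.*-congʳ se) (S.*-identityˡ _))) (S.*-congˡ (S.sym θs)) ⟩
  s ⊠ e ⊠ θ e ⊞ e ⊠ e ⊠ θ s                        ≈⟨ solve 4 (λ s e a b → s :* e :* a :+ e :* e :* b := e :* (b :* e :+ s :* a)) S.refl s e (θ e) (θ s) ⟩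
  e ⊠ (θ s ⊠ e ⊞ s ⊠ θ e)                          ≈⟨ S.*-congˡ (S.trans (S.sym (θ-⊠ s e)) (S.trans (θ-cong se) θ-δ₀)) ⟩
  e ⊠ 0ₛ                                           ≈⟨ S.zeroʳ e ⟩
  0ₛ                                               ∎
  where open ≋R

-- In the derivative of Y / (z (1 + z²)) the numerator is (1 + z)³ times 4 z (1 + z²) - (1 + z)(1 +
-- 3 z²), and the latter is -(1 - z)³.
cubic : p ⊠ (s ⊞ z ⊠ z ⊞ z ⊠ z) ≋ (z ⊞ z ⊞ z ⊞ z) ⊠ s ⊞ q ⊠ q ⊠ q
cubic = S.trans (S.*-cong p≋ (S.+-congʳ (S.+-congʳ s≋)))
  (S.trans (solve 2 (λ q z → let s = (q :+ z) :* (q :+ z) :+ z :* z in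
      (q :+ z :+ z) :* (s :+ z :* z :+ z :* z) := (z :+ z :+ z :+ z) :* s :+ q :* q :* q) S.refl q z)
    (S.+-congʳ (S.*-congˡ (S.sym s≋))))

-- For g = Y e this is z² (g / z)′ = θ g - g = -(1 - z²)³ e², the derivative of Y / (z (1 + z²))
-- freed of negative powers and signs.
euler : Y ⊠ e ≋ θ (Y ⊠ e) ⊞ e ⊠ e ⊠ p³q³
euler = GroupProperties.∙-cancelʳ S.+-group (Y ⊠ (e ⊠ e ⊠ (z ⊠ z ⊞ z ⊠ z))) _ _ (begin
  Y ⊠ e ⊞ Y ⊠ (e ⊠ e ⊠ (z ⊠ z ⊞ z ⊠ z))
    ≈⟨ S.+-congʳ (S.trans (S.sym (S.*-identityˡ _)) (S.*-congʳ (S.sym se))) ⟩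
  s ⊠ e ⊠ (Y ⊠ e) ⊞ Y ⊠ (e ⊠ e ⊠ (z ⊠ z ⊞ z ⊠ z))
    ≈⟨ solve 4 (λ p s e z → let Y = p :* p :* p :* p in
         s :* e :* (Y :* e) :+ Y :* (e :* e :* (z :* z :+ z :* z)) := e :* e :* (p :* p :* p) :* (p :* (s :+ z :* z :+ z :* z))) S.refl p s e z ⟩
  e ⊠ e ⊠ (p ⊠ p ⊠ p) ⊠ (p ⊠ (s ⊞ z ⊠ z ⊞ z ⊠ z))
    ≈⟨ S.*-congˡ cubic ⟩
  e ⊠ e ⊠ (p ⊠ p ⊠ p) ⊠ ((z ⊞ z ⊞ z ⊞ z) ⊠ s ⊞ q ⊠ q ⊠ q)
    ≈⟨ solve 5 (λ p q s e z → e :* e :* (p :* p :* p) :* ((z :+ z :+ z :+ z) :* s :+ q :* q :* q)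
                  := s :* e :* (p :* p :* p :* (z :+ z :+ z :+ z) :* e) :+ e :* e :* (p :* p :* p :* (q :* q :* q))) S.refl p q s e z ⟩
  s ⊠ e ⊠ (p ⊠ p ⊠ p ⊠ (z ⊞ z ⊞ z ⊞ z) ⊠ e) ⊞ e ⊠ e ⊠ p³q³
    ≈⟨ S.+-congʳ (S.trans (S.*-congʳ se) (S.trans (S.*-identityˡ _) (S.*-congʳ (S.sym θY)))) ⟩
  θ Y ⊠ e ⊞ e ⊠ e ⊠ p³q³
    ≈⟨ S.sym (S.trans (S.+-congˡ (S.trans (S.*-congˡ θe) (S.zeroʳ Y))) (S.+-identityʳ _)) ⟩
  θ Y ⊠ e ⊞ e ⊠ e ⊠ p³q³ ⊞ Y ⊠ (θ e ⊞ e ⊠ e ⊠ (z ⊠ z ⊞ z ⊠ z))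
    ≈⟨ solve 5 (λ a b c d f → a :+ b :+ c :* (d :+ f) := a :+ c :* d :+ b :+ c :* f) S.refl (θ Y ⊠ e) (e ⊠ e ⊠ p³q³) Y (θ e) (e ⊠ e ⊠ (z ⊠ z ⊞ z ⊠ z)) ⟩
  θ Y ⊠ e ⊞ Y ⊠ θ e ⊞ e ⊠ e ⊠ p³q³ ⊞ Y ⊠ (e ⊠ e ⊠ (z ⊠ z ⊞ z ⊠ z))
    ≈⟨ S.+-congʳ (S.+-congʳ (S.sym (θ-⊠ Y e))) ⟩
  θ (Y ⊠ e) ⊞ e ⊠ e ⊠ p³q³ ⊞ Y ⊠ (e ⊠ e ⊠ (z ⊠ z ⊞ z ⊠ z)) ∎)
  where open ≋R

-- R N f is the residue at z = 0 of f / (z (1 + z²))^{N+1}.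
R : ℕ → Series → ℤ
R N f = (f ⊠ e ↑ suc N) N

R-cong : ∀ N {f g} → f ≋ g → R N f ≡ R N g
R-cong N r = at (S.*-congʳ r) N

-- The identity is Y = X + 8 z (1 + z²).
R-step : ∀ N f → R (suc N) (f ⊠ Y) ≡ R (suc N) (f ⊠ X) ⊹ + 8 ⋆ R N f
R-step N f = trans (at expand (suc N)) (trans (⊞-at _ _ (suc N)) (cong (R (suc N) (f ⊠ X) ⊹_) eightfold))
  where
  E h : Series
  E = e ↑ suc N
  h = z ⊠ (f ⊠ E)
  open ≋R
  expand : f ⊠ Y ⊠ e ↑ suc (suc N) ≋ f ⊠ X ⊠ e ↑ suc (suc N) ⊞ twice (twice (twice h))
  expand = begin
    f ⊠ Y ⊠ (e ⊠ E)
      ≈⟨ S.*-congʳ (S.*-congˡ Y≋) ⟩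
    f ⊠ (X ⊞ twice (twice (twice (z ⊠ s)))) ⊠ (e ⊠ E)
      ≈⟨ solve 6 (λ f X z s e E → let a = z :* s ; a₂ = a :+ a ; a₄ = a₂ :+ a₂ ; b = s :* e :* (z :* (f :* E)) ; b₂ = b :+ b ; b₄ = b₂ :+ b₂ in
           f :* (X :+ (a₄ :+ a₄)) :* (e :* E) := f :* X :* (e :* E) :+ (b₄ :+ b₄)) S.refl f X z s e E ⟩
    f ⊠ X ⊠ (e ⊠ E) ⊞ twice (twice (twice (s ⊠ e ⊠ h)))
      ≈⟨ S.+-congˡ (twice-cong (twice-cong (twice-cong (S.trans (S.*-congʳ se) (S.*-identityˡ h))))) ⟩
    f ⊠ X ⊠ (e ⊠ E) ⊞ twice (twice (twice h)) ∎
    where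
    twice-cong : ∀ {f g} → f ≋ g → twice f ≋ twice g
    twice-cong r = S.+-cong r r
  eightfold : twice (twice (twice h)) (suc N) ≡ + 8 ⋆ R N f
  eightfold = trans (twice-at _ _) (trans (cong (+ 2 ⋆_) (trans (twice-at _ _) (cong (+ 2 ⋆_) (trans (twice-at h _) (cong (+ 2 ⋆_) (z⊠-suc (f ⊠ E) N))))))
    (combine (R N f)))
    where
    combine : ∀ a → + 2 ⋆ (+ 2 ⋆ (+ 2 ⋆ a)) ≡ + 8 ⋆ a
    combine = solve-∀

-- Y^M (1 - z²)³ / (z (1 + z²))^{M+2} is, up to a factor, the derivative of (Y / (z (1 + z²)))^{M+1}.
R-exact : ∀ M → R (suc M) (Y ↑ M ⊠ p³q³) ≡ 0ℤ
R-exact M = trans (at regroup (suc M)) exact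
  where
  g : Series
  g = Y ⊠ e
  open ≋R
  regroup : Y ↑ M ⊠ p³q³ ⊠ e ↑ suc (suc M) ≋ g ↑ M ⊠ (e ⊠ e ⊠ p³q³)
  regroup = S.sym (S.trans (S.*-congʳ (↑-⊠ Y e M))
    (solve 4 (λ a b e c → a :* b :* (e :* e :* c) := a :* c :* (e :* (e :* b))) S.refl (Y ↑ M) (e ↑ M) e p³q³))
  -- At z^{M+1} the operator θ multiplies the coefficient of g^{M+1} by M + 1, and the power rule
  -- produces the same factor. This is the vanishing of the residue of a total derivative.
  derivative : (g ↑ M ⊠ g) (suc M) ≡ (g ↑ M ⊠ θ g) (suc M)
  derivative = ℤP.*-cancelˡ-≡ (+ suc M) _ _ (trans (cong (+ suc M ⋆_) (at (S.*-comm (g ↑ M) g) (suc M))) (trans (sym (θ-at (g ↑ suc M) (suc M))) (θ-↑ g M (suc M))))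
  exact : (g ↑ M ⊠ (e ⊠ e ⊠ p³q³)) (suc M) ≡ 0ℤ
  exact = +-cancelˡ ((g ↑ M ⊠ θ g) (suc M)) (trans (sym (trans (at (S.trans (S.*-congˡ euler) (S.distribˡ (g ↑ M) (θ g) _)) (suc M)) (⊞-at _ _ (suc M)))) derivative)
    where
    +-cancelˡ : ∀ a {b} → a ⊹ b ≡ a → b ≡ 0ℤ
    +-cancelˡ a {b} r = trans (shift a b) (trans (cong (ℤ._- a) r) (ℤP.+-inverseʳ a))
      where
      shift : ∀ a b → b ≡ (a ⊹ b) ℤ.- a
      shift = solve-∀

-- The summands (1 + z)^{4j-1} (1 - z)^{4b+3} with j + b = N are Y^j X^b ends; for j > N the exponent of X is negative.
ends : Series
ends = p⁻¹ ⊠ (q ⊠ q ⊠ q)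

-- For 1 ≤ j ≤ N the form u^{j-1} / (u - 1)^{N+1} du has no residue at u = 1. Without a factor X
-- this is `R-exact`; by `R-step` a factor X is traded for a factor Y, up to a residue of lower
-- order.
R-middle : ∀ a b → R (suc (b ℕ.+ a)) (Y ↑ suc a ⊠ X ↑ b ⊠ ends) ≡ 0ℤ
R-middle a zero = trans (R-cong (suc a) (S.trans
    (solve 4 (λ p A r q → (p :* p :* p :* p) :* A :* con 1 :* (r :* (q :* q :* q)) := p :* r :* (A :* (p :* p :* p :* (q :* q :* q)))) S.refl p (Y ↑ a) p⁻¹ q)
    (S.trans (S.*-congʳ pp⁻¹) (S.*-identityˡ _))))
  (R-exact a)
R-middle a (suc b) = trans (R-cong N (solve 4 (λ A x B t → A :* (x :* B) :* t := A :* B :* t :* x) S.refl (Y ↑ suc a) X (X ↑ b) ends))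
  (trans (subtract _ _ (R-step (suc (b ℕ.+ a)) (Y ↑ suc a ⊠ X ↑ b ⊠ ends)))
    (trans (cong₂ (λ u v → u ℤ.- + 8 ⋆ v) next (R-middle a b)) refl))
  where
  N : ℕ
  N = suc (suc (b ℕ.+ a))
  subtract : ∀ {u} v w → u ≡ v ⊹ w → v ≡ u ℤ.- w
  subtract v w refl = cancel v w
    where
    cancel : ∀ v w → v ≡ (v ⊹ w) ℤ.- w
    cancel = solve-∀
  next : R N (Y ↑ suc a ⊠ X ↑ b ⊠ ends ⊠ Y) ≡ 0ℤ
  next = trans (R-cong N (solve 4 (λ A B t y → A :* B :* t :* y := (y :* A) :* B :* t) S.refl (Y ↑ suc a) (X ↑ b) ends Y))
    (subst (λ k → R (suc k) (Y ↑ suc (suc a) ⊠ X ↑ b ⊠ ends) ≡ 0ℤ) (ℕP.+-suc b a) (R-middle (suc a) b))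

8^_ : ℕ → ℤ
8^ zero = 1ℤ
8^ suc k = + 8 ⋆ (8^ k)

p₀ : p 0 ≡ 1ℤ
p₀ = ⊞-at δ₀ z 0

q₀ : q 0 ≡ 1ℤ
q₀ = trans (⊞-at δ₀ _ 0) (cong (1ℤ ⊹_) (⊟-at z 0))

s₀ : s 0 ≡ 1ℤ
s₀ = trans (⊞-at δ₀ _ 0) (cong (1ℤ ⊹_) (⊠-zero z z))

⊠₀ : ∀ f g → f 0 ≡ 1ℤ → g 0 ≡ 1ℤ → (f ⊠ g) 0 ≡ 1ℤ
⊠₀ f g u v = trans (⊠-zero f g) (cong₂ _⋆_ u v)

power₄₀ : ∀ f → f 0 ≡ 1ℤ → (f ⊠ f ⊠ f ⊠ f) 0 ≡ 1ℤ
power₄₀ f u = ⊠₀ (f ⊠ f ⊠ f) f (⊠₀ (f ⊠ f) f (⊠₀ f f u u) u) u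

R-zero : ∀ f → f 0 ≡ 1ℤ → R 0 (f ⊠ ends) ≡ 1ℤ
R-zero f u = ⊠₀ (f ⊠ ends) (e ↑ 1) (⊠₀ f ends u ends₀) (↑-zero 1 (⊠₀ (p ⊠ q) G (⊠₀ p q p₀ q₀) refl))
  where
  ends₀ : ends 0 ≡ 1ℤ
  ends₀ = ⊠₀ p⁻¹ _ (⊠₀ (q ⊠ s) G (⊠₀ q s q₀ s₀) refl) (⊠₀ (q ⊠ q) q (⊠₀ q q q₀ q₀) q₀)

-- The case j = 0: 1 / (u (u - 1)^{N+1}) has residue (-1)^N at u = 1. In `R-step` the term with Y
-- vanishes, so each unit of N costs a factor -8.
R-first : ∀ N → R N (X ↑ N ⊠ ends) ≡ (-1^ N) ⋆ (8^ N)
R-first zero = R-zero δ₀ refl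
R-first (suc N) = trans (R-cong (suc N) (solve 3 (λ A x t → (x :* A) :* t := A :* t :* x) S.refl (X ↑ N) X ends))
  (trans (sign _ _ (R-step N (X ↑ N ⊠ ends)) next) (trans (cong (λ u → ℤ.- (+ 8 ⋆ u)) (R-first N)) (pull (-1^ N) (8^ N))))
  where
  sign : ∀ {u} v w → u ≡ v ⊹ w → u ≡ 0ℤ → v ≡ ℤ.- w
  sign v w refl q = trans (cancel v w) (trans (cong (ℤ._- w) q) (ℤP.+-identityˡ _))
    where
    cancel : ∀ v w → v ≡ (v ⊹ w) ℤ.- w
    cancel = solve-∀
  pull : ∀ a b → ℤ.- (+ 8 ⋆ (a ⋆ b)) ≡ (-1ℤ ⋆ a) ⋆ (+ 8 ⋆ b)
  pull = solve-∀
  next : R (suc N) (X ↑ N ⊠ ends ⊠ Y) ≡ 0ℤ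
  next = trans (R-cong (suc N) (solve 3 (λ A t y → A :* t :* y := (y :* con 1) :* A :* t) S.refl (X ↑ N) ends Y))
    (subst (λ k → R (suc k) (Y ↑ 1 ⊠ X ↑ N ⊠ ends) ≡ 0ℤ) (ℕP.+-identityʳ N) (R-middle 0 N))

-- Here j = N + k + 1, and C(N + k, N) is the coefficient of (u - 1)^N in u^{N+k}; `R-step` becomes
-- Pascal's rule.
R-beyond : ∀ N k → R N (Y ↑ (N ℕ.+ suc k) ⊠ X⁻¹ ↑ suc k ⊠ ends) ≡ (8^ N) ⋆ + ((N ℕ.+ k) choose N)
R-beyond-step : ∀ N k → R (suc N) (Y ↑ (suc N ℕ.+ suc k) ⊠ X⁻¹ ↑ suc k ⊠ ends)
  ≡ R (suc N) (Y ↑ (suc N ℕ.+ k) ⊠ X⁻¹ ↑ k ⊠ ends) ⊹ + 8 ⋆ ((8^ N) ⋆ + ((N ℕ.+ k) choose N))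

R-beyond-step N k = begin
  R (suc N) (Y ↑ (suc N ℕ.+ suc k) ⊠ X⁻¹ ↑ suc k ⊠ ends)
    ≡⟨ R-cong (suc N) (solve 4 (λ A y B t → (y :* A) :* B :* t := A :* B :* t :* y) S.refl (Y ↑ (N ℕ.+ suc k)) Y (X⁻¹ ↑ suc k) ends) ⟩
  R (suc N) (f ⊠ Y)
    ≡⟨ R-step N f ⟩
  R (suc N) (f ⊠ X) ⊹ + 8 ⋆ R N f
    ≡⟨ cong₂ (λ u v → u ⊹ + 8 ⋆ v) (R-cong (suc N) lower) (R-beyond N k) ⟩
  R (suc N) (Y ↑ (suc N ℕ.+ k) ⊠ X⁻¹ ↑ k ⊠ ends) ⊹ + 8 ⋆ ((8^ N) ⋆ + ((N ℕ.+ k) choose N)) ∎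
  where
  open ≡-Reasoning
  f : Series
  f = Y ↑ (N ℕ.+ suc k) ⊠ X⁻¹ ↑ suc k ⊠ ends
  lower : f ⊠ X ≋ Y ↑ (suc N ℕ.+ k) ⊠ X⁻¹ ↑ k ⊠ ends
  lower = S.trans (solve 5 (λ A w B t x → A :* (w :* B) :* t :* x := (x :* w) :* (A :* B :* t)) S.refl (Y ↑ (N ℕ.+ suc k)) X⁻¹ (X⁻¹ ↑ k) ends X)
    (S.trans (S.*-congʳ XX⁻¹) (S.trans (S.*-identityˡ _)
      (subst (λ a → Y ↑ (N ℕ.+ suc k) ⊠ X⁻¹ ↑ k ⊠ ends ≋ Y ↑ a ⊠ X⁻¹ ↑ k ⊠ ends) (ℕP.+-suc N k) S.refl)))

R-beyond zero k = trans (R-zero (Y ↑ suc k ⊠ X⁻¹ ↑ suc k) (⊠₀ (Y ↑ suc k) _ (↑-zero (suc k) (power₄₀ p p₀)) (↑-zero (suc k) (power₄₀ q⁻¹ (⊠₀ (p ⊠ s) G (⊠₀ p s p₀ s₀) refl)))))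
  (sym (trans (ℤP.*-identityˡ _) (cong +_ (nC0≡1 k))))
  where
  nC0≡1 : ∀ n → n choose 0 ≡ 1
  nC0≡1 n = trans (nCk≡nC[n∸k] {n = n} z≤n) (nCn≡1 n)
R-beyond (suc N) zero = trans (R-beyond-step N 0) (trans (cong₂ (λ a b → a ⊹ + 8 ⋆ ((8^ N) ⋆ + b)) (R-last N)
    (trans (cong (_choose N) (ℕP.+-identityʳ N)) (trans (nCn≡1 N) (sym (trans (cong (_choose suc N) (ℕP.+-identityʳ (suc N))) (nCn≡1 (suc N)))))))
  (shape (8^ N) _))
  where
  R-last : ∀ N → R (suc N) (Y ↑ (suc N ℕ.+ 0) ⊠ δ₀ ⊠ ends) ≡ 0ℤ
  R-last N = subst (λ k → R (suc N) (Y ↑ suc k ⊠ δ₀ ⊠ ends) ≡ 0ℤ) (sym (ℕP.+-identityʳ N)) (R-middle N 0)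
  shape : ∀ a b → 0ℤ ⊹ + 8 ⋆ (a ⋆ b) ≡ (+ 8 ⋆ a) ⋆ b
  shape = solve-∀
R-beyond (suc N) (suc k) = trans (R-beyond-step N (suc k)) (trans (cong₂ (λ a b → a ⊹ + 8 ⋆ ((8^ N) ⋆ + (b choose N))) (R-beyond (suc N) k) (ℕP.+-suc N k))
  (trans (shape (8^ N) (+ (suc (N ℕ.+ k) choose suc N)) (+ (suc (N ℕ.+ k) choose N)))
    (cong (λ a → (+ 8 ⋆ (8^ N)) ⋆ + a) (trans (nCk+nC[k+1]≡[n+1]C[k+1] (suc (N ℕ.+ k)) N) (cong (λ a → suc a choose suc N) (sym (ℕP.+-suc N k)))))))
  where
  shape : ∀ a b c → (+ 8 ⋆ a) ⋆ b ⊹ + 8 ⋆ (a ⋆ c) ≡ (+ 8 ⋆ a) ⋆ (c ⊹ b)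
  shape = solve-∀

-- Powers of 1 / (1 - z⁴) and the multiplier `κ`

G↑-suc : ∀ M → G ↑ suc M ≋ G ↑ M ⊞ z⁴ (G ↑ suc M)
G↑-suc M = S.trans (S.*-congʳ G≋) (solve 3 (λ g z a → (con 1 :+ z :* (z :* (z :* (z :* g)))) :* a := a :+ z :* (z :* (z :* (z :* (g :* a))))) S.refl G z (G ↑ M))

z⁴-low : ∀ f i → i ℕ.< 4 → z⁴ f i ≡ 0ℤ
z⁴-low f i i<4 = trans (at (z⊠ _) i) (go i i<4)
  where
  v : ∀ h → (z ⊠ h) 0 ≡ 0ℤ
  v h = at (z⊠ h) 0
  go : ∀ i → i ℕ.< 4 → (z∙ (z ⊠ (z ⊠ (z ⊠ f)))) i ≡ 0ℤ
  go 0 _ = refl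
  go 1 _ = v _
  go 2 _ = trans (z⊠-suc _ 0) (v _)
  go 3 _ = trans (z⊠-suc _ 1) (trans (z⊠-suc _ 0) (v _))
  go (suc (suc (suc (suc i)))) (s≤s (s≤s (s≤s (s≤s ()))))

z⁴-high : ∀ f i → z⁴ f (4 ℕ.+ i) ≡ f i
z⁴-high f i = trans (z⊠-suc _ (3 ℕ.+ i)) (trans (z⊠-suc _ (2 ℕ.+ i)) (trans (z⊠-suc _ (1 ℕ.+ i)) (z⊠-suc _ i)))

G↑-off : ∀ M r k → 0 ℕ.< r → r ℕ.< 4 → (G ↑ M) (r ℕ.+ four k) ≡ 0ℤ
G↑-off zero (suc r) k _ _ = refl
G↑-off (suc M) r zero 0<r r<4 = trans (at (G↑-suc M) _) (trans (⊞-at _ _ (r ℕ.+ 0)) (cong₂ _⊹_ (G↑-off M r 0 0<r r<4)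
  (z⁴-low _ (r ℕ.+ 0) (subst (ℕ._< 4) (sym (ℕP.+-identityʳ r)) r<4))))
G↑-off (suc M) r (suc k) 0<r r<4 = trans (at (G↑-suc M) _) (trans (⊞-at _ _ (r ℕ.+ four (suc k))) (cong₂ _⊹_ (G↑-off M r (suc k) 0<r r<4)
  (subst (λ i → z⁴ (G ↑ suc M) i ≡ 0ℤ) (sym four-suc) (trans (z⁴-high _ _) (G↑-off (suc M) r k 0<r r<4)))))
  where
  four-suc : r ℕ.+ four (suc k) ≡ 4 ℕ.+ (r ℕ.+ four k)
  four-suc = trans (sym (ℕP.+-assoc r 4 (four k))) (trans (cong (ℕ._+ four k) (ℕP.+-comm r 4)) (ℕP.+-assoc 4 r (four k)))

G↑-four : ∀ M k → (G ↑ suc M) (four k) ≡ + ((k ℕ.+ M) choose k)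
G↑-four M zero = trans (↑-zero (suc M) refl) (cong +_ (sym (trans (nCk≡nC[n∸k] {n = M} z≤n) (nCn≡1 M))))
G↑-four zero (suc k) = trans (at (G↑-suc 0) _) (trans (⊞-at _ _ (four (suc k))) (trans (ℤP.+-identityˡ _) (trans (z⁴-high _ (four k)) (trans (G↑-four 0 k)
  (cong +_ (trans (cong (_choose k) (ℕP.+-identityʳ k)) (trans (nCn≡1 k) (sym (trans (cong (_choose suc k) (ℕP.+-identityʳ (suc k))) (nCn≡1 (suc k))))))))))) 
G↑-four (suc M) (suc k) = trans (at (G↑-suc (suc M)) _) (trans (⊞-at _ _ (four (suc k))) (trans (cong₂ _⊹_ (G↑-four M (suc k)) (trans (z⁴-high _ (four k)) (G↑-four (suc M) k)))
  (cong +_ (trans (cong (λ a → (suc (k ℕ.+ M) choose suc k) ℕ.+ (a choose k)) (ℕP.+-suc k M))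
    (trans (ℕP.+-comm (suc (k ℕ.+ M) choose suc k) _) (trans (nCk+nC[k+1]≡[n+1]C[k+1] (suc (k ℕ.+ M)) k) (cong (λ a → suc a choose suc k) (sym (ℕP.+-suc k M)))))))))

weightSeries≋ : ∀ {n} (t c : Word n) → (t ⊑ c) ≡ true → weightSeries t c ≋ p ↑ (c ∖ t) ⊠ q ↑ co# c
weightSeries≋ [] [] r = S.sym (S.*-identityˡ δ₀)
weightSeries≋ (true ∷ t) (true ∷ c) r = weightSeries≋ t c r
weightSeries≋ (false ∷ t) (false ∷ c) r = S.trans (pointwise λ i → sym (trans (⊞-at f (⊟ (z ⊠ f)) i) (cong (f i ⊹_) (trans (⊟-at (z ⊠ f) i) (cong ℤ.-_ (at (z⊠ f) i))))))
  (S.trans (S.trans (S.+-cong (S.sym (S.*-identityˡ f)) (RingProperties.-‿distribˡ-* S.ring z f)) (S.sym (S.distribʳ f δ₀ (⊟ z))))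
    (S.trans (S.*-congˡ (weightSeries≋ t c r)) (solve 3 (λ a b c → a :* (b :* c) := b :* (a :* c)) S.refl q (p ↑ (c ∖ t)) (q ↑ co# c))))
  where
  f : Series
  f = weightSeries t c
weightSeries≋ (false ∷ t) (true ∷ c) r = S.trans (pointwise λ i → sym (trans (⊞-at f (z ⊠ f) i) (cong (f i ⊹_) (at (z⊠ f) i))))
  (S.trans (S.trans (S.+-congʳ (S.sym (S.*-identityˡ f))) (S.sym (S.distribʳ f δ₀ z)))
    (S.trans (S.*-congˡ (weightSeries≋ t c r)) (S.sym (S.*-assoc p _ _))))
  where
  f : Series
  f = weightSeries t c

↑-four : ∀ f k → f ↑ four k ≋ (f ⊠ f ⊠ f ⊠ f) ↑ k
↑-four f zero = S.refl
↑-four f (suc k) = S.trans (S.*-congˡ (S.*-congˡ (S.*-congˡ (S.*-congˡ (↑-four f k)))))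
  (solve 2 (λ f g → f :* (f :* (f :* (f :* g))) := (f :* f :* f :* f) :* g) S.refl f _)

-- [z^N] (κ N · -) sends the weight series of c to the coefficient R N of a power of Y / X.
κ : ℕ → Series
κ N = e ↑ suc N ⊠ ends ⊠ p⁻¹ ↑ suc N ⊠ q⁻¹ ↑ (6 ℕ.+ N)

-- For |t| = 5 and weight d + 4 j with j + l = N, the exponents of 1 + z and 1 - z are N + 1 + 4 j
-- and N + 6 + 4 l. `κ` removes the parts N + 1 and N + 6, common to all weights from d to n - d.
κ-inner : ∀ N j l → κ N ⊠ (p ↑ (suc N ℕ.+ four j) ⊠ q ↑ ((6 ℕ.+ N) ℕ.+ four l)) ≋ Y ↑ j ⊠ X ↑ l ⊠ ends ⊠ e ↑ suc N
κ-inner N j l = begin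
  κ N ⊠ (p ↑ (suc N ℕ.+ four j) ⊠ q ↑ ((6 ℕ.+ N) ℕ.+ four l))
    ≈⟨ S.*-congˡ (S.*-cong (S.trans (↑-+ p (suc N) (four j)) (S.*-congˡ (↑-four p j))) (S.trans (↑-+ q (6 ℕ.+ N) (four l)) (S.*-congˡ (↑-four q l)))) ⟩
  κ N ⊠ (p ↑ suc N ⊠ Y ↑ j ⊠ (q ↑ (6 ℕ.+ N) ⊠ X ↑ l))
    ≈⟨ solve 8 (λ E t u v a y b x → E :* t :* u :* v :* (a :* y :* (b :* x)) := (a :* u) :* (b :* v) :* (y :* x :* t :* E)) S.refl
         (e ↑ suc N) ends (p⁻¹ ↑ suc N) (q⁻¹ ↑ (6 ℕ.+ N)) (p ↑ suc N) (Y ↑ j) (q ↑ (6 ℕ.+ N)) (X ↑ l) ⟩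
  p ↑ suc N ⊠ p⁻¹ ↑ suc N ⊠ (q ↑ (6 ℕ.+ N) ⊠ q⁻¹ ↑ (6 ℕ.+ N)) ⊠ (Y ↑ j ⊠ X ↑ l ⊠ ends ⊠ e ↑ suc N)
    ≈⟨ S.*-congʳ (S.*-cong (inverse-↑ (suc N) pp⁻¹) (inverse-↑ (6 ℕ.+ N) qq⁻¹)) ⟩
  δ₀ ⊠ δ₀ ⊠ (Y ↑ j ⊠ X ↑ l ⊠ ends ⊠ e ↑ suc N)
    ≈⟨ solve 1 (λ a → con 1 :* con 1 :* a := a) S.refl _ ⟩
  Y ↑ j ⊠ X ↑ l ⊠ ends ⊠ e ↑ suc N ∎
  where open ≋R

-- The all-one word has no factor 1 - z to cancel. Since 6 + N is divisible by 4, the uncancelled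
-- inverses form a power of 1 / X.
κ-outer : ∀ N j k → 6 ℕ.+ N ≡ four k → κ N ⊠ (p ↑ (suc N ℕ.+ four j) ⊠ q ↑ 0) ≋ Y ↑ j ⊠ X⁻¹ ↑ k ⊠ ends ⊠ e ↑ suc N
κ-outer N j k r = begin
  κ N ⊠ (p ↑ (suc N ℕ.+ four j) ⊠ δ₀)
    ≈⟨ S.*-cong (S.*-congˡ (S.trans (subst (λ a → q⁻¹ ↑ (6 ℕ.+ N) ≋ q⁻¹ ↑ a) r S.refl) (↑-four q⁻¹ k)))
         (S.*-congʳ (S.trans (↑-+ p (suc N) (four j)) (S.*-congˡ (↑-four p j)))) ⟩
  e ↑ suc N ⊠ ends ⊠ p⁻¹ ↑ suc N ⊠ X⁻¹ ↑ k ⊠ (p ↑ suc N ⊠ Y ↑ j ⊠ δ₀)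
    ≈⟨ solve 6 (λ E t u x a y → E :* t :* u :* x :* (a :* y :* con 1) := (a :* u) :* (y :* x :* t :* E)) S.refl
         (e ↑ suc N) ends (p⁻¹ ↑ suc N) (X⁻¹ ↑ k) (p ↑ suc N) (Y ↑ j) ⟩
  p ↑ suc N ⊠ p⁻¹ ↑ suc N ⊠ (Y ↑ j ⊠ X⁻¹ ↑ k ⊠ ends ⊠ e ↑ suc N)
    ≈⟨ S.trans (S.*-congʳ (inverse-↑ (suc N) pp⁻¹)) (S.*-identityˡ _) ⟩
  Y ↑ j ⊠ X⁻¹ ↑ k ⊠ ends ⊠ e ↑ suc N ∎
  where open ≋R

-- N + 1 of the inverses of 1 + z, 1 - z and 1 + z² combine to `G`. What remains is 1 / ((1 + z)(1 -
-- z)²) = (1 + z)(1 + z²)² `G`².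
κ≋ : ∀ N → κ N ≋ p ⊠ s ⊠ s ⊠ G ↑ (3 ℕ.+ N)
κ≋ N = begin
  e ↑ suc N ⊠ ends ⊠ p⁻¹ ↑ suc N ⊠ q⁻¹ ↑ (6 ℕ.+ N)
    ≈⟨ solve 6 (λ E P Q r q′ q → E :* (r :* (q :* q :* q)) :* P :* (q′ :* (q′ :* (q′ :* (q′ :* (q′ :* Q))))) := E :* P :* Q :* ((q :* q′) :* (q :* q′) :* (q :* q′)) :* (r :* q′ :* q′))
         S.refl (e ↑ suc N) (p⁻¹ ↑ suc N) (q⁻¹ ↑ suc N) p⁻¹ q⁻¹ q ⟩
  e ↑ suc N ⊠ p⁻¹ ↑ suc N ⊠ q⁻¹ ↑ suc N ⊠ (q ⊠ q⁻¹ ⊠ (q ⊠ q⁻¹) ⊠ (q ⊠ q⁻¹)) ⊠ (p⁻¹ ⊠ q⁻¹ ⊠ q⁻¹)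
    ≈⟨ S.*-cong (S.*-cong powers (S.*-cong (S.*-cong qq⁻¹ qq⁻¹) qq⁻¹)) (solve 4 (λ p q s g → (q :* s :* g) :* (p :* s :* g) :* (p :* s :* g) := (p :* q :* s :* g) :* (p :* s :* s :* g :* g)) S.refl p q s G) ⟩
  G ↑ suc N ⊠ (δ₀ ⊠ δ₀ ⊠ δ₀) ⊠ (p ⊠ q ⊠ s ⊠ G ⊠ (p ⊠ s ⊠ s ⊠ G ⊠ G))
    ≈⟨ S.*-congˡ (S.trans (S.*-congʳ pqsG) (S.*-identityˡ _)) ⟩
  G ↑ suc N ⊠ (δ₀ ⊠ δ₀ ⊠ δ₀) ⊠ (p ⊠ s ⊠ s ⊠ G ⊠ G)
    ≈⟨ solve 4 (λ A p s g → A :* (con 1 :* con 1 :* con 1) :* (p :* s :* s :* g :* g) := p :* s :* s :* (g :* (g :* A))) S.refl (G ↑ suc N) p s G ⟩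
  p ⊠ s ⊠ s ⊠ G ↑ (3 ℕ.+ N) ∎
  where
  open ≋R
  powers : e ↑ suc N ⊠ p⁻¹ ↑ suc N ⊠ q⁻¹ ↑ suc N ≋ G ↑ suc N
  powers = S.trans (S.*-congʳ (S.sym (↑-⊠ e p⁻¹ (suc N)))) (S.trans (S.sym (↑-⊠ (e ⊠ p⁻¹) q⁻¹ (suc N))) (↑-cong (suc N)
    (S.trans (solve 4 (λ p q s g → (p :* q :* g) :* (q :* s :* g) :* (p :* s :* g) := (p :* q :* s :* g) :* (p :* q :* s :* g) :* g) S.refl p q s G)
      (S.trans (S.*-congʳ (S.*-cong pqsG pqsG)) (solve 1 (λ g → con 1 :* con 1 :* g := g) S.refl G)))))

-- (1 + z)(1 + z²)² = 1 + z + 2 z² + 2 z³ + z⁴ + z⁵ and N ≡ 2 mod 4, so among powers of z⁴ only the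
-- term 2 z² can contribute.
κ-coefficient : ∀ k → κ (2 ℕ.+ four k) (2 ℕ.+ four k) ≡ + 2 ⋆ + ((k ℕ.+ (4 ℕ.+ four k)) choose k)
κ-coefficient k = begin
  κ N N                                                             ≡⟨ at (S.trans (κ≋ N) expand) N ⟩
  (Γ ⊞ (z ⊠ Γ ⊞ (twice (z ⊠ (z ⊠ Γ)) ⊞ (twice (z ⊠ (z ⊠ (z ⊠ Γ))) ⊞ (z⁴ Γ ⊞ z ⊠ z⁴ Γ))))) N
    ≡⟨ trans (⊞-at _ _ N) (cong₂ _⊹_ (G↑-off M 2 k (s≤s z≤n) (s≤s (s≤s (s≤s z≤n))))
        (trans (⊞-at _ _ N) (cong₂ _⊹_ (trans (z⊠-suc Γ (1 ℕ.+ four k)) (G↑-off M 1 k (s≤s z≤n) (s≤s (s≤s z≤n))))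
        (trans (⊞-at _ _ N) (cong₂ _⊹_ (trans (twice-at _ N) (cong (+ 2 ⋆_) (trans (z⊠-suc _ (1 ℕ.+ four k)) (trans (z⊠-suc Γ (four k)) (G↑-four (2 ℕ.+ N) k)))))
        (trans (⊞-at _ _ N) (cong₂ _⊹_ (trans (twice-at _ N) (cong (+ 2 ⋆_) (trans (z⊠-suc _ (1 ℕ.+ four k)) (trans (z⊠-suc _ (four k)) (off₁ k)))))
        (trans (⊞-at _ _ N) (cong₂ _⊹_ (trans (z⊠-suc _ (1 ℕ.+ four k)) (trans (z⊠-suc _ (four k)) (off₂ k)))
                                       (trans (z⊠-suc _ (1 ℕ.+ four k)) (trans (z⊠-suc _ (four k)) (off₃ k)))))))))))) ⟩
  0ℤ ⊹ (0ℤ ⊹ (+ 2 ⋆ + B ⊹ (0ℤ ⊹ (0ℤ ⊹ 0ℤ))))                        ≡⟨ tidy (+ 2 ⋆ + B) ⟩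
  + 2 ⋆ + B                                                         ∎
  where
  open ≡-Reasoning
  N M B : ℕ
  N = 2 ℕ.+ four k
  M = 3 ℕ.+ N
  B = (k ℕ.+ (4 ℕ.+ four k)) choose k
  Γ : Series
  Γ = G ↑ M
  tidy : ∀ a → 0ℤ ⊹ (0ℤ ⊹ (a ⊹ (0ℤ ⊹ (0ℤ ⊹ 0ℤ)))) ≡ a
  tidy = solve-∀
  expand : p ⊠ s ⊠ s ⊠ Γ ≋ Γ ⊞ (z ⊠ Γ ⊞ (twice (z ⊠ (z ⊠ Γ)) ⊞ (twice (z ⊠ (z ⊠ (z ⊠ Γ))) ⊞ (z⁴ Γ ⊞ z ⊠ z⁴ Γ))))
  expand = solve 2 (λ z g → let s = con 1 :+ z :* z ; z² = z :* (z :* g) ; z³ = z :* z² ; z⁴ = z :* z³ in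
    (con 1 :+ z) :* s :* s :* g := g :+ (z :* g :+ ((z² :+ z²) :+ ((z³ :+ z³) :+ (z⁴ :+ z :* z⁴))))) S.refl z Γ
  off₁ : ∀ k → (z ⊠ Γ) (four k) ≡ 0ℤ
  off₁ zero = at (z⊠ Γ) 0
  off₁ (suc k) = trans (z⊠-suc Γ _) (G↑-off M 3 k (s≤s z≤n) ℕP.≤-refl)
  off₂ : ∀ k → (z ⊠ (z ⊠ Γ)) (four k) ≡ 0ℤ
  off₂ zero = at (z⊠ _) 0
  off₂ (suc k) = trans (z⊠-suc _ _) (trans (z⊠-suc Γ _) (G↑-off M 2 k (s≤s z≤n) (s≤s (s≤s (s≤s z≤n)))))
  off₃ : ∀ k → (z ⊠ (z ⊠ (z ⊠ Γ))) (four k) ≡ 0ℤ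
  off₃ zero = at (z⊠ _) 0
  off₃ (suc k) = trans (z⊠-suc _ _) (trans (z⊠-suc _ _) (trans (z⊠-suc Γ _) (G↑-off M 1 k (s≤s z≤n) (s≤s (s≤s z≤n)))))

-- Extremal codes: the possible weights and the value of λ_5

-1^four : ∀ a → -1^ four a ≡ 1ℤ
-1^four zero = refl
-1^four (suc a) = trans (quadruple (-1^ four a)) (-1^four a)
  where
  quadruple : ∀ b → -1ℤ ⋆ (-1ℤ ⋆ (-1ℤ ⋆ (-1ℤ ⋆ b))) ≡ b
  quadruple = solve-∀

8^≡2^ : ∀ a → 8^ a ≡ 2^ (3 ℕ.* a)
8^≡2^ zero = refl
8^≡2^ (suc a) = trans (cong (+ 8 ⋆_) (8^≡2^ a)) (trans (eight (2^ (3 ℕ.* a))) (cong 2^_ (sym (ℕP.*-suc 3 a))))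
  where
  eight : ∀ b → + 8 ⋆ b ≡ + 2 ⋆ (+ 2 ⋆ (+ 2 ⋆ b))
  eight = solve-∀

weightSeries-⋢ : ∀ {n} (t c : Word n) → (t ⊑ c) ≡ false → ∀ i → weightSeries t c i ≡ 0ℤ
weightSeries-⋢ [] [] ()
weightSeries-⋢ (true ∷ t) (false ∷ c) r i = refl
weightSeries-⋢ (true ∷ t) (true ∷ c) r i = weightSeries-⋢ t c r i
weightSeries-⋢ (false ∷ t) (false ∷ c) r zero = cong (ℤ._- 0ℤ) (weightSeries-⋢ t c r 0)
weightSeries-⋢ (false ∷ t) (false ∷ c) r (suc i) = cong₂ ℤ._-_ (weightSeries-⋢ t c r (suc i)) (weightSeries-⋢ t c r i)
weightSeries-⋢ (false ∷ t) (true ∷ c) r zero = cong (_⊹ 0ℤ) (weightSeries-⋢ t c r 0)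
weightSeries-⋢ (false ∷ t) (true ∷ c) r (suc i) = cong₂ _⊹_ (weightSeries-⋢ t c r (suc i)) (weightSeries-⋢ t c r i)

∖+# : ∀ {n} (t c : Word n) → (t ⊑ c) ≡ true → c ∖ t ℕ.+ # t ≡ # c
∖+# [] [] r = refl
∖+# (true ∷ t) (true ∷ c) r = trans (ℕP.+-suc (c ∖ t) (# t)) (cong suc (∖+# t c r))
∖+# (false ∷ t) (false ∷ c) r = ∖+# t c r
∖+# (false ∷ t) (true ∷ c) r = cong suc (∖+# t c r)

#-complement : ∀ {n} (x : Word n) → # (x ⊕ 1w n) ≡ co# x
#-complement [] = refl
#-complement (false ∷ x) = cong suc (#-complement x)
#-complement (true ∷ x) = #-complement x

co#-1w : ∀ n → co# (1w n) ≡ 0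
co#-1w zero = refl
co#-1w (suc n) = co#-1w n

sg-1w· : ∀ {n} (y : Word n) → sg (1w n · y) ≡ -1^ # y
sg-1w· [] = refl
sg-1w· (false ∷ y) = sg-1w· y
sg-1w· (true ∷ y) = trans (sg-xor true (1w _ · y)) (cong (-1ℤ ⋆_) (sg-1w· y))

sg-injective-false : ∀ b → sg b ≡ 1ℤ → b ≡ false
sg-injective-false false _ = refl

complementary-weights : ∀ m a b {x y} → x ≡ a ℕ.* 4 → y ≡ b ℕ.* 4 → x ℕ.+ y ≡ 24 ℕ.* suc m → 8 ℕ.+ four m ℕ.≤ x → 8 ℕ.+ four m ℕ.≤ y →
  ∃ λ j → ∃ λ l → j ℕ.+ l ≡ 2 ℕ.+ four m × x ≡ 8 ℕ.+ four m ℕ.+ four j × y ≡ 8 ℕ.+ four m ℕ.+ four l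
complementary-weights m a b {x} {y} r s x+y d≤x d≤y = combine (large a r d≤x) (large b s d≤y)
  where
  large : ∀ a {x} → x ≡ a ℕ.* 4 → 8 ℕ.+ four m ℕ.≤ x → ∃ λ j → a ≡ (2 ℕ.+ m) ℕ.+ j × x ≡ 8 ℕ.+ four m ℕ.+ four j
  large a {x} r d≤x = finish (ℕP.m≤n⇒∃[o]m+o≡n (ℕP.*-cancelʳ-≤ (2 ℕ.+ m) a 4 (subst₂ ℕ._≤_ d≡ r d≤x)))
    where
    d≡ : 8 ℕ.+ four m ≡ (2 ℕ.+ m) ℕ.* 4
    d≡ = cong (8 ℕ.+_) (trans (four≡ m) (ℕP.*-comm 4 m))
    arith : ∀ a j → (2 ℕ.+ a ℕ.+ j) ℕ.* 4 ≡ 8 ℕ.+ 4 ℕ.* a ℕ.+ 4 ℕ.* j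
    arith = solveℕ-∀
    finish : (∃ λ j → 2 ℕ.+ m ℕ.+ j ≡ a) → ∃ λ j → a ≡ (2 ℕ.+ m) ℕ.+ j × x ≡ 8 ℕ.+ four m ℕ.+ four j
    finish (j , refl) = j , refl , trans r (trans (arith m j) (cong₂ (λ u v → 8 ℕ.+ u ℕ.+ v) (sym (four≡ m)) (sym (four≡ j))))
  left : ∀ a j l → (4 ℕ.+ 2 ℕ.* a ℕ.+ (j ℕ.+ l)) ℕ.* 4 ≡ (2 ℕ.+ a ℕ.+ j) ℕ.* 4 ℕ.+ (2 ℕ.+ a ℕ.+ l) ℕ.* 4
  left = solveℕ-∀
  right : ∀ a → 24 ℕ.* suc a ≡ (4 ℕ.+ 2 ℕ.* a ℕ.+ (2 ℕ.+ 4 ℕ.* a)) ℕ.* 4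
  right = solveℕ-∀
  combine : (∃ λ j → a ≡ (2 ℕ.+ m) ℕ.+ j × x ≡ 8 ℕ.+ four m ℕ.+ four j) → (∃ λ l → b ≡ (2 ℕ.+ m) ℕ.+ l × y ≡ 8 ℕ.+ four m ℕ.+ four l) →
    ∃ λ j → ∃ λ l → j ℕ.+ l ≡ 2 ℕ.+ four m × x ≡ 8 ℕ.+ four m ℕ.+ four j × y ≡ 8 ℕ.+ four m ℕ.+ four l
  combine (j , a≡ , x≡) (l , b≡ , y≡) = j , l , ℕP.+-cancelˡ-≡ (4 ℕ.+ 2 ℕ.* m) (j ℕ.+ l) (2 ℕ.+ four m) (ℕP.*-cancelʳ-≡ _ _ 4 total) , x≡ , y≡
    where
    total : (4 ℕ.+ 2 ℕ.* m ℕ.+ (j ℕ.+ l)) ℕ.* 4 ≡ (4 ℕ.+ 2 ℕ.* m ℕ.+ (2 ℕ.+ four m)) ℕ.* 4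
    total = trans (left m j l) (trans (cong₂ ℕ._+_ (trans (cong (ℕ._* 4) (sym a≡)) (sym r)) (trans (cong (ℕ._* 4) (sym b≡)) (sym s)))
      (trans x+y (trans (right m) (cong (λ x → (4 ℕ.+ 2 ℕ.* m ℕ.+ (2 ℕ.+ x)) ℕ.* 4) (sym (four≡ m))))))

module Extremal (m′ : ℕ) (C : Code (24 ℕ.* suc m′)) (ext : IsExtremalDESD (suc m′) C) where
  open IsDoublyEvenSelfDual (proj₁ ext)

  n N d k : ℕ
  n = 24 ℕ.* suc m′
  N = 2 ℕ.+ four m′
  d = 6 ℕ.+ N
  k = 12 ℕ.* suc m′

  d≡ : d ≡ 4 ℕ.* suc m′ ℕ.+ 4
  d≡ = trans (cong (8 ℕ.+_) (four≡ m′)) (arith m′)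
    where
    arith : ∀ a → 8 ℕ.+ 4 ℕ.* a ≡ 4 ℕ.* suc a ℕ.+ 4
    arith = solveℕ-∀

  quarter : ∀ x → x ∈C C → ∃ λ a → # x ≡ a ℕ.* 4
  quarter x x∈ with doublyEven x x∈
  ... | divides a r = a , trans (sym (#-wt x)) r

  even : ∀ x → x ∈C C → -1^ # x ≡ 1ℤ
  even x x∈ with quarter x x∈
  ... | a , r = trans (cong -1^_ (trans r (trans (ℕP.*-comm a 4) (sym (four≡ a))))) (-1^four a)

  min : ∀ x → x ∈C C → x ≢ 0w n → d ℕ.≤ # x
  min x x∈ x≢0 = subst₂ ℕ._≤_ (sym d≡) (#-wt x) (proj₁ (proj₂ ext) x x∈ x≢0)

  n≡k+k : n ≡ k ℕ.+ k
  n≡k+k = arith m′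
    where
    arith : ∀ a → 24 ℕ.* suc a ≡ 12 ℕ.* suc a ℕ.+ 12 ℕ.* suc a
    arith = solveℕ-∀

  open Counting C linear selfDual even d (s≤s z≤n) min k n≡k+k public

  d≤k : d ℕ.≤ k
  d≤k = subst₂ ℕ._≤_ (cong (8 ℕ.+_) (sym (four≡ m′))) (sym (arith m′)) (ℕP.m≤m+n (8 ℕ.+ 4 ℕ.* m′) (4 ℕ.+ 8 ℕ.* m′))
    where
    arith : ∀ a → 12 ℕ.* suc a ≡ 8 ℕ.+ 4 ℕ.* a ℕ.+ (4 ℕ.+ 8 ℕ.* a)
    arith = solveℕ-∀

  1w∈ : 1w n ∈C C
  1w∈ = Equivalence.from (selfDual (1w n)) (λ y y∈ → sg-injective-false _ (trans (sg-1w· y) (even y y∈)))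

  -- The all-one word belongs to C, so the minimum weight and the divisibility by 4 apply to the
  -- complement of c as well; this bounds the weight by n - d.
  weight-cases : ∀ c → c ∈C C → # c ≢ 0 →
    c ≡ 1w n ⊎ (∃ λ j → ∃ λ l → j ℕ.+ l ≡ N × # c ≡ d ℕ.+ four j × co# c ≡ d ℕ.+ four l)
  weight-cases c c∈ c≢0 with co# c ℕP.≟ 0
  ... | yes r = inj₁ (#≡n c (trans (sym (ℕP.+-identityʳ (# c))) (trans (cong (# c ℕ.+_) (sym r)) (#+co# c))))
  ... | no co≢0 = inj₂ (split (quarter c c∈) (quarter (c ⊕ 1w n) c̄∈))
    where
    c̄∈ : (c ⊕ 1w n) ∈C C
    c̄∈ = IsLinear.⊕-closed linear c (1w n) c∈ 1w∈
    split : (∃ λ a → # c ≡ a ℕ.* 4) → (∃ λ b → # (c ⊕ 1w n) ≡ b ℕ.* 4) →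
      ∃ λ j → ∃ λ l → j ℕ.+ l ≡ N × # c ≡ d ℕ.+ four j × co# c ≡ d ℕ.+ four l
    split (a , r) (b , s) = complementary-weights m′ a b r (trans (sym (#-complement c)) s) (#+co# c)
      (min c c∈ (λ { refl → c≢0 (#-0w n) }))
      (subst (d ℕ.≤_) (#-complement c) (min (c ⊕ 1w n) c̄∈ (λ t → co≢0 (trans (sym (#-complement c)) (trans (cong # t) (#-0w n))))))

  count-n : ∀ t → count n t ≡ 1ℤ
  count-n t = trans (∑-single (1w n) _ (λ x x≢1 → trans (cong (λ b → ⟦ C x ⟧ ⋆ (⟦ t ⊑ x ⟧ ⋆ ⟦ b ⟧)) (≡ᵇ-≢ (λ r → x≢1 (#≡n x r))))
      (trans (cong (⟦ C x ⟧ ⋆_) (ℤP.*-zeroʳ ⟦ t ⊑ x ⟧)) (ℤP.*-zeroʳ ⟦ C x ⟧))))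
    (cong₂ _⋆_ (cong ⟦_⟧ 1w∈) (cong₂ (λ a b → ⟦ a ⟧ ⋆ ⟦ b ⟧) (⊑-1w t) (trans (cong (_≡ᵇ n) (#-1w n)) (≡ᵇ-refl n))))

  N-even : -1^ N ≡ 1ℤ
  N-even = trans (double (-1^ four m′)) (-1^four m′)
    where
    double : ∀ b → -1ℤ ⋆ (-1ℤ ⋆ b) ≡ b
    double = solve-∀

  B : ℤ
  B = + ((N ℕ.+ suc m′) choose N)

  n≡5+ : n ≡ 5 ℕ.+ (suc N ℕ.+ four (N ℕ.+ suc (suc m′)))
  n≡5+ = trans (arith m′) (cong₂ (λ u v → 5 ℕ.+ (suc (2 ℕ.+ u) ℕ.+ v)) (sym (four≡ m′)) (trans (cong (λ x → 4 ℕ.* (2 ℕ.+ x ℕ.+ suc (suc m′))) (sym (four≡ m′))) (sym (four≡ (N ℕ.+ suc (suc m′))))))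
    where
    arith : ∀ a → 24 ℕ.* suc a ≡ 5 ℕ.+ (suc (2 ℕ.+ 4 ℕ.* a) ℕ.+ 4 ℕ.* (2 ℕ.+ 4 ℕ.* a ℕ.+ suc (suc a)))
    arith = solveℕ-∀

  k≡ : k ≡ 5 ℕ.+ suc (3 ℕ.* N)
  k≡ = trans (arith m′) (cong (λ a → 5 ℕ.+ suc (3 ℕ.* (2 ℕ.+ a))) (sym (four≡ m′)))
    where
    arith : ∀ a → 12 ℕ.* suc a ≡ 5 ℕ.+ suc (3 ℕ.* (2 ℕ.+ 4 ℕ.* a))
    arith = solveℕ-∀

  -- The three values of the residue: `R-first` at weight d, `R-middle` at the other weights up to n
  -- - d, `R-beyond` at weight n.
  residue : ∀ t → # t ≡ 5 → ∀ c → c ∈C C →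
    (κ N ⊠ weightSeries t c) N ≡ (⟦ t ⊑ c ⟧ ⋆ ⟦ # c ≡ᵇ d ⟧) ⋆ (8^ N) ⊹ (⟦ t ⊑ c ⟧ ⋆ ⟦ # c ≡ᵇ n ⟧) ⋆ ((8^ N) ⋆ B)
  residue t t≡5 c c∈ with t ⊑ c in eq
  ... | false = trans (at (S.trans (S.*-congˡ (pointwise {g = 0ₛ} (weightSeries-⋢ t c eq))) (S.zeroʳ (κ N))) N) (zeros (8^ N) B ⟦ # c ≡ᵇ d ⟧ ⟦ # c ≡ᵇ n ⟧)
    where
    zeros : ∀ a b x y → 0ℤ ≡ (0ℤ ⋆ x) ⋆ a ⊹ (0ℤ ⋆ y) ⋆ (a ⋆ b)
    zeros = solve-∀
  ... | true = trans (at (S.*-congˡ (weightSeries≋ t c eq)) N) (go (weight-cases c c∈ #c≢0))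
    where
    ∖≡ : c ∖ t ℕ.+ 5 ≡ # c
    ∖≡ = trans (cong (c ∖ t ℕ.+_) (sym t≡5)) (∖+# t c eq)
    5+∖≡ : 5 ℕ.+ c ∖ t ≡ # c
    5+∖≡ = trans (ℕP.+-comm 5 (c ∖ t)) ∖≡
    #c≢0 : # c ≢ 0
    #c≢0 r with trans 5+∖≡ r
    ... | ()
    indicators : ∀ {v w} a b → v ≡ ⟦ a ⟧ → w ≡ ⟦ b ⟧ → ∀ {x} → x ≡ v ⋆ (8^ N) ⊹ w ⋆ ((8^ N) ⋆ B) → x ≡ (1ℤ ⋆ ⟦ a ⟧) ⋆ (8^ N) ⊹ (1ℤ ⋆ ⟦ b ⟧) ⋆ ((8^ N) ⋆ B)
    indicators a b refl refl r = trans r (cong₂ (λ u v → u ⋆ (8^ N) ⊹ v ⋆ ((8^ N) ⋆ B)) (sym (ℤP.*-identityˡ ⟦ a ⟧)) (sym (ℤP.*-identityˡ ⟦ b ⟧)))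
    d<n : d ℕ.< n
    d<n = subst (d ℕ.<_) (sym n≡k+k) (ℕP.≤-<-trans d≤k (ℕP.m<m+n k (s≤s z≤n)))
    first : ∀ a x → x ≡ a → x ≡ 1ℤ ⋆ a ⊹ 0ℤ ⋆ (a ⋆ B)
    first a x r = trans r (tidy a B)
      where
      tidy : ∀ a b → a ≡ 1ℤ ⋆ a ⊹ 0ℤ ⋆ (a ⋆ b)
      tidy = solve-∀
    none : ∀ a b → 0ℤ ≡ 0ℤ ⋆ a ⊹ 0ℤ ⋆ (a ⋆ b)
    none = solve-∀
    final : ∀ a b → a ⋆ b ≡ 0ℤ ⋆ a ⊹ 1ℤ ⋆ (a ⋆ b)
    final = solve-∀
    go : c ≡ 1w n ⊎ _ → (κ N ⊠ (p ↑ (c ∖ t) ⊠ q ↑ co# c)) N ≡ (1ℤ ⋆ ⟦ # c ≡ᵇ d ⟧) ⋆ (8^ N) ⊹ (1ℤ ⋆ ⟦ # c ≡ᵇ n ⟧) ⋆ ((8^ N) ⋆ B)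
    go (inj₁ c≡1) = indicators (# c ≡ᵇ d) (# c ≡ᵇ n)
      (sym (cong ⟦_⟧ (≡ᵇ-≢ (λ r → ℕP.<⇒≢ d<n (trans (sym r) #c≡n))))) (sym (cong ⟦_⟧ (trans (cong (_≡ᵇ n) #c≡n) (≡ᵇ-refl n))))
      (trans (cong₂ (λ a b → (κ N ⊠ (p ↑ a ⊠ q ↑ b)) N) (ℕP.+-cancelˡ-≡ 5 _ _ (trans 5+∖≡ (trans #c≡n n≡5+))) (trans (cong co# c≡1) (co#-1w n)))
        (trans (at (κ-outer N (N ℕ.+ suc (suc m′)) (suc (suc m′)) refl) N) (trans (R-beyond N (suc m′)) (final (8^ N) B))))
      where
      #c≡n : # c ≡ n
      #c≡n = trans (cong # c≡1) (#-1w n)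
    go (inj₂ (j , l , j+l , #c , coc)) = indicators (# c ≡ᵇ d) (# c ≡ᵇ n) refl (sym (cong ⟦_⟧ (≡ᵇ-≢ c≢n)))
      (trans (cong₂ (λ a b → (κ N ⊠ (p ↑ a ⊠ q ↑ b)) N) (ℕP.+-cancelˡ-≡ 5 _ _ (trans 5+∖≡ #c)) coc)
        (trans (at (κ-inner N j l) N) (inner j j+l #c)))
      where
      c≢n : # c ≢ n
      c≢n r = ℕP.<⇒≢ (subst₂ ℕ._<_ refl (#+co# c) (ℕP.m<m+n (# c) (subst (0 ℕ.<_) (sym coc) (s≤s z≤n)))) r
      inner : ∀ j → j ℕ.+ l ≡ N → # c ≡ d ℕ.+ four j → R N (Y ↑ j ⊠ X ↑ l ⊠ ends) ≡ ⟦ # c ≡ᵇ d ⟧ ⋆ (8^ N) ⊹ 0ℤ ⋆ ((8^ N) ⋆ B)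
      inner zero refl w = trans (R-cong N (solve 2 (λ A t → con 1 :* A :* t := A :* t) S.refl (X ↑ N) ends)) (trans (R-first N)
        (trans (first (8^ N) _ (trans (cong (_⋆ (8^ N)) N-even) (ℤP.*-identityˡ _)))
          (cong (λ b → ⟦ b ⟧ ⋆ (8^ N) ⊹ 0ℤ ⋆ ((8^ N) ⋆ B)) (sym (trans (cong (_≡ᵇ d) (trans w (ℕP.+-identityʳ d))) (≡ᵇ-refl d))))))
      inner (suc j) r w = trans (subst (λ M → R M (Y ↑ suc j ⊠ X ↑ l ⊠ ends) ≡ 0ℤ) (trans (cong suc (ℕP.+-comm l j)) r) (R-middle j l))
        (trans (none (8^ N) B) (cong (λ b → ⟦ b ⟧ ⋆ (8^ N) ⊹ 0ℤ ⋆ ((8^ N) ⋆ B)) (sym (≡ᵇ-≢ (λ r → ℕP.m+1+n≢m d (trans (sym w) r))))))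

  -- Both sides are the coefficient of z^N in `κ N` times the total weight series: once codeword by
  -- codeword through `residue`, once from the vanishing of all coefficients of the total but the
  -- constant one. The value simplifies to C(5m - 2, m - 1).
  λ₅ : ∀ t → # t ≡ 5 → count d t ⊹ B ≡ + 4 ⋆ + ((m′ ℕ.+ (4 ℕ.+ four m′)) choose m′)
  λ₅ t t≡5 = *-cancelˡ (8^ N) (λ r → 2^≢0 (3 ℕ.* N) (trans (sym (8^≡2^ N)) r)) (begin
    (8^ N) ⋆ (count d t ⊹ B)
      ≡⟨ shape (8^ N) (count d t) B ⟩
    count d t ⋆ (8^ N) ⊹ 1ℤ ⋆ ((8^ N) ⋆ B)
      ≡⟨ cong (λ a → count d t ⋆ (8^ N) ⊹ a ⋆ ((8^ N) ⋆ B)) (sym (count-n t)) ⟩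
    count d t ⋆ (8^ N) ⊹ count n t ⋆ ((8^ N) ⋆ B)
      ≡⟨ sym (∑C-linear (8^ N) ((8^ N) ⋆ B) (λ c → ⟦ t ⊑ c ⟧ ⋆ ⟦ # c ≡ᵇ d ⟧) (λ c → ⟦ t ⊑ c ⟧ ⋆ ⟦ # c ≡ᵇ n ⟧)) ⟩
    ∑C (λ c → (⟦ t ⊑ c ⟧ ⋆ ⟦ # c ≡ᵇ d ⟧) ⋆ (8^ N) ⊹ (⟦ t ⊑ c ⟧ ⋆ ⟦ # c ≡ᵇ n ⟧) ⋆ ((8^ N) ⋆ B))
      ≡⟨ ∑C-cong (λ c c∈ → sym (residue t t≡5 c c∈)) ⟩
    ∑C (λ c → (κ N ⊠ weightSeries t c) N)
      ≡⟨ ⊠-linear (κ N) (λ c → ⟦ C c ⟧) (weightSeries t) N ⟩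
    (κ N ⊠ H) N
      ≡⟨ ⊠-constant (κ N) H N vanish ⟩
    κ N N ⋆ H 0
      ≡⟨ cong₂ _⋆_ (κ-coefficient m′) H₀ ⟩
    (+ 2 ⋆ A) ⋆ (+ 2 ⋆ (8^ N))
      ≡⟨ shape′ A (8^ N) ⟩
    (8^ N) ⋆ (+ 4 ⋆ A) ∎)
    where
    open ≡-Reasoning
    A : ℤ
    A = + ((m′ ℕ.+ (4 ℕ.+ four m′)) choose m′)
    H : Series
    H i = ∑C (λ c → weightSeries t c i)
    shape : ∀ a b c → a ⋆ (b ⊹ c) ≡ b ⋆ a ⊹ 1ℤ ⋆ (a ⋆ c)
    shape = solve-∀
    shape′ : ∀ a b → (+ 2 ⋆ a) ⋆ (+ 2 ⋆ b) ≡ b ⋆ (+ 4 ⋆ a)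
    shape′ = solve-∀
    vanish : ∀ j → j ℕ.< N → H (suc j) ≡ 0ℤ
    vanish j j<N = *-cancelˡ (2^ k) (2^≢0 k) (trans (cong (_⋆ H (suc j)) (sym ∣C∣≡)) (trans (sym (poisson t (suc j))) (trans (∑C-cong dual) (trans (∑-0 (λ c → ℤP.*-zeroʳ ⟦ C c ⟧)) (sym (ℤP.*-zeroʳ (2^ k)))))))
      where
      dual : ∀ u → u ∈C C → dualSeries t u (suc j) ≡ 0ℤ
      dual u u∈ with # u ℕP.≟ 0
      ... | yes r rewrite #≡0 u r = trans (dual-⊑ t (0w n) (suc j) (0w-⊑ t)) (trans (cong ((-1^ # (0w n)) ⋆_) (ℤP.*-zeroʳ (2^ co# t))) (ℤP.*-zeroʳ (-1^ # (0w n))))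
      -- A nonzero codeword has at least d - 5 = N + 1 points outside t, just beyond the last
      -- coefficient needed.
      ... | no r = dual-low t u (suc j) (ℕP.≤-trans (s≤s j<N) (ℕP.+-cancelʳ-≤ 5 (suc N) (u ∖ t) (ℕP.≤-trans (ℕP.≤-reflexive (ℕP.+-comm (suc N) 5))
          (ℕP.≤-trans (min u u∈ (λ { refl → r (#-0w n) })) (subst (λ a → # u ℕ.≤ u ∖ t ℕ.+ a) t≡5 (#≤∖+# u t))))))
    -- 2^(k - 5) codewords contain t, and k - 5 = 3 N + 1.
    H₀ : H 0 ≡ + 2 ⋆ (8^ N)
    H₀ = trans (∑C-cong (λ c _ → weight₀ t c)) (trans (incidence t (subst (ℕ._≤ k) (sym t≡5) (ℕP.≤-trans (s≤s (s≤s (s≤s (s≤s (s≤s z≤n))))) d≤k)))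
      (trans (cong₂ _⋆_ (cong 2^_ exponent) (below t (subst (ℕ._< d) (sym t≡5) (s≤s (s≤s (s≤s (s≤s (s≤s (s≤s z≤n)))))))))
        (trans (ℤP.*-identityʳ (2^ suc (3 ℕ.* N))) (cong (+ 2 ⋆_) (sym (8^≡2^ N))))))
      where
      exponent : k ℕ.∸ # t ≡ suc (3 ℕ.* N)
      exponent = trans (cong (k ℕ.∸_) t≡5) (trans (cong (ℕ._∸ 5) k≡) (ℕP.m+n∸m≡n 5 (suc (3 ℕ.* N))))

-- The design property passes from D_w to the minimum weight

Σ< : ℕ → (ℕ → ℤ) → ℤ
Σ< zero a = 0ℤ
Σ< (suc M) a = Σ< M a ⊹ a M

Σ<-cong : ∀ M {a b : ℕ → ℤ} → (∀ i → i ℕ.< M → a i ≡ b i) → Σ< M a ≡ Σ< M b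
Σ<-cong zero r = refl
Σ<-cong (suc M) r = cong₂ _⊹_ (Σ<-cong M (λ i i<M → r i (ℕP.m<n⇒m<1+n i<M))) (r M ℕP.≤-refl)

Σ<-0 : ∀ M → Σ< M (λ _ → 0ℤ) ≡ 0ℤ
Σ<-0 zero = refl
Σ<-0 (suc M) = cong (_⊹ 0ℤ) (Σ<-0 M)

Σ<-sub : ∀ M (a b : ℕ → ℤ) → Σ< M a ℤ.- Σ< M b ≡ Σ< M (λ i → a i ℤ.- b i)
Σ<-sub zero a b = refl
Σ<-sub (suc M) a b = trans (regroup (Σ< M a) (Σ< M b) (a M) (b M)) (cong (_⊹ (a M ℤ.- b M)) (Σ<-sub M a b))
  where
  regroup : ∀ a b c d → (a ⊹ c) ℤ.- (b ⊹ d) ≡ (a ℤ.- b) ⊹ (c ℤ.- d)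
  regroup = solve-∀

Σ<-single : ∀ M i (a : ℕ → ℤ) → i ℕ.< M → (∀ j → j ℕ.< M → j ≢ i → a j ≡ 0ℤ) → Σ< M a ≡ a i
Σ<-single (suc M) i a i<M r with i ℕP.≟ M
... | yes refl = trans (cong (_⊹ a M) (trans (Σ<-cong M (λ j j<M → r j (ℕP.m<n⇒m<1+n j<M) (ℕP.<⇒≢ j<M))) (Σ<-0 M))) (ℤP.+-identityˡ _)
... | no i≢M = trans (cong₂ _⊹_ (Σ<-single M i a (ℕP.≤∧≢⇒< (ℕP.≤-pred i<M) i≢M) (λ j j<M → r j (ℕP.m<n⇒m<1+n j<M))) (r M ℕP.≤-refl (λ e → i≢M (sym e)))) (ℤP.+-identityʳ _)

Σ<-pair : ∀ M i j (a : ℕ → ℤ) → i ℕ.< j → j ℕ.< M → (∀ v → v ℕ.< M → v ≢ i → v ≢ j → a v ≡ 0ℤ) → Σ< M a ≡ a i ⊹ a j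
Σ<-pair (suc M) i j a i<j j<M r with j ℕP.≟ M
... | yes refl = cong (_⊹ a M) (Σ<-single M i a i<j (λ v v<M v≢i → r v (ℕP.m<n⇒m<1+n v<M) v≢i (ℕP.<⇒≢ v<M)))
... | no j≢M = trans (cong₂ _⊹_ (Σ<-pair M i j a i<j (ℕP.≤∧≢⇒< (ℕP.≤-pred j<M) j≢M) (λ v v<M → r v (ℕP.m<n⇒m<1+n v<M)))
    (r M ℕP.≤-refl (λ e → ℕP.<⇒≢ (ℕP.<-≤-trans i<j (ℕP.≤-pred j<M)) (sym e)) (λ e → j≢M (sym e)))) (ℤP.+-identityʳ _)

∑-Σ< : ∀ {n} M (F : ℕ → Word n → ℤ) → ∑ (λ c → Σ< M (λ v → F v c)) ≡ Σ< M (λ v → ∑ (F v))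
∑-Σ< zero F = ∑-0 (λ _ → refl)
∑-Σ< (suc M) F = trans (∑-+ _ _) (cong (_⊹ ∑ (F M)) (∑-Σ< M F))

segment : ∀ n → ℕ → Word n
segment zero s = []
segment (suc n) zero = false ∷ segment n 0
segment (suc n) (suc s) = true ∷ segment n s

#-segment : ∀ n s → s ℕ.≤ n → # (segment n s) ≡ s
#-segment zero zero z≤n = refl
#-segment (suc n) zero z≤n = #-segment n zero z≤n
#-segment (suc n) (suc s) (s≤s r) = cong suc (#-segment n s r)

subsets : ∀ {n} → Word n → (Word n → ℤ) → ℤ
subsets [] f = f []
subsets (false ∷ t) f = subsets t (λ u → f (false ∷ u))
subsets (true ∷ t) f = subsets t (λ u → f (false ∷ u)) ⊹ subsets t (λ u → f (true ∷ u))

binomialSum : ℕ → (ℕ → ℤ) → ℤ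
binomialSum zero φ = φ 0
binomialSum (suc s) φ = binomialSum s φ ⊹ binomialSum s (λ i → φ (suc i))

subsets-# : ∀ {n} (t : Word n) (φ : ℕ → ℤ) → subsets t (λ u → φ (# u)) ≡ binomialSum (# t) φ
subsets-# [] φ = refl
subsets-# (false ∷ t) φ = subsets-# t φ
subsets-# (true ∷ t) φ = cong₂ _⊹_ (subsets-# t φ) (subsets-# t (λ i → φ (suc i)))

subsets-cong : ∀ {n} (t : Word n) {f g : Word n → ℤ} → (∀ u → (u ⊑ t) ≡ true → f u ≡ g u) → subsets t f ≡ subsets t g
subsets-cong [] r = r [] refl
subsets-cong (false ∷ t) r = subsets-cong t (λ u e → r (false ∷ u) e)
subsets-cong (true ∷ t) r = cong₂ _⊹_ (subsets-cong t (λ u e → r (false ∷ u) e)) (subsets-cong t (λ u e → r (true ∷ u) e))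

subsets-+ : ∀ {n} (t : Word n) (f g : Word n → ℤ) → subsets t (λ u → f u ⊹ g u) ≡ subsets t f ⊹ subsets t g
subsets-+ [] f g = refl
subsets-+ (false ∷ t) f g = subsets-+ t (λ u → f (false ∷ u)) (λ u → g (false ∷ u))
subsets-+ (true ∷ t) f g = trans (cong₂ _⊹_ (subsets-+ t (λ u → f (false ∷ u)) (λ u → g (false ∷ u))) (subsets-+ t (λ u → f (true ∷ u)) (λ u → g (true ∷ u))))
  (interchange (subsets t (λ u → f (false ∷ u))) (subsets t (λ u → g (false ∷ u))) _ _)

subsets-0 : ∀ {n} (t : Word n) {f : Word n → ℤ} → (∀ u → (u ⊑ t) ≡ true → f u ≡ 0ℤ) → subsets t f ≡ 0ℤ
subsets-0 [] r = r [] refl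
subsets-0 (false ∷ t) r = subsets-0 t (λ u e → r (false ∷ u) e)
subsets-0 (true ∷ t) r = cong₂ _⊹_ (subsets-0 t (λ u e → r (false ∷ u) e)) (subsets-0 t (λ u e → r (true ∷ u) e))

subsets-top : ∀ {n} (t : Word n) (f : Word n → ℤ) → (∀ u → (u ⊑ t) ≡ true → # u ℕ.< # t → f u ≡ 0ℤ) → subsets t f ≡ f t
subsets-top [] f r = refl
subsets-top (false ∷ t) f r = subsets-top t (λ u → f (false ∷ u)) (λ u e → r (false ∷ u) e)
subsets-top (true ∷ t) f r = trans (cong₂ _⊹_ (subsets-0 t (λ u e → r (false ∷ u) e (s≤s (⊑⇒#≤ u t e)))) (subsets-top t (λ u → f (true ∷ u)) (λ u e l → r (true ∷ u) e (s≤s l)))) (ℤP.+-identityˡ _)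

subsets-∑ : ∀ {m n} (t : Word n) (f : Word n → Word m → ℤ) → subsets t (λ u → ∑ (f u)) ≡ ∑ (λ c → subsets t (λ u → f u c))
subsets-∑ [] f = refl
subsets-∑ (false ∷ t) f = subsets-∑ t (λ u → f (false ∷ u))
subsets-∑ (true ∷ t) f = trans (cong₂ _⊹_ (subsets-∑ t (λ u → f (false ∷ u))) (subsets-∑ t (λ u → f (true ∷ u)))) (sym (∑-+ _ _))

subsets-*ʳ : ∀ {n} (t : Word n) (f : Word n → ℤ) a → subsets t (λ u → f u ⋆ a) ≡ subsets t f ⋆ a
subsets-*ʳ [] f a = refl
subsets-*ʳ (false ∷ t) f a = subsets-*ʳ t (λ u → f (false ∷ u)) a
subsets-*ʳ (true ∷ t) f a = trans (cong₂ _⊹_ (subsets-*ʳ t (λ u → f (false ∷ u)) a) (subsets-*ʳ t (λ u → f (true ∷ u)) a)) (sym (ℤP.*-distribʳ-+ a (subsets t (λ u → f (false ∷ u))) _))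

inclusion-exclusion : ∀ {n} (t c : Word n) → ⟦ t ⊑ (c ⊕ 1w n) ⟧ ≡ subsets t (λ u → (-1^ # u) ⋆ ⟦ u ⊑ c ⟧)
inclusion-exclusion [] [] = refl
inclusion-exclusion (false ∷ t) (_ ∷ c) = inclusion-exclusion t c
inclusion-exclusion (true ∷ t) (false ∷ c) = trans (inclusion-exclusion t c)
  (sym (trans (cong (subsets t (λ u → (-1^ # u) ⋆ ⟦ u ⊑ c ⟧) ⊹_) (subsets-0 t (λ u _ → ℤP.*-zeroʳ (-1^ suc (# u))))) (ℤP.+-identityʳ _)))
inclusion-exclusion (true ∷ t) (true ∷ c) = sym (trans (sym (subsets-+ t (λ u → (-1^ # u) ⋆ ⟦ u ⊑ c ⟧) (λ u → (-1^ suc (# u)) ⋆ ⟦ u ⊑ c ⟧)))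
  (subsets-0 t (λ u _ → cancel (-1^ # u) ⟦ u ⊑ c ⟧)))
  where
  cancel : ∀ a b → a ⋆ b ⊹ (-1ℤ ⋆ a) ⋆ b ≡ 0ℤ
  cancel = solve-∀

-- Polynomials with prescribed weights as roots

Π-remove : ∀ {ρ ρs} (r : ρ ∈ ρs) x → Π ρs x ≡ (x ℤ.- ρ) ⋆ Π (ρs ─ r) x
Π-remove (here refl) x = refl
Π-remove {ρ} {σ List.∷ ρs} (there r) x = trans (cong ((x ℤ.- σ) ⋆_) (Π-remove r x)) (swap (x ℤ.- σ) (x ℤ.- ρ) _)
  where
  swap : ∀ a b c → a ⋆ (b ⋆ c) ≡ b ⋆ (a ⋆ c)
  swap = solve-∀

length-remove : ∀ {ρ : ℤ} {ρs} (r : ρ ∈ ρs) → List.length ρs ≡ suc (List.length (ρs ─ r))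
length-remove (here _) = refl
length-remove (there r) = cong suc (length-remove r)

∈-remove : ∀ {ρ σ : ℤ} {ρs} (r : ρ ∈ ρs) → σ ∈ ρs → σ ≢ ρ → σ ∈ (ρs ─ r)
∈-remove (here refl) (here refl) σ≢ρ = ⊥-elim (σ≢ρ refl)
∈-remove (here _) (there q) σ≢ρ = q
∈-remove (there r) (here e) σ≢ρ = here e
∈-remove (there r) (there q) σ≢ρ = there (∈-remove r q σ≢ρ)

Π-∈ : ∀ {ρ ρs} → ρ ∈ ρs → Π ρs ρ ≡ 0ℤ
Π-∈ {ρ} {ρs} r = trans (Π-remove r ρ) (trans (cong (_⋆ Π (ρs ─ r) ρ) (ℤP.+-inverseʳ ρ)) (ℤP.*-zeroˡ (Π (ρs ─ r) ρ)))

0<fact : ∀ i → fact i ≢ 0ℤ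
0<fact (suc i) r with ℤP.i*j≡0⇒i≡0∨j≡0 (+ suc i) {fact i} r
... | inj₂ q = 0<fact i q

4^_ : ℕ → ℤ
4^ zero = 1ℤ
4^ suc i = + 4 ⋆ (4^ i)

4^≡2^ : ∀ i → 4^ i ≡ 2^ (i ℕ.+ i)
4^≡2^ zero = refl
4^≡2^ (suc i) = trans (cong (+ 4 ⋆_) (4^≡2^ i)) (trans (two (2^ (i ℕ.+ i))) (cong 2^_ (sym (cong suc (ℕP.+-suc i i)))))
  where
  two : ∀ a → + 4 ⋆ a ≡ + 2 ⋆ (+ 2 ⋆ a)
  two = solve-∀

product≢0 : ∀ {a b} → a ≢ 0ℤ → b ≢ 0ℤ → a ⋆ b ≢ 0ℤ
product≢0 {a} {b} p q r with ℤP.i*j≡0⇒i≡0∨j≡0 a {b} r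
... | inj₁ e = p e
... | inj₂ e = q e

module Weights (d : ℕ) where

  weight : ℕ → ℤ
  weight j = + (d ℕ.+ four j)

  weight≡ : ∀ j → weight j ≡ + d ⊹ + 4 ⋆ + j
  weight≡ j = trans (ℤP.pos-+ d (four j)) (cong (+ d ⊹_) (trans (cong +_ (four≡ j)) (ℤP.pos-* 4 j)))

  weight-injective : ∀ {i j} → weight i ≡ weight j → i ≡ j
  weight-injective {i} {j} r = ℕP.*-cancelˡ-≡ i j 4 (trans (sym (four≡ i)) (trans (ℕP.+-cancelˡ-≡ d _ _ (ℤP.+-injective r)) (four≡ j)))

  weight-diff : ∀ i j → weight i ℤ.- weight j ≡ + 4 ⋆ (+ i ℤ.- + j)
  weight-diff i j = trans (cong₂ ℤ._-_ (weight≡ i) (weight≡ j)) (shape (+ d) (+ i) (+ j))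
    where
    shape : ∀ a b c → (a ⊹ + 4 ⋆ b) ℤ.- (a ⊹ + 4 ⋆ c) ≡ + 4 ⋆ (b ℤ.- c)
    shape = solve-∀

  run : ℕ → ℕ → List ℤ
  run i zero = List.[]
  run i (suc len) = weight i List.∷ run (suc i) len

  run-length : ∀ i len → List.length (run i len) ≡ len
  run-length i zero = refl
  run-length i (suc len) = cong suc (run-length (suc i) len)

  run-∈ : ∀ i len j → i ℕ.≤ j → j ℕ.< i ℕ.+ len → weight j ∈ run i len
  run-∈ i zero j i≤j j<i = ⊥-elim (ℕP.<-irrefl refl (ℕP.<-≤-trans (subst (j ℕ.<_) (ℕP.+-identityʳ i) j<i) i≤j))
  run-∈ i (suc len) j i≤j j< with i ℕP.≟ j
  ... | yes refl = here refl
  ... | no i≢j = there (run-∈ (suc i) len j (ℕP.≤∧≢⇒< i≤j i≢j) (subst (j ℕ.<_) (ℕP.+-suc i len) j<))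

  -- The point lies at distances 4, 8, ..., 4 `len` from the roots.
  run-above : ∀ i len → Π (run i len) (weight (i ℕ.+ len)) ≡ (4^ len) ⋆ fact len
  run-above i zero = refl
  run-above i (suc len) = trans (cong₂ _⋆_ (trans (weight-diff (i ℕ.+ suc len) i) (cong (+ 4 ⋆_) (trans (cong (ℤ._- + i) (ℤP.pos-+ i (suc len))) (cancel (+ i) (+ suc len)))))
      (trans (cong (λ a → Π (run (suc i) len) (weight a)) (ℕP.+-suc i len)) (run-above (suc i) len)))
    (shape (+ suc len) (4^ len) (fact len))
    where
    cancel : ∀ a b → (a ⊹ b) ℤ.- a ≡ b
    cancel = solve-∀
    shape : ∀ a b c → (+ 4 ⋆ a) ⋆ (b ⋆ c) ≡ (+ 4 ⋆ b) ⋆ (a ⋆ c)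
    shape = solve-∀

  run-snoc : ∀ i len x → Π (run i (suc len)) x ≡ Π (run i len) x ⋆ (x ℤ.- weight (i ℕ.+ len))
  run-snoc i zero x = trans (ℤP.*-comm (x ℤ.- weight i) 1ℤ) (cong (λ a → 1ℤ ⋆ (x ℤ.- weight a)) (sym (ℕP.+-identityʳ i)))
  run-snoc i (suc len) x = trans (cong ((x ℤ.- weight i) ⋆_) (trans (run-snoc (suc i) len x) (cong (λ a → Π (run (suc i) len) x ⋆ (x ℤ.- weight a)) (sym (ℕP.+-suc i len)))))
    (sym (ℤP.*-assoc (x ℤ.- weight i) (Π (run (suc i) len) x) _))

  run-below : ∀ i len → Π (run (suc i) len) (weight i) ≡ (-1^ len) ⋆ ((4^ len) ⋆ fact len)
  run-below i zero = refl
  run-below i (suc len) = trans (run-snoc (suc i) len (weight i)) (trans (cong₂ _⋆_ (run-below i len)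
      (trans (weight-diff i (suc (i ℕ.+ len))) (cong (λ a → + 4 ⋆ (+ i ℤ.- a)) (trans (cong +_ (sym (ℕP.+-suc i len))) (ℤP.pos-+ i (suc len))))))
    (shape (-1^ len) (4^ len) (fact len) (+ i) (+ suc len)))
    where
    shape : ∀ s b c i l → (s ⋆ (b ⋆ c)) ⋆ (+ 4 ⋆ (i ℤ.- (i ⊹ l))) ≡ (-1ℤ ⋆ s) ⋆ ((+ 4 ⋆ b) ⋆ (l ⋆ c))
    shape = solve-∀

half-four : ∀ a → four a ≡ (a ℕ.+ a) ℕ.+ (a ℕ.+ a)
half-four a = trans (four≡ a) (arith a)
  where
  arith : ∀ a → 4 ℕ.* a ≡ (a ℕ.+ a) ℕ.+ (a ℕ.+ a)
  arith = solveℕ-∀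

complement-≡ᵇ : ∀ {a b v v̄} → a ℕ.+ b ≡ v ℕ.+ v̄ → (b ≡ᵇ v̄) ≡ (a ≡ᵇ v)
complement-≡ᵇ {a} {b} {v} {v̄} r with a ℕP.≟ v
... | yes refl = trans (trans (cong (_≡ᵇ v̄) (ℕP.+-cancelˡ-≡ a b v̄ r)) (≡ᵇ-refl v̄)) (sym (≡ᵇ-refl a))
... | no a≢v = trans (≡ᵇ-≢ (λ e → a≢v (ℕP.+-cancelʳ-≡ b a v (trans r (cong (v ℕ.+_) (sym e)))))) (sym (≡ᵇ-≢ a≢v))

-- Deviations of the counts from constancy

module Strength (m′ : ℕ) (C : Code (24 ℕ.* suc m′)) (ext : IsExtremalDESD (suc m′) C) where
  open Extremal m′ C ext
  open Weights d

  n≡d+ : n ≡ (d ℕ.+ four N) ℕ.+ d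
  n≡d+ = trans (arith m′) (cong₂ (λ u v → (8 ℕ.+ u ℕ.+ v) ℕ.+ (8 ℕ.+ u)) (sym (four≡ m′)) (trans (cong (λ x → 4 ℕ.* (2 ℕ.+ x)) (sym (four≡ m′))) (sym (four≡ N))))
    where
    arith : ∀ a → 24 ℕ.* suc a ≡ (8 ℕ.+ 4 ℕ.* a ℕ.+ 4 ℕ.* (2 ℕ.+ 4 ℕ.* a)) ℕ.+ (8 ℕ.+ 4 ℕ.* a)
    arith = solveℕ-∀

  2^[k∸d] : 2^ (k ℕ.∸ d) ≡ 4^ N
  2^[k∸d] = trans (cong 2^_ (trans (cong (ℕ._∸ d) k≡d+) (ℕP.m+n∸m≡n d (N ℕ.+ N)))) (sym (4^≡2^ N))
    where
    arith : ∀ a → 12 ℕ.* suc a ≡ 8 ℕ.+ 4 ℕ.* a ℕ.+ (2 ℕ.+ 4 ℕ.* a ℕ.+ (2 ℕ.+ 4 ℕ.* a))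
    arith = solveℕ-∀
    k≡d+ : k ≡ d ℕ.+ (N ℕ.+ N)
    k≡d+ = trans (arith m′) (cong (λ u → 8 ℕ.+ u ℕ.+ (2 ℕ.+ u ℕ.+ (2 ℕ.+ u))) (sym (four≡ m′)))

  -- Comparing with one reference set of the same size, instead of with an arbitrary second set,
  -- makes constancy the vanishing of a linear quantity.
  D : ℕ → Word n → ℤ
  D v t = count v t ℤ.- count v (segment n (# t))

  Const : ℕ → ℕ → Set
  Const s v = ∀ t → # t ≡ s → D v t ≡ 0ℤ

  #-seg : ∀ t → # (segment n (# t)) ≡ # t
  #-seg t = #-segment n (# t) (#≤n t)

  D-seg : ∀ v t → D v (segment n (# t)) ≡ 0ℤ
  D-seg v t = trans (cong (λ s → count v (segment n (# t)) ℤ.- count v (segment n s)) (#-seg t)) (ℤP.+-inverseʳ (count v (segment n (# t))))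

  -- Double counting: a block of size v containing t offers v - |t| points by which t can be
  -- enlarged.
  count-extend : ∀ v t → extend (1w n) t (count v) ≡ (+ v ℤ.- + # t) ⋆ count v t
  count-extend v t = begin
    extend (1w n) t (count v)
      ≡⟨ extend-cong (1w n) t (⊑-1w t) (λ x _ _ → ∑-cong (λ c → shape ⟦ C c ⟧ ⟦ x ⊑ c ⟧ ⟦ # c ≡ᵇ v ⟧)) ⟩
    extend (1w n) t (λ x → moment x List.[])
      ≡⟨ extend-moment t List.[] (⊑-1w t) ⟩
    ∑ (λ c → (⟦ C c ⟧ ⋆ ⟦ # c ≡ᵇ v ⟧) ⋆ (⟦ t ⊑ c ⟧ ⋆ ((+ (c ∩# 1w n) ℤ.- + # t) ⋆ 1ℤ)))
      ≡⟨ ∑-cong point ⟩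
    ∑ (λ c → (+ v ℤ.- + # t) ⋆ (⟦ C c ⟧ ⋆ (⟦ t ⊑ c ⟧ ⋆ ⟦ # c ≡ᵇ v ⟧)))
      ≡⟨ ∑-*ˡ (+ v ℤ.- + # t) _ ⟩
    (+ v ℤ.- + # t) ⋆ count v t ∎
    where
    open ≡-Reasoning
    open Moments (1w n) (λ c → ⟦ C c ⟧ ⋆ ⟦ # c ≡ᵇ v ⟧)
    shape : ∀ a b c → a ⋆ (b ⋆ c) ≡ (a ⋆ c) ⋆ (b ⋆ 1ℤ)
    shape = solve-∀
    shape′ : ∀ a b e → (a ⋆ 1ℤ) ⋆ (b ⋆ (e ⋆ 1ℤ)) ≡ e ⋆ (a ⋆ (b ⋆ 1ℤ))
    shape′ = solve-∀
    shape″ : ∀ a b e f → (a ⋆ 0ℤ) ⋆ (b ⋆ (e ⋆ 1ℤ)) ≡ f ⋆ (a ⋆ (b ⋆ 0ℤ))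
    shape″ = solve-∀
    point : ∀ c → (⟦ C c ⟧ ⋆ ⟦ # c ≡ᵇ v ⟧) ⋆ (⟦ t ⊑ c ⟧ ⋆ ((+ (c ∩# 1w n) ℤ.- + # t) ⋆ 1ℤ)) ≡ (+ v ℤ.- + # t) ⋆ (⟦ C c ⟧ ⋆ (⟦ t ⊑ c ⟧ ⋆ ⟦ # c ≡ᵇ v ⟧))
    point c with # c ≡ᵇ v in eq
    ... | true = trans (cong (λ a → (⟦ C c ⟧ ⋆ 1ℤ) ⋆ (⟦ t ⊑ c ⟧ ⋆ ((+ a ℤ.- + # t) ⋆ 1ℤ))) (trans (∩#-1w c) (≡ᵇ-sound (# c) v eq))) (shape′ ⟦ C c ⟧ ⟦ t ⊑ c ⟧ (+ v ℤ.- + # t))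
    ... | false = shape″ ⟦ C c ⟧ ⟦ t ⊑ c ⟧ (+ (c ∩# 1w n) ℤ.- + # t) (+ v ℤ.- + # t)

  open Moments (1w n) (λ c → ⟦ C c ⟧)

  bare : ∀ t → moment t List.[] ≡ ∑C (λ c → ⟦ t ⊑ c ⟧)
  bare t = ∑-cong (λ c → cong (⟦ C c ⟧ ⋆_) (ℤP.*-identityʳ ⟦ t ⊑ c ⟧))

  1+-distrib : ∀ a b → a ⋆ (1ℤ ⊹ b) ≡ a ⊹ a ⋆ b
  1+-distrib = solve-∀

  -- Against the all-one word the intersection number is the weight. A set of size d is the first
  -- that may carry a relation, and then the number of codewords through it doubles from 2^(k - d).
  open Values (λ s → 2^ (k ℕ.∸ s)) d (2^ (k ℕ.∸ d)) (count d)
    (λ t _ t<d → trans (bare t) (trans (incidence t (ℕP.<⇒≤ (ℕP.<-≤-trans t<d d≤k))) (trans (cong ((2^ (k ℕ.∸ # t)) ⋆_) (below t t<d)) (ℤP.*-identityʳ _))))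
    (λ t _ t≡d → trans (bare t) (trans (incidence t (subst (ℕ._≤ k) (sym t≡d) d≤k)) (trans (cong₂ (λ a b → (2^ (k ℕ.∸ a)) ⋆ b) t≡d (at-distance t t≡d)) (1+-distrib (2^ (k ℕ.∸ d)) (count d t)))))
    (λ t _ _ → count-extend d t)

  by-weight : ∀ t ρs → moment t ρs ≡ Σ< (suc n) (λ v → Π ρs (+ v) ⋆ count v t)
  by-weight t ρs = begin
    ∑ (λ c → ⟦ C c ⟧ ⋆ (⟦ t ⊑ c ⟧ ⋆ Π ρs (+ (c ∩# 1w n))))
      ≡⟨ ∑-cong (λ c → sym (point c)) ⟩
    ∑ (λ c → Σ< (suc n) (λ v → Π ρs (+ v) ⋆ (⟦ C c ⟧ ⋆ (⟦ t ⊑ c ⟧ ⋆ ⟦ # c ≡ᵇ v ⟧))))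
      ≡⟨ ∑-Σ< (suc n) (λ v c → Π ρs (+ v) ⋆ (⟦ C c ⟧ ⋆ (⟦ t ⊑ c ⟧ ⋆ ⟦ # c ≡ᵇ v ⟧))) ⟩
    Σ< (suc n) (λ v → ∑ (λ c → Π ρs (+ v) ⋆ (⟦ C c ⟧ ⋆ (⟦ t ⊑ c ⟧ ⋆ ⟦ # c ≡ᵇ v ⟧))))
      ≡⟨ Σ<-cong (suc n) (λ v _ → ∑-*ˡ (Π ρs (+ v)) (λ c → ⟦ C c ⟧ ⋆ (⟦ t ⊑ c ⟧ ⋆ ⟦ # c ≡ᵇ v ⟧))) ⟩
    Σ< (suc n) (λ v → Π ρs (+ v) ⋆ count v t) ∎
    where
    open ≡-Reasoning
    shape : ∀ a b c → a ⋆ (b ⋆ (c ⋆ 1ℤ)) ≡ b ⋆ (c ⋆ a)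
    shape = solve-∀
    shape′ : ∀ a b c → a ⋆ (b ⋆ (c ⋆ 0ℤ)) ≡ 0ℤ
    shape′ = solve-∀
    point : ∀ c → Σ< (suc n) (λ v → Π ρs (+ v) ⋆ (⟦ C c ⟧ ⋆ (⟦ t ⊑ c ⟧ ⋆ ⟦ # c ≡ᵇ v ⟧))) ≡ ⟦ C c ⟧ ⋆ (⟦ t ⊑ c ⟧ ⋆ Π ρs (+ (c ∩# 1w n)))
    point c = trans (Σ<-single (suc n) (# c) _ (s≤s (#≤n c))
        (λ v _ v≢ → trans (cong (λ b → Π ρs (+ v) ⋆ (⟦ C c ⟧ ⋆ (⟦ t ⊑ c ⟧ ⋆ ⟦ b ⟧))) (≡ᵇ-≢ (λ e → v≢ (sym e)))) (shape′ (Π ρs (+ v)) ⟦ C c ⟧ ⟦ t ⊑ c ⟧)))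
      (trans (cong (λ b → Π ρs (+ # c) ⋆ (⟦ C c ⟧ ⋆ (⟦ t ⊑ c ⟧ ⋆ ⟦ b ⟧))) (≡ᵇ-refl (# c)))
        (trans (shape (Π ρs (+ # c)) ⟦ C c ⟧ ⟦ t ⊑ c ⟧) (cong (λ a → ⟦ C c ⟧ ⋆ (⟦ t ⊑ c ⟧ ⋆ Π ρs (+ a))) (sym (∩#-1w c)))))

  moment-difference : ∀ t ρs → Σ< (suc n) (λ v → Π ρs (+ v) ⋆ D v t) ≡ moment t ρs ℤ.- moment (segment n (# t)) ρs
  moment-difference t ρs = sym (trans (cong₂ ℤ._-_ (by-weight t ρs) (by-weight (segment n (# t)) ρs))
    (trans (Σ<-sub (suc n) _ _) (Σ<-cong (suc n) (λ v _ → factor (Π ρs (+ v)) (count v t) (count v (segment n (# t)))))))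
    where
    factor : ∀ a b c → a ⋆ b ℤ.- a ⋆ c ≡ a ⋆ (b ℤ.- c)
    factor = solve-∀

  difference-low : ∀ t ρs → # t ℕ.+ List.length ρs ℕ.< d → Σ< (suc n) (λ v → Π ρs (+ v) ⋆ D v t) ≡ 0ℤ
  difference-low t ρs r = trans (moment-difference t ρs) (trans (cong₂ ℤ._-_ (moment-low t ρs (⊑-1w t) r)
      (trans (moment-low (segment n (# t)) ρs (⊑-1w (segment n (# t))) (subst (λ s → s ℕ.+ List.length ρs ℕ.< d) (sym (#-seg t)) r)) (cong (λ s → V s ρs) (#-seg t))))
    (ℤP.+-inverseʳ (V (# t) ρs)))

  difference-top : ∀ t ρs → # t ℕ.+ List.length ρs ≡ d → Σ< (suc n) (λ v → Π ρs (+ v) ⋆ D v t) ≡ (4^ N) ⋆ (fact (List.length ρs) ⋆ D d t)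
  difference-top t ρs r = trans (moment-difference t ρs) (trans (cong₂ ℤ._-_ (moment-top t ρs (⊑-1w t) r)
      (trans (moment-top (segment n (# t)) ρs (⊑-1w (segment n (# t))) (trans (cong (ℕ._+ List.length ρs) (#-seg t)) r))
        (cong (λ s → V s ρs ⊹ (2^ (k ℕ.∸ d)) ⋆ (fact (List.length ρs) ⋆ count d (segment n (# t)))) (#-seg t))))
    (trans (shape (V (# t) ρs) (2^ (k ℕ.∸ d)) (fact (List.length ρs)) (count d t) (count d (segment n (# t)))) (cong (_⋆ (fact (List.length ρs) ⋆ D d t)) 2^[k∸d])))
    where
    shape : ∀ v a f x y → (v ⊹ a ⋆ (f ⋆ x)) ℤ.- (v ⊹ a ⋆ (f ⋆ y)) ≡ a ⋆ (f ⋆ (x ℤ.- y))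
    shape = solve-∀

  -- At weight n the all-one word is counted for every set, so the difference is zero. The zero word
  -- contains no nonempty t, hence the test for positive weight in the search.
  D-vanishes : ∀ v t → 1 ℕ.≤ # t → D v t ≡ 0ℤ ⊎ (∃ λ j → j ℕ.≤ N × v ≡ d ℕ.+ four j)
  D-vanishes v t 1≤t with all⊎counterexample (λ c → not (C c ∧ ((# c ≡ᵇ v) ∧ (0 ℕ.<ᵇ # c))))
  ... | inj₁ none = inj₁ (cong₂ ℤ._-_ (empty t 1≤t) (empty (segment n (# t)) (subst (1 ℕ.≤_) (sym (#-seg t)) 1≤t)))
    where
    empty : ∀ t → 1 ℕ.≤ # t → count v t ≡ 0ℤ
    empty t 1≤t = trans (∑C-cong λ c c∈ → go c (C c) (# c ≡ᵇ v) (t ⊑ c) c∈ refl refl (none c)) (∑-0 (λ c → ℤP.*-zeroʳ ⟦ C c ⟧))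
      where
      go : ∀ c a b e → a ≡ true → (# c ≡ᵇ v) ≡ b → (t ⊑ c) ≡ e → not (a ∧ (b ∧ (0 ℕ.<ᵇ # c))) ≡ true → ⟦ e ⟧ ⋆ ⟦ b ⟧ ≡ 0ℤ
      go c true false e _ _ _ _ = ℤP.*-zeroʳ ⟦ e ⟧
      go c true true false _ _ _ _ = refl
      go c true true true _ _ t⊑c r with # c | ℕP.≤-trans 1≤t (⊑⇒#≤ t c t⊑c)
      go c true true true _ _ t⊑c () | suc _ | _
  ... | inj₂ (c , r) = classify (split (C c) (# c ≡ᵇ v) (# c) refl r)
    where
    split : ∀ a b x → # c ≡ x → not (a ∧ (b ∧ (0 ℕ.<ᵇ x))) ≡ false → a ≡ true × b ≡ true × # c ≢ 0
    split true true (suc x) e _ = refl , refl , λ z → ℕP.1+n≢0 (trans (sym e) z)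
    classify : C c ≡ true × (# c ≡ᵇ v) ≡ true × # c ≢ 0 → _
    classify (c∈ , #c , c≢0) = kind (weight-cases c c∈ c≢0)
      where
      v≡ : # c ≡ v
      v≡ = ≡ᵇ-sound (# c) v #c
      kind : c ≡ 1w n ⊎ (∃ λ j → ∃ λ l → j ℕ.+ l ≡ N × # c ≡ d ℕ.+ four j × co# c ≡ d ℕ.+ four l) → D v t ≡ 0ℤ ⊎ (∃ λ j → j ℕ.≤ N × v ≡ d ℕ.+ four j)
      kind (inj₁ e) = inj₁ (subst (λ v → D v t ≡ 0ℤ) (trans (sym (trans (cong # e) (#-1w n))) v≡) (cong₂ ℤ._-_ (count-n t) (count-n (segment n (# t)))))
      kind (inj₂ (j , l , j+l , w , _)) = inj₂ (j , subst (j ℕ.≤_) j+l (ℕP.m≤m+n j l) , trans (sym v≡) w)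

  term : List ℤ → Word n → ℕ → ℤ
  term ρs t v = Π ρs (+ v) ⋆ D v t

  d≤n : d ℕ.≤ n
  d≤n = subst (d ℕ.≤_) (sym n≡d+) (ℕP.m≤n+m d (d ℕ.+ four N))

  d+four0 : d ℕ.+ four 0 ≡ d
  d+four0 = ℕP.+-identityʳ d

  only-d : ∀ t ρs → 1 ℕ.≤ # t → (∀ j → 1 ℕ.≤ j → j ℕ.≤ N → term ρs t (d ℕ.+ four j) ≡ 0ℤ) → Σ< (suc n) (term ρs t) ≡ term ρs t d
  only-d t ρs 1≤t r = Σ<-single (suc n) d (term ρs t) (s≤s d≤n) other
    where
    other : ∀ v → v ℕ.< suc n → v ≢ d → term ρs t v ≡ 0ℤ
    other v _ v≢d with D-vanishes v t 1≤t
    ... | inj₁ e = trans (cong (Π ρs (+ v) ⋆_) e) (ℤP.*-zeroʳ (Π ρs (+ v)))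
    ... | inj₂ (zero , _ , e) = ⊥-elim (v≢d (trans e d+four0))
    ... | inj₂ (suc j , j≤N , e) = subst (λ v → term ρs t v ≡ 0ℤ) (sym e) (r (suc j) (s≤s z≤n) j≤N)

  d<top : d ℕ.< d ℕ.+ four N
  d<top = ℕP.m<m+n d (s≤s z≤n)

  only-ends : ∀ t ρs → 1 ℕ.≤ # t → (∀ j → 1 ℕ.≤ j → j ℕ.< N → term ρs t (d ℕ.+ four j) ≡ 0ℤ) →
    Σ< (suc n) (term ρs t) ≡ term ρs t d ⊹ term ρs t (d ℕ.+ four N)
  only-ends t ρs 1≤t r = Σ<-pair (suc n) d (d ℕ.+ four N) (term ρs t) d<top (s≤s (subst (d ℕ.+ four N ℕ.≤_) (sym n≡d+) (ℕP.m≤m+n (d ℕ.+ four N) d))) other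
    where
    other : ∀ v → v ℕ.< suc n → v ≢ d → v ≢ d ℕ.+ four N → term ρs t v ≡ 0ℤ
    other v _ v≢d v≢top with D-vanishes v t 1≤t
    ... | inj₁ e = trans (cong (Π ρs (+ v) ⋆_) e) (ℤP.*-zeroʳ (Π ρs (+ v)))
    ... | inj₂ (zero , _ , e) = ⊥-elim (v≢d (trans e d+four0))
    ... | inj₂ (suc j , j≤N , e) = subst (λ v → term ρs t v ≡ 0ℤ) (sym e) (r (suc j) (s≤s z≤n) (ℕP.≤∧≢⇒< j≤N (λ { refl → v≢top e })))

  count-complement : ∀ v v̄ t → v ℕ.+ v̄ ≡ n → count v̄ t ≡ subsets t (λ u → (-1^ # u) ⋆ count v u)
  count-complement v v̄ t v+v̄ = begin
    count v̄ t
      ≡⟨ sym (∑C-⊕ (1w n) 1w∈ (λ c → ⟦ t ⊑ c ⟧ ⋆ ⟦ # c ≡ᵇ v̄ ⟧)) ⟩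
    ∑C (λ c → ⟦ t ⊑ (c ⊕ 1w n) ⟧ ⋆ ⟦ # (c ⊕ 1w n) ≡ᵇ v̄ ⟧)
      ≡⟨ ∑-cong (λ c → trans (cong (⟦ C c ⟧ ⋆_) (cong₂ (λ a b → a ⋆ ⟦ b ⟧) (inclusion-exclusion t c)
            (trans (cong (_≡ᵇ v̄) (#-complement c)) (complement-≡ᵇ {# c} {co# c} {v} (trans (#+co# c) (sym v+v̄))))))
          (trans (weave ⟦ C c ⟧ (subsets t (λ u → (-1^ # u) ⋆ ⟦ u ⊑ c ⟧)) ⟦ # c ≡ᵇ v ⟧) (sym (subsets-*ʳ t (λ u → (-1^ # u) ⋆ ⟦ u ⊑ c ⟧) (⟦ C c ⟧ ⋆ ⟦ # c ≡ᵇ v ⟧))))) ⟩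
    ∑ (λ c → subsets t (λ u → ((-1^ # u) ⋆ ⟦ u ⊑ c ⟧) ⋆ (⟦ C c ⟧ ⋆ ⟦ # c ≡ᵇ v ⟧)))
      ≡⟨ sym (subsets-∑ t (λ u c → ((-1^ # u) ⋆ ⟦ u ⊑ c ⟧) ⋆ (⟦ C c ⟧ ⋆ ⟦ # c ≡ᵇ v ⟧))) ⟩
    subsets t (λ u → ∑ (λ c → ((-1^ # u) ⋆ ⟦ u ⊑ c ⟧) ⋆ (⟦ C c ⟧ ⋆ ⟦ # c ≡ᵇ v ⟧)))
      ≡⟨ subsets-cong t (λ u _ → trans (∑-cong (λ c → shape (-1^ # u) ⟦ u ⊑ c ⟧ ⟦ C c ⟧ ⟦ # c ≡ᵇ v ⟧)) (∑-*ˡ (-1^ # u) (λ c → ⟦ C c ⟧ ⋆ (⟦ u ⊑ c ⟧ ⋆ ⟦ # c ≡ᵇ v ⟧)))) ⟩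
    subsets t (λ u → (-1^ # u) ⋆ count v u) ∎
    where
    open ≡-Reasoning
    weave : ∀ a s b → a ⋆ (s ⋆ b) ≡ s ⋆ (a ⋆ b)
    weave = solve-∀
    shape : ∀ a b c d → (a ⋆ b) ⋆ (c ⋆ d) ≡ a ⋆ (c ⋆ (b ⋆ d))
    shape = solve-∀

  count-mirror : ∀ v v̄ t → v ℕ.+ v̄ ≡ n → (∀ s → s ℕ.< # t → Const s v) →
    count v̄ t ≡ binomialSum (# t) (λ i → (-1^ i) ⋆ count v (segment n i)) ⊹ (-1^ # t) ⋆ D v t
  count-mirror v v̄ t v+v̄ lower = begin
    count v̄ t
      ≡⟨ count-complement v v̄ t v+v̄ ⟩
    subsets t (λ u → (-1^ # u) ⋆ count v u)
      ≡⟨ subsets-cong t (λ u _ → shape (-1^ # u) (count v u) (count v (segment n (# u)))) ⟩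
    subsets t (λ u → (-1^ # u) ⋆ count v (segment n (# u)) ⊹ (-1^ # u) ⋆ D v u)
      ≡⟨ subsets-+ t (λ u → (-1^ # u) ⋆ count v (segment n (# u))) (λ u → (-1^ # u) ⋆ D v u) ⟩
    subsets t (λ u → (-1^ # u) ⋆ count v (segment n (# u))) ⊹ subsets t (λ u → (-1^ # u) ⋆ D v u)
      ≡⟨ cong₂ _⊹_ (subsets-# t (λ i → (-1^ i) ⋆ count v (segment n i)))
           (subsets-top t (λ u → (-1^ # u) ⋆ D v u) (λ u _ u<t → trans (cong ((-1^ # u) ⋆_) (lower (# u) u<t u refl)) (ℤP.*-zeroʳ (-1^ # u)))) ⟩
    binomialSum (# t) (λ i → (-1^ i) ⋆ count v (segment n i)) ⊹ (-1^ # t) ⋆ D v t ∎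
    where
    open ≡-Reasoning
    shape : ∀ a b c → a ⋆ b ≡ a ⋆ c ⊹ a ⋆ (b ℤ.- c)
    shape = solve-∀

  -- By inclusion-exclusion over the subsets of t, the count at the complementary weight is a signed
  -- sum of counts at v. All proper subsets give values depending on their size only, so just the
  -- subset t itself remains, with sign (-1)^|t|.
  D-mirror : ∀ v v̄ t → v ℕ.+ v̄ ≡ n → (∀ s → s ℕ.< # t → Const s v) → D v̄ t ≡ (-1^ # t) ⋆ D v t
  D-mirror v v̄ t v+v̄ lower = trans (cong₂ ℤ._-_ (count-mirror v v̄ t v+v̄ lower) at-segment)
    (cancel (S (# t)) ((-1^ # t) ⋆ D v t) (-1^ # (segment n (# t))))
    where
    S : ℕ → ℤ
    S s = binomialSum s (λ i → (-1^ i) ⋆ count v (segment n i))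
    at-segment : count v̄ (segment n (# t)) ≡ S (# t) ⊹ (-1^ # (segment n (# t))) ⋆ 0ℤ
    at-segment = trans (count-mirror v v̄ (segment n (# t)) v+v̄ (λ s s<t → lower s (subst (s ℕ.<_) (#-seg t) s<t)))
      (cong₂ (λ a b → a ⊹ (-1^ # (segment n (# t))) ⋆ b) (cong S (#-seg t)) (D-seg v t))
    cancel : ∀ a b c → (a ⊹ b) ℤ.- (a ⊹ c ⋆ 0ℤ) ≡ b
    cancel = solve-∀

  extension-count : ∀ s v → Const (suc s) v → ∀ t → # t ≡ s → (+ v ℤ.- + s) ⋆ count v t ≡ (+ n ℤ.- + s) ⋆ count v (segment n (suc s))
  extension-count s v const t refl = trans (sym (count-extend v t)) (trans
    (extend-cong (1w n) t (⊑-1w t) (λ x _ e → ℤP.i-j≡0⇒i≡j _ _ (trans (cong (λ a → count v x ℤ.- count v (segment n a)) (sym e)) (const x e))))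
    (trans (extend-const (1w n) t (count v (segment n (suc (# t)))) (⊑-1w t)) (cong (λ a → (+ a ℤ.- + # t) ⋆ count v (segment n (suc (# t)))) (#-1w n))))

  -- Counting one-point extensions determines (v - s) times the count of an s-set, and v - s is not
  -- zero.
  Const-pred : ∀ s v → s ℕ.< v → Const (suc s) v → Const s v
  Const-pred s v s<v const t t≡s = ℤP.i≡j⇒i-j≡0 (*-cancelˡ (+ v ℤ.- + s) v-s≢0
      (trans (extension-count s v const t t≡s) (sym (extension-count s v const (segment n (# t)) (trans (#-seg t) t≡s)))))
    where
    v-s≢0 : + v ℤ.- + s ≢ 0ℤ
    v-s≢0 e = ℕP.<⇒≢ s<v (sym (ℤP.+-injective (ℤP.i-j≡0⇒i≡j (+ v) (+ s) e)))

4^≢0 : ∀ i → 4^ i ≢ 0ℤ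
4^≢0 i r = 2^≢0 (i ℕ.+ i) (trans (sym (4^≡2^ i)) r)

*-zero-cancel : ∀ {a b} → a ≢ 0ℤ → a ⋆ b ≡ 0ℤ → b ≡ 0ℤ
*-zero-cancel {a} {b} a≢0 r = *-cancelˡ a a≢0 (trans r (sym (ℤP.*-zeroʳ a)))

-1^odd : ∀ a → -1^ suc (four a) ≡ -1ℤ
-1^odd a = cong (-1ℤ ⋆_) (-1^four a)

module Transfer (m′ : ℕ) (C : Code (24 ℕ.* suc m′)) (ext : IsExtremalDESD (suc m′) C) where
  open Extremal m′ C ext
  open Weights d
  open Strength m′ C ext

  -- `M` = N - 1 is the number of weights strictly between d and n - d, and `weight mid` is n / 2.
  -- Both numbers are odd, which fixes the signs below and the final parity.
  M mid : ℕ
  M = suc (four m′)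
  mid = suc (m′ ℕ.+ m′)

  N≡mid+mid : N ≡ mid ℕ.+ mid
  N≡mid+mid = cong suc (trans (cong suc (half-four m′)) (sym (ℕP.+-suc (m′ ℕ.+ m′) (m′ ℕ.+ m′))))

  +d≡ : + d ≡ weight 0
  +d≡ = cong +_ (sym d+four0)

  run-at-d : ∀ len → Π (run 1 len) (+ d) ≡ (-1^ len) ⋆ ((4^ len) ⋆ fact len)
  run-at-d len = trans (cong (Π (run 1 len)) +d≡) (run-below 0 len)

  run-at-d≢0 : ∀ len → Π (run 1 len) (+ d) ≢ 0ℤ
  run-at-d≢0 len r = product≢0 (-1^≢0 len) (product≢0 (4^≢0 len) (0<fact len)) (trans (sym (run-at-d len)) r)
    where
    -1^≢0 : ∀ i → -1^ i ≢ 0ℤ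
    -1^≢0 (suc i) = product≢0 { -1ℤ} (λ ()) (-1^≢0 i)

  term-root : ∀ {ρs} t j → weight j ∈ ρs → term ρs t (d ℕ.+ four j) ≡ 0ℤ
  term-root t j r = trans (cong (_⋆ D (d ℕ.+ four j) t) (Π-∈ r)) (ℤP.*-zeroˡ (D (d ℕ.+ four j) t))

  term-D : ∀ ρs t j → D (d ℕ.+ four j) t ≡ 0ℤ → term ρs t (d ℕ.+ four j) ≡ 0ℤ
  term-D ρs t j r = trans (cong (Π ρs (weight j) ⋆_) r) (ℤP.*-zeroʳ (Π ρs (weight j)))

  -- The N roots are affordable as long as |t| + N < d = N + 6.
  const≤5 : ∀ t → 1 ℕ.≤ # t → # t ℕ.≤ 5 → D d t ≡ 0ℤ
  const≤5 t 1≤t t≤5 = *-zero-cancel (run-at-d≢0 N) (trans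
    (sym (only-d t (run 1 N) 1≤t (λ j 1≤j j≤N → term-root t j (run-∈ 1 N j 1≤j (s≤s j≤N)))))
    (difference-low t (run 1 N) (s≤s (ℕP.≤-trans (ℕP.≤-reflexive (cong (# t ℕ.+_) (run-length 1 N))) (ℕP.+-monoˡ-≤ N t≤5)))))

  -- Six points permit only N - 1 roots; the one given up belongs to a weight at which the deviation
  -- is known to vanish.
  const-6 : ∀ t j → # t ≡ 6 → 1 ℕ.≤ j → j ℕ.≤ N → D (d ℕ.+ four j) t ≡ 0ℤ → D d t ≡ 0ℤ
  const-6 t j t≡6 1≤j j≤N Dj = *-zero-cancel P≢0 (trans (sym (only-d t ρs (subst (1 ℕ.≤_) (sym t≡6) (s≤s z≤n)) zeros))
    (difference-low t ρs (ℕP.≤-reflexive (trans (cong suc (cong (ℕ._+ List.length ρs) t≡6)) (cong (6 ℕ.+_) (trans (sym (length-remove r)) (run-length 1 N)))))))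
    where
    r : weight j ∈ run 1 N
    r = run-∈ 1 N j 1≤j (s≤s j≤N)
    ρs : List ℤ
    ρs = run 1 N ─ r
    P≢0 : Π ρs (+ d) ≢ 0ℤ
    P≢0 e = run-at-d≢0 N (trans (Π-remove r (+ d)) (trans (cong ((+ d ℤ.- weight j) ⋆_) e) (ℤP.*-zeroʳ (+ d ℤ.- weight j))))
    zeros : ∀ i → 1 ℕ.≤ i → i ℕ.≤ N → term ρs t (d ℕ.+ four i) ≡ 0ℤ
    zeros i 1≤i i≤N with i ℕP.≟ j
    ... | yes refl = term-D ρs t j Dj
    ... | no i≢j = term-root t i (∈-remove r (run-∈ 1 N i 1≤i (s≤s i≤N)) (λ e → i≢j (weight-injective e)))

  run-top : Π (run 1 M) (+ (d ℕ.+ four N)) ≡ (4^ M) ⋆ fact M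
  run-top = run-above 1 M

  -- Put A = 4^M M!. As M is odd, the polynomial is -A at d and A at n - d, and the deviations there
  -- are opposite too. Since 4^N M! = 4 A, the identity of top degree says 4 A x = -2 A x.
  const-7 : ∀ t → # t ≡ 7 → D (d ℕ.+ four N) t ≡ -1ℤ ⋆ D d t → D d t ≡ 0ℤ
  const-7 t t≡7 mirror = *-zero-cancel {+ 6 ⋆ A} (product≢0 {+ 6} (λ ()) A≢0) (trans (shape A (D d t)) (trans (cong (ℤ._- ((-1ℤ ⋆ A) ⋆ D d t ⊹ A ⋆ (-1ℤ ⋆ D d t))) equation) (ℤP.+-inverseʳ ((-1ℤ ⋆ A) ⋆ D d t ⊹ A ⋆ (-1ℤ ⋆ D d t)))))
    where
    A : ℤ
    A = (4^ M) ⋆ fact M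
    A≢0 : A ≢ 0ℤ
    A≢0 = product≢0 (4^≢0 M) (0<fact M)
    shape : ∀ a x → (+ 6 ⋆ a) ⋆ x ≡ + 4 ⋆ a ⋆ x ℤ.- ((-1ℤ ⋆ a) ⋆ x ⊹ a ⋆ (-1ℤ ⋆ x))
    shape = solve-∀
    assoc : ∀ a f x → (+ 4 ⋆ a) ⋆ (f ⋆ x) ≡ + 4 ⋆ (a ⋆ f) ⋆ x
    assoc = solve-∀
    equation : + 4 ⋆ A ⋆ D d t ≡ (-1ℤ ⋆ A) ⋆ D d t ⊹ A ⋆ (-1ℤ ⋆ D d t)
    equation = begin
      + 4 ⋆ A ⋆ D d t
        ≡⟨ sym (assoc (4^ M) (fact M) (D d t)) ⟩
      (4^ N) ⋆ (fact M ⋆ D d t)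
        ≡⟨ cong (λ a → (4^ N) ⋆ (fact a ⋆ D d t)) (sym (run-length 1 M)) ⟩
      (4^ N) ⋆ (fact (List.length (run 1 M)) ⋆ D d t)
        ≡⟨ sym (difference-top t (run 1 M) (trans (cong₂ ℕ._+_ t≡7 (run-length 1 M)) refl)) ⟩
      Σ< (suc n) (term (run 1 M) t)
        ≡⟨ only-ends t (run 1 M) (subst (1 ℕ.≤_) (sym t≡7) (s≤s z≤n)) (λ j 1≤j j<N → term-root t j (run-∈ 1 M j 1≤j j<N)) ⟩
      Π (run 1 M) (+ d) ⋆ D d t ⊹ Π (run 1 M) (+ (d ℕ.+ four N)) ⋆ D (d ℕ.+ four N) t
        ≡⟨ cong₂ _⊹_ (cong (_⋆ D d t) (trans (run-at-d M) (cong (_⋆ A) (-1^odd m′)))) (cong₂ _⋆_ run-top mirror) ⟩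
      (-1ℤ ⋆ A) ⋆ D d t ⊹ A ⋆ (-1ℤ ⋆ D d t) ∎
      where open ≡-Reasoning

  -- P kills all weights strictly between the extreme ones except the j-th and the l-th; the factor x - weight mid makes it
  -- even about n / 2 and brings its degree to d - 8.
  record Kernel (j l : ℕ) : Set where
    field
      ρs : List ℤ
      length≡ : List.length ρs ≡ four m′
      product : ∀ x → Π ρs x ⋆ ((x ℤ.- weight j) ⋆ (x ℤ.- weight l)) ≡ Π (run 1 M) x ⋆ (x ℤ.- weight mid)

  -- If j = l, both equal `mid`, and dropping this one root suffices. Otherwise the roots at j and l
  -- are dropped and `mid`, still present, becomes a double root.
  kernel : ∀ j l → 1 ℕ.≤ j → 1 ℕ.≤ l → j ℕ.+ l ≡ N → Kernel j l
  kernel j l 1≤j 1≤l j+l with j ℕP.≟ l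
  ... | yes refl = record
    { ρs = run 1 M ─ r
    ; length≡ = ℕP.suc-injective (trans (sym (length-remove r)) (run-length 1 M))
    ; product = λ x → trans (shape (Π (run 1 M ─ r) x) (x ℤ.- weight j)) (cong₂ (λ a b → a ⋆ (x ℤ.- weight b)) (sym (Π-remove r x)) j≡mid) }
    where
    r : weight j ∈ run 1 M
    r = run-∈ 1 M j 1≤j (subst (j ℕ.<_) j+l (ℕP.m<m+n j 1≤l))
    j≡mid : j ≡ mid
    j≡mid = ℕP.*-cancelˡ-≡ j mid 2 (trans (cong (j ℕ.+_) (ℕP.+-identityʳ j)) (trans j+l (trans N≡mid+mid (cong (mid ℕ.+_) (sym (ℕP.+-identityʳ mid))))))
    shape : ∀ a b → a ⋆ (b ⋆ b) ≡ (b ⋆ a) ⋆ b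
    shape = solve-∀
  ... | no j≢l = record
    { ρs = weight mid List.∷ ((run 1 M ─ r) ─ r′)
    ; length≡ = ℕP.suc-injective (trans (cong suc (sym (length-remove r′))) (trans (sym (length-remove r)) (run-length 1 M)))
    ; product = λ x → trans (shape (x ℤ.- weight mid) (Π ((run 1 M ─ r) ─ r′) x) (x ℤ.- weight j) (x ℤ.- weight l))
        (cong (_⋆ (x ℤ.- weight mid)) (sym (trans (Π-remove r x) (cong ((x ℤ.- weight j) ⋆_) (Π-remove r′ x))))) }
    where
    r : weight j ∈ run 1 M
    r = run-∈ 1 M j 1≤j (subst (j ℕ.<_) j+l (ℕP.m<m+n j 1≤l))
    r′ : weight l ∈ (run 1 M ─ r)
    r′ = ∈-remove r (run-∈ 1 M l 1≤l (subst (l ℕ.<_) (trans (ℕP.+-comm l j) j+l) (ℕP.m<m+n l 1≤j))) (λ e → j≢l (sym (weight-injective e)))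
    shape : ∀ m p a b → (m ⋆ p) ⋆ (a ⋆ b) ≡ (a ⋆ (b ⋆ p)) ⋆ m
    shape = solve-∀

  -- At both extreme weights P · (4 j)(4 l) equals 4 `mid` · 4^M M!. Comparison with the term of top
  -- degree gives 8 · 4^M (M - 1)! (M · `mid` - 8 j l) x = 0.
  const-8 : ∀ t j l → # t ≡ 8 → 1 ℕ.≤ j → 1 ℕ.≤ l → j ℕ.+ l ≡ N → D (d ℕ.+ four j) t ≡ 0ℤ → D (d ℕ.+ four l) t ≡ 0ℤ →
    D (d ℕ.+ four N) t ≡ D d t → D d t ≡ 0ℤ
  const-8 t j l t≡8 1≤j 1≤l j+l Dj Dl mirror = *-zero-cancel {+ 8 ⋆ B₀ ⋆ (+ M ⋆ + mid ℤ.- + 8 ⋆ (+ j ⋆ + l))}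
    (product≢0 (product≢0 {+ 8} (λ ()) (product≢0 (4^≢0 M) (0<fact (four m′)))) parity) (begin
      + 8 ⋆ B₀ ⋆ (+ M ⋆ + mid ℤ.- + 8 ⋆ (+ j ⋆ + l)) ⋆ x
        ≡⟨ shape (4^ M) (fact (four m′)) (+ M) (+ mid) (+ j) (+ l) x ⟩
      (A ⋆ (+ 4 ⋆ + mid)) ⋆ x ⊹ (A ⋆ (+ 4 ⋆ + mid)) ⋆ x ℤ.- (+ 4 ⋆ + j) ⋆ (+ 4 ⋆ + l) ⋆ ((+ 4 ⋆ (4^ M)) ⋆ (fact (four m′) ⋆ x))
        ≡⟨ cong₂ (λ a b → a ⋆ x ⊹ b ⋆ x ℤ.- (+ 4 ⋆ + j) ⋆ (+ 4 ⋆ + l) ⋆ ((+ 4 ⋆ (4^ M)) ⋆ (fact (four m′) ⋆ x))) (sym P-bottom) (sym P-top) ⟩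
      (P (+ d) ⋆ jl) ⋆ x ⊹ (P (+ (d ℕ.+ four N)) ⋆ jl) ⋆ x ℤ.- jl ⋆ ((4^ N) ⋆ (fact (four m′) ⋆ x))
        ≡⟨ collect (P (+ d)) (P (+ (d ℕ.+ four N))) jl x ((4^ N) ⋆ (fact (four m′) ⋆ x)) ⟩
      jl ⋆ ((P (+ d) ⋆ x ⊹ P (+ (d ℕ.+ four N)) ⋆ x) ℤ.- (4^ N) ⋆ (fact (four m′) ⋆ x))
        ≡⟨ cong (jl ⋆_) (ℤP.i≡j⇒i-j≡0 equation) ⟩
      jl ⋆ 0ℤ
        ≡⟨ ℤP.*-zeroʳ jl ⟩
      0ℤ ∎)
    where
    open ≡-Reasoning
    open Kernel (kernel j l 1≤j 1≤l j+l)
    x A B₀ jl : ℤ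
    x = D d t
    A = (4^ M) ⋆ fact M
    B₀ = (4^ M) ⋆ fact (four m′)
    jl = (+ 4 ⋆ + j) ⋆ (+ 4 ⋆ + l)
    P : ℤ → ℤ
    P = Π ρs
    shape : ∀ a f m h j l x → + 8 ⋆ (a ⋆ f) ⋆ (m ⋆ h ℤ.- + 8 ⋆ (j ⋆ l)) ⋆ x
      ≡ ((a ⋆ (m ⋆ f)) ⋆ (+ 4 ⋆ h)) ⋆ x ⊹ ((a ⋆ (m ⋆ f)) ⋆ (+ 4 ⋆ h)) ⋆ x ℤ.- (+ 4 ⋆ j) ⋆ (+ 4 ⋆ l) ⋆ ((+ 4 ⋆ a) ⋆ (f ⋆ x))
    shape = solve-∀
    collect : ∀ p r s x y → (p ⋆ s) ⋆ x ⊹ (r ⋆ s) ⋆ x ℤ.- s ⋆ y ≡ s ⋆ ((p ⋆ x ⊹ r ⋆ x) ℤ.- y)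
    collect = solve-∀
    -- M = 4 m′ + 1 and `mid` = 2 m′ + 1 have an odd product, which cannot be 8 j l.
    parity : + M ⋆ + mid ℤ.- + 8 ⋆ (+ j ⋆ + l) ≢ 0ℤ
    parity e = ℕP.even≢odd (4 ℕ.* (j ℕ.* l)) (m′ ℕ.* (3 ℕ.+ 4 ℕ.* m′)) (trans (eight (j ℕ.* l)) (trans (sym (ℤP.+-injective (trans (ℤP.pos-* M mid)
        (trans (ℤP.i-j≡0⇒i≡j _ _ e) (trans (cong (+ 8 ⋆_) (sym (ℤP.pos-* j l))) (sym (ℤP.pos-* 8 (j ℕ.* l)))))))) (trans (cong (λ a → suc a ℕ.* mid) (four≡ m′)) (odd m′))))
      where
      eight : ∀ a → 2 ℕ.* (4 ℕ.* a) ≡ 8 ℕ.* a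
      eight = solveℕ-∀
      odd : ∀ a → suc (4 ℕ.* a) ℕ.* suc (a ℕ.+ a) ≡ suc (2 ℕ.* (a ℕ.* (3 ℕ.+ 4 ℕ.* a)))
      odd = solveℕ-∀
    P-bottom : P (+ d) ⋆ jl ≡ A ⋆ (+ 4 ⋆ + mid)
    P-bottom = begin
      P (+ d) ⋆ jl
        ≡⟨ cong (P (+ d) ⋆_) (negate (+ j) (+ l)) ⟩
      P (+ d) ⋆ ((+ 4 ⋆ (0ℤ ℤ.- + j)) ⋆ (+ 4 ⋆ (0ℤ ℤ.- + l)))
        ≡⟨ cong (P (+ d) ⋆_) (sym (cong₂ _⋆_ (trans (cong (ℤ._- weight j) +d≡) (weight-diff 0 j)) (trans (cong (ℤ._- weight l) +d≡) (weight-diff 0 l)))) ⟩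
      P (+ d) ⋆ ((+ d ℤ.- weight j) ⋆ (+ d ℤ.- weight l))
        ≡⟨ product (+ d) ⟩
      Π (run 1 M) (+ d) ⋆ (+ d ℤ.- weight mid)
        ≡⟨ cong₂ _⋆_ (trans (run-at-d M) (cong (_⋆ A) (-1^odd m′))) (trans (cong (ℤ._- weight mid) +d≡) (weight-diff 0 mid)) ⟩
      (-1ℤ ⋆ A) ⋆ (+ 4 ⋆ (0ℤ ℤ.- + mid))
        ≡⟨ signs A (+ mid) ⟩
      A ⋆ (+ 4 ⋆ + mid) ∎
      where
      negate : ∀ a b → (+ 4 ⋆ a) ⋆ (+ 4 ⋆ b) ≡ (+ 4 ⋆ (0ℤ ℤ.- a)) ⋆ (+ 4 ⋆ (0ℤ ℤ.- b))
      negate = solve-∀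
      signs : ∀ a b → (-1ℤ ⋆ a) ⋆ (+ 4 ⋆ (0ℤ ℤ.- b)) ≡ a ⋆ (+ 4 ⋆ b)
      signs = solve-∀
    P-top : P (+ (d ℕ.+ four N)) ⋆ jl ≡ A ⋆ (+ 4 ⋆ + mid)
    P-top = begin
      P (weight N) ⋆ jl
        ≡⟨ cong (P (weight N) ⋆_) (trans (ℤP.*-comm (+ 4 ⋆ + j) (+ 4 ⋆ + l)) (sym (cong₂ _⋆_ (gap j l j+l) (gap l j (trans (ℕP.+-comm l j) j+l))))) ⟩
      P (weight N) ⋆ ((weight N ℤ.- weight j) ⋆ (weight N ℤ.- weight l))
        ≡⟨ product (weight N) ⟩
      Π (run 1 M) (weight N) ⋆ (weight N ℤ.- weight mid)
        ≡⟨ cong₂ _⋆_ run-top (gap mid mid (sym N≡mid+mid)) ⟩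
      A ⋆ (+ 4 ⋆ + mid) ∎
      where
      gap : ∀ i i′ → i ℕ.+ i′ ≡ N → weight N ℤ.- weight i ≡ + 4 ⋆ + i′
      gap i i′ e = trans (weight-diff N i) (cong (+ 4 ⋆_) (trans (cong (ℤ._- + i) (trans (cong +_ (sym e)) (ℤP.pos-+ i i′))) (cancel (+ i) (+ i′))))
        where
        cancel : ∀ a b → (a ⊹ b) ℤ.- a ≡ b
        cancel = solve-∀
    zeros : ∀ i → 1 ℕ.≤ i → i ℕ.< N → term ρs t (d ℕ.+ four i) ≡ 0ℤ
    zeros i 1≤i i<N with i ℕP.≟ j | i ℕP.≟ l
    ... | yes refl | _ = term-D ρs t j Dj
    ... | no _ | yes refl = term-D ρs t l Dl
    ... | no i≢j | no i≢l = trans (cong (_⋆ D (d ℕ.+ four i) t) (*-zero-cancel (product≢0 (apart j i≢j) (apart l i≢l))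
        (trans (ℤP.*-comm _ (P (weight i))) (trans (product (weight i)) (trans (cong (_⋆ (weight i ℤ.- weight mid)) (Π-∈ (run-∈ 1 M i 1≤i i<N))) (ℤP.*-zeroˡ (weight i ℤ.- weight mid))))))) (ℤP.*-zeroˡ (D (d ℕ.+ four i) t))
      where
      apart : ∀ h → i ≢ h → weight i ℤ.- weight h ≢ 0ℤ
      apart h i≢h e = i≢h (weight-injective (ℤP.i-j≡0⇒i≡j (weight i) (weight h) e))
    equation : P (+ d) ⋆ x ⊹ P (+ (d ℕ.+ four N)) ⋆ x ≡ (4^ N) ⋆ (fact (four m′) ⋆ x)
    equation = begin
      P (+ d) ⋆ x ⊹ P (+ (d ℕ.+ four N)) ⋆ x
        ≡⟨ cong (λ a → P (+ d) ⋆ x ⊹ P (+ (d ℕ.+ four N)) ⋆ a) (sym mirror) ⟩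
      term ρs t d ⊹ term ρs t (d ℕ.+ four N)
        ≡⟨ sym (only-ends t ρs (subst (1 ℕ.≤_) (sym t≡8) (s≤s z≤n)) zeros) ⟩
      Σ< (suc n) (term ρs t)
        ≡⟨ difference-top t ρs (trans (cong₂ ℕ._+_ t≡8 length≡) refl) ⟩
      (4^ N) ⋆ (fact (List.length ρs) ⋆ x)
        ≡⟨ cong (λ a → (4^ N) ⋆ (fact a ⋆ x)) length≡ ⟩
      (4^ N) ⋆ (fact (four m′) ⋆ x) ∎

  8≤d : 8 ℕ.≤ d
  8≤d = ℕP.m≤m+n 8 (four m′)

  const-down : ∀ v → 8 ℕ.≤ v → Const 8 v → ∀ i s → s ℕ.+ i ≡ 8 → Const s v
  const-down v 8≤v c₈ zero s e = subst (λ s → Const s v) (trans (sym e) (ℕP.+-identityʳ s)) c₈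
  const-down v 8≤v c₈ (suc i) s e = Const-pred s v (ℕP.<-≤-trans s<8 8≤v)
    (const-down v 8≤v c₈ i (suc s) (trans (sym (ℕP.+-suc s i)) e))
    where
    s<8 : s ℕ.< 8
    s<8 = subst (s ℕ.<_) e (ℕP.m<m+n s (s≤s z≤n))

  const-all : ∀ v → 8 ℕ.≤ v → Const 8 v → ∀ s → s ℕ.≤ 8 → Const s v
  const-all v 8≤v c₈ s s≤8 = const-down v 8≤v c₈ (8 ℕ.∸ s) s (ℕP.m+[n∸m]≡n s≤8)

  const-0 : ∀ v → Const 0 v
  const-0 v t t≡0 = ℤP.i≡j⇒i-j≡0 (cong (count v) (trans (#≡0 t t≡0) (sym (#≡0 (segment n (# t)) (trans (#-seg t) t≡0)))))

  transfer : ∀ j l → j ℕ.+ l ≡ N → Const 8 (d ℕ.+ four j) → ∀ s → s ℕ.≤ 8 → Const s d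
  transfer j l j+l c₈ = go j l j+l refl refl
    where
    w w̄ : ℕ
    w = d ℕ.+ four j
    w̄ = d ℕ.+ four l
    four-+ : ∀ a b → four (a ℕ.+ b) ≡ four a ℕ.+ four b
    four-+ zero b = refl
    four-+ (suc a) b = cong (4 ℕ.+_) (four-+ a b)
    w+w̄ : w ℕ.+ w̄ ≡ n
    w+w̄ = sym (trans n≡d+ (trans (cong (λ a → d ℕ.+ a ℕ.+ d) (trans (cong four (sym j+l)) (four-+ j l))) (arith d (four j) (four l))))
      where
      arith : ∀ d a b → d ℕ.+ (a ℕ.+ b) ℕ.+ d ≡ d ℕ.+ a ℕ.+ (d ℕ.+ b)
      arith = solveℕ-∀
    const-w : ∀ s → s ℕ.≤ 8 → Const s w
    const-w = const-all w (ℕP.≤-trans 8≤d (ℕP.m≤m+n d (four j))) c₈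
    const-w̄ : ∀ s → s ℕ.≤ 8 → Const s w̄
    const-w̄ s s≤8 t refl = trans (D-mirror w w̄ t w+w̄ (λ i i<s → const-w i (ℕP.≤-trans (ℕP.<⇒≤ i<s) s≤8)))
      (trans (cong ((-1^ # t) ⋆_) (const-w (# t) s≤8 t refl)) (ℤP.*-zeroʳ (-1^ # t)))
    d+top : d ℕ.+ (d ℕ.+ four N) ≡ n
    d+top = trans (ℕP.+-comm d (d ℕ.+ four N)) (sym n≡d+)
    go : ∀ j′ l′ → j′ ℕ.+ l′ ≡ N → j′ ≡ j → l′ ≡ l → ∀ s → s ℕ.≤ 8 → Const s d
    -- The extreme cases are immediate: j = 0 means w = d, and l = 0 means n - w = d.
    go zero l′ _ refl _ s s≤8 = subst (Const s) d+four0 (const-w s s≤8)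
    go (suc j′) zero _ _ refl s s≤8 = subst (Const s) d+four0 (const-w̄ s s≤8)
    go (suc j′) (suc l′) e refl refl = all
      where
      small : ∀ s → s ℕ.≤ 5 → Const s d
      small zero _ = const-0 d
      small (suc s) s≤5 t t≡s = const≤5 t (subst (1 ℕ.≤_) (sym t≡s) (s≤s z≤n)) (subst (ℕ._≤ 5) (sym t≡s) s≤5)
      six : Const 6 d
      six t t≡6 = const-6 t (suc j′) t≡6 (s≤s z≤n) (subst (suc j′ ℕ.≤_) e (ℕP.m≤m+n (suc j′) (suc l′))) (const-w 6 (ℕP.m≤m+n 6 2) t t≡6)
      below-7 : ∀ s → s ℕ.< 7 → Const s d
      below-7 s s<7 with s ℕP.≟ 6
      ... | yes refl = six
      ... | no s≢6 = small s (ℕP.≤-pred (ℕP.≤∧≢⇒< (ℕP.≤-pred s<7) s≢6))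
      seven : Const 7 d
      seven t t≡7 = const-7 t t≡7 (trans (D-mirror d (d ℕ.+ four N) t d+top (λ s s<t → below-7 s (subst (s ℕ.<_) t≡7 s<t))) (cong (λ a → (-1^ a) ⋆ D d t) t≡7))
      below-8 : ∀ s → s ℕ.< 8 → Const s d
      below-8 s s<8 with s ℕP.≟ 7
      ... | yes refl = seven
      ... | no s≢7 = below-7 s (ℕP.≤∧≢⇒< (ℕP.≤-pred s<8) s≢7)
      eight : Const 8 d
      eight t t≡8 = const-8 t (suc j′) (suc l′) t≡8 (s≤s z≤n) (s≤s z≤n) e (c₈ t t≡8) (const-w̄ 8 ℕP.≤-refl t t≡8)
        (trans (D-mirror d (d ℕ.+ four N) t d+top (λ s s<t → below-8 s (subst (s ℕ.<_) t≡8 s<t))) (trans (cong (λ a → (-1^ a) ⋆ D d t) t≡8) (ℤP.*-identityˡ (D d t))))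
      all : ∀ s → s ℕ.≤ 8 → Const s d
      all s s≤8 with s ℕP.≟ 8
      ... | yes refl = eight
      ... | no s≢8 = below-8 s (ℕP.≤∧≢⇒< s≤8 s≢8)

-- Arithmetic contradictions

-1^-parity : ∀ a → -1^ a ≡ 1ℤ → 2 ∣ a
-1^-parity zero _ = divides 0 refl
-1^-parity (suc (suc a)) r with -1^-parity a (trans (sym (double (-1^ a))) r)
  where
  double : ∀ b → -1ℤ ⋆ (-1ℤ ⋆ b) ≡ b
  double = solve-∀
... | divides h e = divides (suc h) (cong (λ x → suc (suc x)) e)

parity--1^ : ∀ {a} → 2 ∣ a → -1^ a ≡ 1ℤ
parity--1^ (divides h refl) = go h
  where
  go : ∀ h → -1^ (h ℕ.* 2) ≡ 1ℤ
  go zero = refl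
  go (suc h) = trans (double (-1^ (h ℕ.* 2))) (go h)
    where
    double : ∀ b → -1ℤ ⋆ (-1ℤ ⋆ b) ≡ b
    double = solve-∀

sg-· : ∀ {n} (x y : Word n) → sg (x · y) ≡ -1^ (x ∩# y)
sg-· [] [] = refl
sg-· (true ∷ x) (true ∷ y) = trans (sg-xor true (x · y)) (cong (-1ℤ ⋆_) (sg-· x y))
sg-· (true ∷ x) (false ∷ y) = sg-· x y
sg-· (false ∷ x) (_ ∷ y) = sg-· x y

_∧ʷ_ : ∀ {n} → Word n → Word n → Word n
_∧ʷ_ = zipWith _∧_

∧ʷ-⊑ : ∀ {n} (x y : Word n) → ((x ∧ʷ y) ⊑ x) ≡ true
∧ʷ-⊑ [] [] = refl
∧ʷ-⊑ (true ∷ x) (true ∷ y) = ∧ʷ-⊑ x y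
∧ʷ-⊑ (true ∷ x) (false ∷ y) = ∧ʷ-⊑ x y
∧ʷ-⊑ (false ∷ x) (_ ∷ y) = ∧ʷ-⊑ x y

#-⊕ : ∀ {n} (x y : Word n) → # (x ⊕ y) ℕ.+ 2 ℕ.* (x ∩# y) ≡ # x ℕ.+ # y
#-⊕ [] [] = refl
#-⊕ (true ∷ x) (true ∷ y) = trans (cong (# (x ⊕ y) ℕ.+_) (ℕP.*-suc 2 (x ∩# y))) (trans (shape (# (x ⊕ y)) _) (trans (cong (2 ℕ.+_) (#-⊕ x y)) (cong suc (sym (ℕP.+-suc (# x) (# y))))))
  where
  shape : ∀ a b → a ℕ.+ (2 ℕ.+ b) ≡ 2 ℕ.+ (a ℕ.+ b)
  shape = solveℕ-∀
#-⊕ (true ∷ x) (false ∷ y) = cong suc (#-⊕ x y)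
#-⊕ (false ∷ x) (true ∷ y) = trans (cong suc (#-⊕ x y)) (sym (ℕP.+-suc (# x) (# y)))
#-⊕ (false ∷ x) (false ∷ y) = #-⊕ x y

∩#-⊕ : ∀ {n} (x y z : Word n) → x ∩# (y ⊕ z) ℕ.+ 2 ℕ.* ((x ∧ʷ y) ∩# z) ≡ x ∩# y ℕ.+ x ∩# z
∩#-⊕ [] [] [] = refl
∩#-⊕ (false ∷ x) (_ ∷ y) (_ ∷ z) = ∩#-⊕ x y z
∩#-⊕ (true ∷ x) (true ∷ y) (true ∷ z) = trans (cong (x ∩# (y ⊕ z) ℕ.+_) (ℕP.*-suc 2 ((x ∧ʷ y) ∩# z))) (trans (shape (x ∩# (y ⊕ z)) _) (trans (cong (2 ℕ.+_) (∩#-⊕ x y z)) (cong suc (sym (ℕP.+-suc (x ∩# y) (x ∩# z))))))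
  where
  shape : ∀ a b → a ℕ.+ (2 ℕ.+ b) ≡ 2 ℕ.+ (a ℕ.+ b)
  shape = solveℕ-∀
∩#-⊕ (true ∷ x) (true ∷ y) (false ∷ z) = cong suc (∩#-⊕ x y z)
∩#-⊕ (true ∷ x) (false ∷ y) (true ∷ z) = trans (cong suc (∩#-⊕ x y z)) (sym (ℕP.+-suc (x ∩# y) (x ∩# z)))
∩#-⊕ (true ∷ x) (false ∷ y) (false ∷ z) = ∩#-⊕ x y z

subword : ∀ {n} (x : Word n) s → s ℕ.≤ # x → ∃ λ t → (t ⊑ x) ≡ true × # t ≡ s
subword {n} x zero _ = 0w n , 0w-⊑ x , #-0w n
subword (false ∷ x) (suc s) r with subword x (suc s) r
... | t , p , q = false ∷ t , p , q
subword (true ∷ x) (suc s) (s≤s r) with subword x s r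
... | t , p , q = true ∷ t , p , cong suc q

⊑-∧ʷ-0 : ∀ {n} (t x y : Word n) → (t ⊑ x) ≡ true → x ∧ʷ y ≡ 0w n → t ∩# y ≡ 0
⊑-∧ʷ-0 [] [] [] _ _ = refl
⊑-∧ʷ-0 (false ∷ t) (_ ∷ x) (_ ∷ y) p r = ⊑-∧ʷ-0 t x y p (cong Vec.tail r)
⊑-∧ʷ-0 (true ∷ t) (true ∷ x) (false ∷ y) p r = ⊑-∧ʷ-0 t x y p (cong Vec.tail r)

⊑-∧ʷ-all : ∀ {n} (t x y : Word n) → (t ⊑ x) ≡ true → x ∧ʷ y ≡ x → t ∩# y ≡ # t
⊑-∧ʷ-all [] [] [] _ _ = refl
⊑-∧ʷ-all (false ∷ t) (_ ∷ x) (_ ∷ y) p r = ⊑-∧ʷ-all t x y p (cong Vec.tail r)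
⊑-∧ʷ-all (true ∷ t) (true ∷ x) (true ∷ y) p r = cong suc (⊑-∧ʷ-all t x y p (cong Vec.tail r))

-- If all weights were divisible by 8, C would be closed under intersection, so a minimum word would meet every codeword
-- trivially and every pair of its coordinates would be orthogonal to C.
module NotTriplyEven {n} (C : Code n) (lin : IsLinear C) (sd : IsSelfDual C) (triply : ∀ x → x ∈C C → 8 ∣ # x)
  (d : ℕ) (2<d : 2 ℕ.< d) (min : ∀ x → x ∈C C → x ≢ 0w n → d ℕ.≤ # x) (x₀ : Word n) (x₀∈ : x₀ ∈C C) (#x₀ : # x₀ ≡ d) where

  ∩-quadruply : ∀ x y → x ∈C C → y ∈C C → 4 ∣ x ∩# y
  ∩-quadruply x y x∈ y∈ = *-cancelˡ-∣ 2 (∣m+n∣m⇒∣n (subst (8 ∣_) (sym (#-⊕ x y)) (∣m∣n⇒∣m+n (triply x x∈) (triply y y∈))) (triply (x ⊕ y) (IsLinear.⊕-closed lin x y x∈ y∈)))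

  orthogonal : ∀ (x y : Word n) → 2 ∣ x ∩# y → x · y ≡ false
  orthogonal x y r = sg-injective-false _ (trans (sg-· x y) (parity--1^ r))

  -- In |x ∩ (y + z)| + 2 |x ∩ y ∩ z| = |x ∩ y| + |x ∩ z| all pairwise intersections of codewords
  -- are divisible by 4. Hence x ∩ y meets every codeword z evenly and lies in the dual code.
  ∧ʷ-closed : ∀ x y → x ∈C C → y ∈C C → (x ∧ʷ y) ∈C C
  ∧ʷ-closed x y x∈ y∈ = Equivalence.from (sd (x ∧ʷ y)) λ z z∈ → orthogonal (x ∧ʷ y) z
    (*-cancelˡ-∣ 2 (∣m+n∣m⇒∣n (subst (4 ∣_) (sym (∩#-⊕ x y z)) (∣m∣n⇒∣m+n (∩-quadruply x y x∈ y∈) (∩-quadruply x z x∈ z∈))) (∩-quadruply x (y ⊕ z) x∈ (IsLinear.⊕-closed lin y z y∈ z∈))))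

  absurd : ⊥
  absurd with subword x₀ 2 (ℕP.<⇒≤ (subst (2 ℕ.<_) (sym #x₀) 2<d))
  ... | t , t⊑x₀ , #t = ℕP.<-irrefl refl (ℕP.<-≤-trans 2<d (subst (d ℕ.≤_) #t (min t t∈ (λ { refl → ℕP.0≢1+n (trans (sym (#-0w n)) #t) }))))
    where
    t∈ : t ∈C C
    t∈ = Equivalence.from (sd t) λ y y∈ → orthogonal t y (go y (# (x₀ ∧ʷ y) ℕP.≟ 0) y∈)
      where
      go : ∀ y → Dec (# (x₀ ∧ʷ y) ≡ 0) → y ∈C C → 2 ∣ t ∩# y
      go y (yes r) y∈ = subst (2 ∣_) (sym (⊑-∧ʷ-0 t x₀ y t⊑x₀ (#≡0 (x₀ ∧ʷ y) r))) (divides 0 refl)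
      go y (no r) y∈ = subst (2 ∣_) (sym (trans (⊑-∧ʷ-all t x₀ y t⊑x₀ (⊑-antisym-# (x₀ ∧ʷ y) x₀ (∧ʷ-⊑ x₀ y)
          (subst (ℕ._≤ # (x₀ ∧ʷ y)) (sym #x₀) (min (x₀ ∧ʷ y) (∧ʷ-closed x₀ y x₀∈ y∈) (λ e → r (trans (cong # e) (#-0w n))))))) #t)) (divides 1 refl)

fallingFactorial : ℤ → ℕ → ℤ
fallingFactorial h zero = 1ℤ
fallingFactorial h (suc r) = fallingFactorial h r ⋆ (h ℤ.- + r)

falling-suc : ∀ h r → fallingFactorial (1ℤ ⊹ h) (suc r) ≡ (1ℤ ⊹ h) ⋆ fallingFactorial h r
falling-suc h zero = shape h
  where
  shape : ∀ h → 1ℤ ⋆ ((1ℤ ⊹ h) ℤ.- 0ℤ) ≡ (1ℤ ⊹ h) ⋆ 1ℤ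
  shape = solve-∀
falling-suc h (suc r) = trans (cong (_⋆ ((1ℤ ⊹ h) ℤ.- + suc r)) (falling-suc h r)) (shape h (+ r) (fallingFactorial h r))
  where
  shape : ∀ h r f → ((1ℤ ⊹ h) ⋆ f) ⋆ ((1ℤ ⊹ h) ℤ.- (1ℤ ⊹ r)) ≡ (1ℤ ⊹ h) ⋆ (f ⋆ (h ℤ.- r))
  shape = solve-∀

-- The quotient is a binomial coefficient; the induction is Pascal's rule multiplied by the
-- factorial.
fact-divides-falling : ∀ h r → ∃ λ y → fallingFactorial (+ h) r ≡ fact r ⋆ y
fact-divides-falling h zero = 1ℤ , refl
fact-divides-falling zero (suc r) = 0ℤ , trans (zero-falling r) (sym (ℤP.*-zeroʳ (fact (suc r))))
  where
  zero-falling : ∀ r → fallingFactorial 0ℤ (suc r) ≡ 0ℤ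
  zero-falling zero = refl
  zero-falling (suc r) = trans (cong (_⋆ (0ℤ ℤ.- + suc r)) (zero-falling r)) (ℤP.*-zeroˡ (0ℤ ℤ.- + suc r))
fact-divides-falling (suc h) (suc r) with fact-divides-falling h (suc r) | fact-divides-falling h r
... | y , p | y′ , p′ = y ⊹ y′ , trans (falling-suc (+ h) r) (trans (shape (+ h) (+ r) (fallingFactorial (+ h) r))
    (trans (cong₂ (λ a b → a ⊹ + suc r ⋆ b) p p′) (collect (+ suc r) (fact r) y y′)))
  where
  shape : ∀ h r f → (1ℤ ⊹ h) ⋆ f ≡ f ⋆ (h ℤ.- r) ⊹ (1ℤ ⊹ r) ⋆ f
  shape = solve-∀
  collect : ∀ a b c d → (a ⋆ b) ⋆ c ⊹ a ⋆ (b ⋆ d) ≡ (a ⋆ b) ⋆ (c ⊹ d)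
  collect = solve-∀

evens : ℕ → List ℤ
evens zero = List.[]
evens (suc r) = (+ 2 ⋆ + r) List.∷ evens r

length-evens : ∀ r → List.length (evens r) ≡ r
length-evens zero = refl
length-evens (suc r) = cong suc (length-evens r)

Π-evens : ∀ r h → Π (evens r) (+ 2 ⋆ h) ≡ (2^ r) ⋆ fallingFactorial h r
Π-evens zero h = refl
Π-evens (suc r) h = trans (cong ((+ 2 ⋆ h ℤ.- + 2 ⋆ + r) ⋆_) (Π-evens r h)) (shape h (+ r) (2^ r) (fallingFactorial h r))
  where
  shape : ∀ h r a f → (+ 2 ⋆ h ℤ.- + 2 ⋆ r) ⋆ (a ⋆ f) ≡ (+ 2 ⋆ a) ⋆ (f ⋆ (h ℤ.- r))
  shape = solve-∀

∑-multiple : ∀ {n} a (f : Word n → ℤ) → (∀ x → ∃ λ y → f x ≡ a ⋆ y) → ∃ λ y → ∑ f ≡ a ⋆ y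
∑-multiple a f r = ∑ (λ x → proj₁ (r x)) , trans (∑-cong (λ x → proj₂ (r x))) (∑-*ˡ a (λ x → proj₁ (r x)))

-- The finite check

infixl 7 _÷_
_÷_ : ℕ → ℕ → ℕ
a ÷ zero = 0
a ÷ suc b = a / suc b

÷-unique : ∀ a b x → 1 ℕ.≤ b → b ℕ.* x ≡ a → x ≡ a ÷ b
÷-unique a (suc b) x _ refl = sym (trans (cong (_/ suc b) (ℕP.*-comm (suc b) x)) (m*n/n≡m x (suc b)))

-- With eight roots and starting size 0 only the arguments 0, ..., 8 are ever looked up, so the last
-- clause serves for 8.
table : (a b c d e f g h i : ℕ) → ℕ → ℤ
table a b c d e f g h i 0 = + a
table a b c d e f g h i 1 = + b
table a b c d e f g h i 2 = + c
table a b c d e f g h i 3 = + d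
table a b c d e f g h i 4 = + e
table a b c d e f g h i 5 = + f
table a b c d e f g h i 6 = + g
table a b c d e f g h i 7 = + h
table a b c d e f g h i _ = + i

allBelow : ℕ → (ℕ → Bool) → Bool
allBelow zero f = true
allBelow (suc k) f = f k ∧ allBelow k f

allBelow-sound : ∀ k f → allBelow k f ≡ true → ∀ i → i ℕ.< k → f i ≡ true
allBelow-sound (suc k) f r i i<k with i ℕP.≟ k | f k in eq
... | yes refl | true = eq
... | no i≢k | true = allBelow-sound k f r i (ℕP.≤∧≢⇒< (ℕP.≤-pred i<k) i≢k)

not-does : ∀ {A : Set} (d : Dec A) → not (does d) ≡ true → ¬ A
not-does (no ¬a) _ = ¬a

divides-abs : ∀ q r {x} y → x ≡ (+ q ⋆ + r) ⋆ y → r ∣ ℤ.∣ x ∣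
divides-abs q r y refl = divides (q ℕ.* ℤ.∣ y ∣) (trans (cong (λ a → ℤ.∣ a ⋆ y ∣) (sym (ℤP.pos-* q r))) (trans (ℤP.abs-* (+ (q ℕ.* r)) y) (shape q r ℤ.∣ y ∣)))
  where
  shape : ∀ q r a → q ℕ.* r ℕ.* a ≡ q ℕ.* a ℕ.* r
  shape = solveℕ-∀

-- 8! = 2^7 · 315, so 2^15 is the full power of 2 in the modulus; the check tests divisibility by
-- this part.
2^8*8! : (2^ 8) ⋆ fact 8 ≡ + 315 ⋆ + 32768
2^8*8! = refl

opaque
  EvenMoment : (ℕ → ℤ) → ℕ → Set
  EvenMoment L w = 2 ℕ.^ 15 ∣ ℤ.∣ momentValue L (+ w) 0 (evens 8) ∣

  evenMoment : ∀ L w → (∃ λ y → momentValue L (+ w) 0 (evens 8) ≡ ((2^ 8) ⋆ fact 8) ⋆ y) → EvenMoment L w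
  evenMoment L w (y , r) = divides-abs 315 (2 ℕ.^ 15) y (trans r (cong (_⋆ y) 2^8*8!))

  -- For the parameters of D_d and each u of weight 8 q + 4, Σ_c Π_{r<8} (|c ∩ u| - 2 r) is not divisible by 2^15.
  noWeight4mod8 : (m : ℕ) (a b c d e f g h i : ℕ) → Bool
  noWeight4mod8 m a b c d e f g h i = allBelow (3 ℕ.* m) (λ q → not (does (2 ℕ.^ 15 ∣? ℤ.∣ momentValue (table a b c d e f g h i) (+ (8 ℕ.* q ℕ.+ 4)) 0 (evens 8) ∣)))

  noWeight4mod8-sound : ∀ m a b c d e f g h i → noWeight4mod8 m a b c d e f g h i ≡ true → ∀ q → q ℕ.< 3 ℕ.* m →
    ¬ EvenMoment (table a b c d e f g h i) (8 ℕ.* q ℕ.+ 4)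
  noWeight4mod8-sound m a b c d e f g h i r q q< = not-does (2 ℕ.^ 15 ∣? _) (allBelow-sound (3 ℕ.* m) _ r q q<)

  -- Three steps of (d - s) λ_s = (n - s) λ_{s+1}, starting at s = 5, express λ_8 as the quotient
  -- tested here.
  λ₈-fractional : (d n f : ℕ) → Bool
  λ₈-fractional d n f = not (does ((n ℕ.∸ 5) ℕ.* (n ℕ.∸ 6) ℕ.* (n ℕ.∸ 7) ∣? (d ℕ.∸ 5) ℕ.* (d ℕ.∸ 6) ℕ.* (d ℕ.∸ 7) ℕ.* f))

  λ₈-fractional-sound : ∀ d n f → λ₈-fractional d n f ≡ true →
    ¬ ((n ℕ.∸ 5) ℕ.* (n ℕ.∸ 6) ℕ.* (n ℕ.∸ 7) ∣ (d ℕ.∸ 5) ℕ.* (d ℕ.∸ 6) ℕ.* (d ℕ.∸ 7) ℕ.* f)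
  λ₈-fractional-sound d n f = not-does (_ ∣? _)

-- From λ_5 the relation (d - s) λ_s = (n - s) λ_{s+1} gives λ_6, λ_7, λ_8 upwards and then λ_4,
-- ..., λ_0 downwards. Each value is handed on as an argument, to be shared by all tests of a weight
-- |u|.
values₆ : (m d n f : ℕ) → Bool
values₇ : (m d n f g : ℕ) → Bool
values₈ : (m d n f g h : ℕ) → Bool
values₄ : (m d n f g h i : ℕ) → Bool
values₃ : (m d n e f g h i : ℕ) → Bool
values₂ : (m d n x e f g h i : ℕ) → Bool
values₁ : (m d n c x e f g h i : ℕ) → Bool
values₀ : (m d n b c x e f g h i : ℕ) → Bool
values₆ m d n f = values₇ m d n f ((d ℕ.∸ 5) ℕ.* f ÷ (n ℕ.∸ 5))
values₇ m d n f g = values₈ m d n f g ((d ℕ.∸ 6) ℕ.* g ÷ (n ℕ.∸ 6))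
values₈ m d n f g h = values₄ m d n f g h ((d ℕ.∸ 7) ℕ.* h ÷ (n ℕ.∸ 7))
values₄ m d n f g h i = values₃ m d n ((n ℕ.∸ 4) ℕ.* f ÷ (d ℕ.∸ 4)) f g h i
values₃ m d n e f g h i = values₂ m d n ((n ℕ.∸ 3) ℕ.* e ÷ (d ℕ.∸ 3)) e f g h i
values₂ m d n x e f g h i = values₁ m d n ((n ℕ.∸ 2) ℕ.* x ÷ (d ℕ.∸ 2)) x e f g h i
values₁ m d n c x e f g h i = values₀ m d n ((n ℕ.∸ 1) ℕ.* c ÷ (d ℕ.∸ 1)) c x e f g h i
values₀ m d n b c x e f g h i = noWeight4mod8 m (n ℕ.* b ÷ d) b c x e f g h i

refuted₅ : (m f : ℕ) → Bool
refuted₅ m f = λ₈-fractional (4 ℕ.* m ℕ.+ 4) (24 ℕ.* m) f ∨ values₆ m (4 ℕ.* m ℕ.+ 4) (24 ℕ.* m) f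

-- In terms of m′ = m - 1; the second argument of refuted₅ is λ₅.
refuted : ℕ → Bool
refuted a = refuted₅ (suc a) (4 ℕ.* ((5 ℕ.* a ℕ.+ 4) choose a) ℕ.∸ ((5 ℕ.* a ℕ.+ 3) choose (4 ℕ.* a ℕ.+ 2)))

opaque
  unfolding noWeight4mod8

  -- By evaluation; the bound m ≤ 153 enters the proof through the range of this check.
  all-refuted : allBelow 153 refuted ≡ true
  all-refuted = refl

∨-split : ∀ a b → a ∨ b ≡ true → a ≡ true ⊎ b ≡ true
∨-split true b _ = inj₁ refl
∨-split false b r = inj₂ r

values-sound : ∀ m d n (ℓ : ℕ → ℕ) →
  (∀ s → s ℕ.< 8 → ℓ (suc s) ≡ (d ℕ.∸ s) ℕ.* ℓ s ÷ (n ℕ.∸ s)) →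
  (∀ s → s ℕ.< 8 → ℓ s ≡ (n ℕ.∸ s) ℕ.* ℓ (suc s) ÷ (d ℕ.∸ s)) →
  values₆ m d n (ℓ 5) ≡ true → noWeight4mod8 m (ℓ 0) (ℓ 1) (ℓ 2) (ℓ 3) (ℓ 4) (ℓ 5) (ℓ 6) (ℓ 7) (ℓ 8) ≡ true
values-sound m d n ℓ up down v₆ = v₋
  where
  v₇ : values₇ m d n (ℓ 5) (ℓ 6) ≡ true
  v₇ = subst (λ x → values₇ m d n (ℓ 5) x ≡ true) (sym (up 5 (ℕP.m≤m+n 6 2))) v₆
  v₈ : values₈ m d n (ℓ 5) (ℓ 6) (ℓ 7) ≡ true
  v₈ = subst (λ x → values₈ m d n (ℓ 5) (ℓ 6) x ≡ true) (sym (up 6 (ℕP.m≤m+n 7 1))) v₇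
  v₄ : values₄ m d n (ℓ 5) (ℓ 6) (ℓ 7) (ℓ 8) ≡ true
  v₄ = subst (λ x → values₄ m d n (ℓ 5) (ℓ 6) (ℓ 7) x ≡ true) (sym (up 7 ℕP.≤-refl)) v₈
  v₃ : values₃ m d n (ℓ 4) (ℓ 5) (ℓ 6) (ℓ 7) (ℓ 8) ≡ true
  v₃ = subst (λ x → values₃ m d n x (ℓ 5) (ℓ 6) (ℓ 7) (ℓ 8) ≡ true) (sym (down 4 (ℕP.m≤m+n 5 3))) v₄
  v₂ : values₂ m d n (ℓ 3) (ℓ 4) (ℓ 5) (ℓ 6) (ℓ 7) (ℓ 8) ≡ true
  v₂ = subst (λ x → values₂ m d n x (ℓ 4) (ℓ 5) (ℓ 6) (ℓ 7) (ℓ 8) ≡ true) (sym (down 3 (ℕP.m≤m+n 4 4))) v₃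
  v₁ : values₁ m d n (ℓ 2) (ℓ 3) (ℓ 4) (ℓ 5) (ℓ 6) (ℓ 7) (ℓ 8) ≡ true
  v₁ = subst (λ x → values₁ m d n x (ℓ 3) (ℓ 4) (ℓ 5) (ℓ 6) (ℓ 7) (ℓ 8) ≡ true) (sym (down 2 (ℕP.m≤m+n 3 5))) v₂
  v₀ : values₀ m d n (ℓ 1) (ℓ 2) (ℓ 3) (ℓ 4) (ℓ 5) (ℓ 6) (ℓ 7) (ℓ 8) ≡ true
  v₀ = subst (λ x → values₀ m d n x (ℓ 2) (ℓ 3) (ℓ 4) (ℓ 5) (ℓ 6) (ℓ 7) (ℓ 8) ≡ true) (sym (down 1 (ℕP.m≤m+n 2 6))) v₁
  v₋ : noWeight4mod8 m (ℓ 0) (ℓ 1) (ℓ 2) (ℓ 3) (ℓ 4) (ℓ 5) (ℓ 6) (ℓ 7) (ℓ 8) ≡ true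
  v₋ = subst (λ x → noWeight4mod8 m x (ℓ 1) (ℓ 2) (ℓ 3) (ℓ 4) (ℓ 5) (ℓ 6) (ℓ 7) (ℓ 8) ≡ true) (sym (down 0 (ℕP.m≤m+n 1 7))) v₀

refuted-cases : ∀ a → refuted a ≡ true →
  let f = 4 ℕ.* ((5 ℕ.* a ℕ.+ 4) choose a) ℕ.∸ ((5 ℕ.* a ℕ.+ 3) choose (4 ℕ.* a ℕ.+ 2)) in
  λ₈-fractional (4 ℕ.* suc a ℕ.+ 4) (24 ℕ.* suc a) f ≡ true ⊎ values₆ (suc a) (4 ℕ.* suc a ℕ.+ 4) (24 ℕ.* suc a) f ≡ true
refuted-cases a r = ∨-split _ _ r

-- Parameters of the minimum weight design and the contradiction

module Refutation (m′ : ℕ) (refuted-m : refuted m′ ≡ true) (C : Code (24 ℕ.* suc m′)) (ext : IsExtremalDESD (suc m′) C) where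
  open IsDoublyEvenSelfDual (proj₁ ext)
  open Extremal m′ C ext
  open Strength m′ C ext
  open Transfer m′ C ext

  -- Each block meets the codeword u in an even number of points, where the product over `evens r`
  -- is a multiple of 2^r r!. The sum over all blocks is also determined by the counts, and thus
  -- depends on u only through |u|.
  moment-multiple : ∀ r (L : ℕ → ℤ) → (∀ t → # t ℕ.≤ r → count d t ≡ L (# t)) → ∀ u → u ∈C C →
    ∃ λ y → momentValue L (+ # u) 0 (evens r) ≡ ((2^ r) ⋆ fact r) ⋆ y
  moment-multiple r L count≡L u u∈ = proj₁ multiple , trans (sym value) (proj₂ multiple)
    where
    open Moments u (λ c → ⟦ C c ⟧ ⋆ ⟦ # c ≡ᵇ d ⟧)
    bare-count : ∀ t → moment t List.[] ≡ count d t
    bare-count t = ∑-cong (λ c → shape ⟦ C c ⟧ ⟦ # c ≡ᵇ d ⟧ ⟦ t ⊑ c ⟧)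
      where
      shape : ∀ a b c → (a ⋆ b) ⋆ (c ⋆ 1ℤ) ≡ a ⋆ (c ⋆ b)
      shape = solve-∀
    -- Sets of size up to and including r have constant counts, so there is no extra term at the top
    -- size.
    open Values L r 0ℤ (λ _ → 0ℤ)
      (λ t _ t<r → trans (bare-count t) (count≡L t (ℕP.<⇒≤ t<r)))
      (λ t _ t≡r → trans (bare-count t) (trans (count≡L t (ℕP.≤-reflexive t≡r)) (trans (cong L t≡r) (sym (ℤP.+-identityʳ (L r))))))
      (λ t _ _ → trans (extend-0 u t) (sym (ℤP.*-zeroʳ (+ r ℤ.- + # t))))
    even-intersection : ∀ c → c ∈C C → 2 ∣ c ∩# u
    even-intersection c c∈ = -1^-parity (c ∩# u) (trans (sym (sg-· c u)) (cong sg (Equivalence.to (selfDual c) c∈ u u∈)))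
    Q : ℤ
    Q = (2^ r) ⋆ fact r
    point : ∀ c b → C c ≡ b → ∃ λ y → (⟦ b ⟧ ⋆ ⟦ # c ≡ᵇ d ⟧) ⋆ (⟦ 0w n ⊑ c ⟧ ⋆ Π (evens r) (+ (c ∩# u))) ≡ Q ⋆ y
    point c false _ = 0ℤ , trans (cong (_⋆ (⟦ 0w n ⊑ c ⟧ ⋆ Π (evens r) (+ (c ∩# u)))) (ℤP.*-zeroˡ ⟦ # c ≡ᵇ d ⟧))
      (trans (ℤP.*-zeroˡ (⟦ 0w n ⊑ c ⟧ ⋆ Π (evens r) (+ (c ∩# u)))) (sym (ℤP.*-zeroʳ Q)))
    point c true c∈ = half (even-intersection c c∈)
      where
      half : 2 ∣ c ∩# u → _
      half (divides h e) = (1ℤ ⋆ ⟦ # c ≡ᵇ d ⟧) ⋆ (⟦ 0w n ⊑ c ⟧ ⋆ proj₁ falling) ,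
        trans (cong (λ a → (1ℤ ⋆ ⟦ # c ≡ᵇ d ⟧) ⋆ (⟦ 0w n ⊑ c ⟧ ⋆ a)) product)
          (shape (1ℤ ⋆ ⟦ # c ≡ᵇ d ⟧) ⟦ 0w n ⊑ c ⟧ (2^ r) (fact r) (proj₁ falling))
        where
        falling : ∃ λ y → fallingFactorial (+ h) r ≡ fact r ⋆ y
        falling = fact-divides-falling h r
        shape : ∀ a b p q y → a ⋆ (b ⋆ (p ⋆ (q ⋆ y))) ≡ (p ⋆ q) ⋆ (a ⋆ (b ⋆ y))
        shape = solve-∀
        product : Π (evens r) (+ (c ∩# u)) ≡ (2^ r) ⋆ (fact r ⋆ proj₁ falling)
        product = trans (cong (Π (evens r)) (trans (cong +_ (trans e (ℕP.*-comm h 2))) (ℤP.pos-* 2 h))) (trans (Π-evens r (+ h)) (cong ((2^ r) ⋆_) (proj₂ falling)))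
    multiple : ∃ λ y → moment (0w n) (evens r) ≡ Q ⋆ y
    multiple = ∑-multiple Q (λ c → (⟦ C c ⟧ ⋆ ⟦ # c ≡ᵇ d ⟧) ⋆ (⟦ 0w n ⊑ c ⟧ ⋆ Π (evens r) (+ (c ∩# u)))) (λ c → point c (C c) refl)
    value : moment (0w n) (evens r) ≡ momentValue L (+ # u) 0 (evens r)
    value = trans (moment-top (0w n) (evens r) (0w-⊑ u) (cong₂ ℕ._+_ (#-0w n) (length-evens r)))
      (trans (ℤP.+-identityʳ (V (# (0w n)) (evens r))) (cong (λ a → momentValue L (+ # u) a (evens r)) (#-0w n)))

  module Design (const : ∀ s → s ℕ.≤ 8 → Const s d) where

    L : ℕ → ℤ
    L s = count d (segment n s)

    ℓ : ℕ → ℕ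
    ℓ s = ℤ.∣ L s ∣

    L≡ : ∀ s → + ℓ s ≡ L s
    L≡ s = ℤP.0≤i⇒+∣i∣≡i (∑-nonneg (λ c → subst (0ℤ ℤ.≤_)
      (trans (⟦∧⟧ (C c) ((segment n s ⊑ c) ∧ (# c ≡ᵇ d))) (cong (⟦ C c ⟧ ⋆_) (⟦∧⟧ (segment n s ⊑ c) (# c ≡ᵇ d))))
      (⟦⟧-nonneg (C c ∧ ((segment n s ⊑ c) ∧ (# c ≡ᵇ d))))))

    count≡ : ∀ t → # t ℕ.≤ 8 → count d t ≡ + ℓ (# t)
    count≡ t t≤8 = trans (ℤP.i-j≡0⇒i≡j _ _ (const (# t) t≤8 t refl)) (sym (L≡ (# t)))

    recurrence : ∀ s → s ℕ.< 8 → (d ℕ.∸ s) ℕ.* ℓ s ≡ (n ℕ.∸ s) ℕ.* ℓ (suc s)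
    recurrence s s<8 = ℤP.+-injective (trans (ℤP.pos-* (d ℕ.∸ s) (ℓ s)) (trans (cong₂ _⋆_ (difference s≤d) (L≡ s))
      (trans (extension-count s d (const (suc s) s<8) (segment n s) (#-segment n s s≤n))
        (sym (trans (ℤP.pos-* (n ℕ.∸ s) (ℓ (suc s))) (cong₂ _⋆_ (difference s≤n) (L≡ (suc s))))))))
      where
      s≤d : s ℕ.≤ d
      s≤d = ℕP.≤-trans (ℕP.<⇒≤ s<8) 8≤d
      s≤n : s ℕ.≤ n
      s≤n = ℕP.≤-trans s≤d d≤n
      difference : ∀ {a b} → b ℕ.≤ a → + (a ℕ.∸ b) ≡ + a ℤ.- + b
      difference {a} {b} b≤a = sym (trans (ℤP.m-n≡m⊖n a b) (ℤP.⊖-≥ b≤a))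

    5≤n : 5 ℕ.≤ n
    5≤n = ℕP.≤-trans (ℕP.m≤m+n 5 3) (ℕP.≤-trans 8≤d d≤n)

    f : ℕ
    f = 4 ℕ.* ((5 ℕ.* m′ ℕ.+ 4) choose m′) ℕ.∸ ((5 ℕ.* m′ ℕ.+ 3) choose (4 ℕ.* m′ ℕ.+ 2))

    -- λ_5 plus the second binomial is four times the first as natural numbers, so the truncated
    -- subtraction is exact.
    ℓ₅ : ℓ 5 ≡ f
    ℓ₅ = trans (sym (ℕP.m+n∸n≡m (ℓ 5) b)) (cong (ℕ._∸ b) (ℤP.+-injective (trans (ℤP.pos-+ (ℓ 5) b) (trans (cong₂ _⊹_ (L≡ 5) (cong +_ b≡))
        (trans (λ₅ (segment n 5) (#-segment n 5 5≤n)) (trans (cong (λ x → + 4 ⋆ + (x choose m′)) a≡) (sym (ℤP.pos-* 4 ((5 ℕ.* m′ ℕ.+ 4) choose m′)))))))))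
      where
      b : ℕ
      b = (5 ℕ.* m′ ℕ.+ 3) choose (4 ℕ.* m′ ℕ.+ 2)
      arith : ∀ x → 5 ℕ.* x ℕ.+ 3 ≡ 2 ℕ.+ 4 ℕ.* x ℕ.+ suc x
      arith = solveℕ-∀
      arith′ : ∀ x → x ℕ.+ (4 ℕ.+ 4 ℕ.* x) ≡ 5 ℕ.* x ℕ.+ 4
      arith′ = solveℕ-∀
      b≡ : b ≡ (N ℕ.+ suc m′) choose N
      b≡ = cong₂ _choose_ (trans (arith m′) (cong (λ x → 2 ℕ.+ x ℕ.+ suc m′) (sym (four≡ m′)))) (trans (ℕP.+-comm (4 ℕ.* m′) 2) (cong (2 ℕ.+_) (sym (four≡ m′))))
      a≡ : m′ ℕ.+ (4 ℕ.+ four m′) ≡ 5 ℕ.* m′ ℕ.+ 4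
      a≡ = trans (cong (λ x → m′ ℕ.+ (4 ℕ.+ x)) (four≡ m′)) (arith′ m′)

    λ₈-integral : (n ℕ.∸ 5) ℕ.* (n ℕ.∸ 6) ℕ.* (n ℕ.∸ 7) ∣ (d ℕ.∸ 5) ℕ.* (d ℕ.∸ 6) ℕ.* (d ℕ.∸ 7) ℕ.* ℓ 5
    λ₈-integral = divides (ℓ 8) (begin
      a ℕ.* b ℕ.* c ℕ.* ℓ 5          ≡⟨ shape₁ a b c (ℓ 5) ⟩
      b ℕ.* c ℕ.* (a ℕ.* ℓ 5)        ≡⟨ cong (b ℕ.* c ℕ.*_) (recurrence 5 (ℕP.m≤m+n 6 2)) ⟩
      b ℕ.* c ℕ.* (x ℕ.* ℓ 6)        ≡⟨ shape₂ b c x (ℓ 6) ⟩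
      c ℕ.* x ℕ.* (b ℕ.* ℓ 6)        ≡⟨ cong (c ℕ.* x ℕ.*_) (recurrence 6 (ℕP.m≤m+n 7 1)) ⟩
      c ℕ.* x ℕ.* (y ℕ.* ℓ 7)        ≡⟨ shape₃ c x y (ℓ 7) ⟩
      x ℕ.* y ℕ.* (c ℕ.* ℓ 7)        ≡⟨ cong (x ℕ.* y ℕ.*_) (recurrence 7 ℕP.≤-refl) ⟩
      x ℕ.* y ℕ.* (z′ ℕ.* ℓ 8)       ≡⟨ shape₄ x y z′ (ℓ 8) ⟩
      ℓ 8 ℕ.* (x ℕ.* y ℕ.* z′)       ∎)
      where
      open ≡-Reasoning
      a b c x y z′ : ℕ
      a = d ℕ.∸ 5
      b = d ℕ.∸ 6
      c = d ℕ.∸ 7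
      x = n ℕ.∸ 5
      y = n ℕ.∸ 6
      z′ = n ℕ.∸ 7
      shape₁ : ∀ a b c l → a ℕ.* b ℕ.* c ℕ.* l ≡ b ℕ.* c ℕ.* (a ℕ.* l)
      shape₁ = solveℕ-∀
      shape₂ : ∀ b c x l → b ℕ.* c ℕ.* (x ℕ.* l) ≡ c ℕ.* x ℕ.* (b ℕ.* l)
      shape₂ = solveℕ-∀
      shape₃ : ∀ c x y l → c ℕ.* x ℕ.* (y ℕ.* l) ≡ x ℕ.* y ℕ.* (c ℕ.* l)
      shape₃ = solveℕ-∀
      shape₄ : ∀ x y w l → x ℕ.* y ℕ.* (w ℕ.* l) ≡ l ℕ.* (x ℕ.* y ℕ.* w)
      shape₄ = solveℕ-∀

    up : ∀ s → s ℕ.< 8 → ℓ (suc s) ≡ (d ℕ.∸ s) ℕ.* ℓ s ÷ (n ℕ.∸ s)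
    up s s<8 = ÷-unique _ (n ℕ.∸ s) (ℓ (suc s)) (ℕP.m<n⇒0<n∸m (ℕP.<-≤-trans s<8 (ℕP.≤-trans 8≤d d≤n))) (sym (recurrence s s<8))

    down : ∀ s → s ℕ.< 8 → ℓ s ≡ (n ℕ.∸ s) ℕ.* ℓ (suc s) ÷ (d ℕ.∸ s)
    down s s<8 = ÷-unique _ (d ℕ.∸ s) (ℓ s) (ℕP.m<n⇒0<n∸m (ℕP.<-≤-trans s<8 8≤d)) (recurrence s s<8)

    Lℓ : ℕ → ℤ
    Lℓ = table (ℓ 0) (ℓ 1) (ℓ 2) (ℓ 3) (ℓ 4) (ℓ 5) (ℓ 6) (ℓ 7) (ℓ 8)

    Lℓ≡ : ∀ s → s ℕ.≤ 8 → Lℓ s ≡ + ℓ s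
    Lℓ≡ 0 _ = refl
    Lℓ≡ 1 _ = refl
    Lℓ≡ 2 _ = refl
    Lℓ≡ 3 _ = refl
    Lℓ≡ 4 _ = refl
    Lℓ≡ 5 _ = refl
    Lℓ≡ 6 _ = refl
    Lℓ≡ 7 _ = refl
    Lℓ≡ 8 _ = refl
    Lℓ≡ (suc (suc (suc (suc (suc (suc (suc (suc (suc s))))))))) r = ⊥-elim (ℕP.<⇒≱ r (ℕP.m≤m+n 8 s))

    even-moment : ∀ u → u ∈C C → EvenMoment Lℓ (# u)
    even-moment u u∈ = evenMoment Lℓ (# u) (moment-multiple 8 Lℓ (λ t t≤8 → trans (count≡ t t≤8) (sym (Lℓ≡ (# t) t≤8))) u u∈)

    -- A weight is a multiple of 4; an odd multiple has the form 8 q + 4 and is excluded by the even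
    -- moment.
    triply : noWeight4mod8 (suc m′) (ℓ 0) (ℓ 1) (ℓ 2) (ℓ 3) (ℓ 4) (ℓ 5) (ℓ 6) (ℓ 7) (ℓ 8) ≡ true → ∀ u → u ∈C C → 8 ∣ # u
    triply none u u∈ with quarter u u∈
    ... | a , e = go (parity a)
      where
      parity : ∀ a → (∃ λ q → a ≡ 2 ℕ.* q) ⊎ (∃ λ q → a ≡ suc (2 ℕ.* q))
      parity zero = inj₁ (0 , refl)
      parity (suc a) with parity a
      ... | inj₁ (q , refl) = inj₂ (q , refl)
      ... | inj₂ (q , refl) = inj₁ (suc q , sym (ℕP.*-suc 2 q))
      shape : ∀ q → 2 ℕ.* q ℕ.* 4 ≡ q ℕ.* 8
      shape = solveℕ-∀
      shape′ : ∀ q → suc (2 ℕ.* q) ℕ.* 4 ≡ 8 ℕ.* q ℕ.+ 4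
      shape′ = solveℕ-∀
      shape″ : ∀ m → 24 ℕ.* m ≡ 8 ℕ.* (3 ℕ.* m)
      shape″ = solveℕ-∀
      go : (∃ λ q → a ≡ 2 ℕ.* q) ⊎ (∃ λ q → a ≡ suc (2 ℕ.* q)) → 8 ∣ # u
      go (inj₁ (q , r)) = divides q (trans e (trans (cong (ℕ._* 4) r) (shape q)))
      go (inj₂ (q , r)) = ⊥-elim (noWeight4mod8-sound (suc m′) (ℓ 0) (ℓ 1) (ℓ 2) (ℓ 3) (ℓ 4) (ℓ 5) (ℓ 6) (ℓ 7) (ℓ 8) none q q<
          (subst (EvenMoment Lℓ) #u (even-moment u u∈)))
        where
        #u : # u ≡ 8 ℕ.* q ℕ.+ 4
        #u = trans e (trans (cong (ℕ._* 4) r) (shape′ q))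
        -- 8 q + 4 ≤ n = 8 · 3 m keeps q inside the tested range.
        q< : q ℕ.< 3 ℕ.* suc m′
        q< = ℕP.*-cancelˡ-< 8 q (3 ℕ.* suc m′) (ℕP.<-≤-trans (ℕP.m<m+n (8 ℕ.* q) (s≤s z≤n)) (subst₂ ℕ._≤_ #u (shape″ (suc m′)) (#≤n u)))

    absurd : ⊥
    absurd with refuted-cases m′ refuted-m
    ... | inj₁ r = λ₈-fractional-sound d n (ℓ 5) (subst₂ (λ a b → λ₈-fractional a n b ≡ true) (sym d≡) (sym ℓ₅) r) λ₈-integral
    ... | inj₂ r = contradiction (proj₂ (proj₂ ext))
      where
      contradiction : (Σ (Word n) λ x → x ∈C C × x ≢ 0w n × wt x ≡ 4 ℕ.* suc m′ ℕ.+ 4) → ⊥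
      contradiction (x , x∈ , _ , #x) = NotTriplyEven.absurd C linear selfDual
        (triply (values-sound (suc m′) d n ℓ up down (subst₂ (λ a b → values₆ (suc m′) a n b ≡ true) (sym d≡) (sym ℓ₅) r)))
        d (ℕP.≤-trans (ℕP.m≤m+n 3 5) 8≤d) min x x∈ (trans (sym (#-wt x)) (trans #x (sym d≡)))

-- From counts over all words to support designs as lists

support≡ : ∀ {n} (c : Word n) → support c ≡ c
support≡ [] = refl
support≡ (false ∷ c) = cong (false ∷_) (support≡ c)
support≡ (true ∷ c) = cong (true ∷_) (support≡ c)

∣∣≡# : ∀ {n} (t : Word n) → ∣ t ∣ ≡ # t
∣∣≡# t = trans (cong ∣_∣ (sym (support≡ t))) (#-wt t)

⊑⇒⊆ : ∀ {n} (t c : Word n) → (t ⊑ c) ≡ true → t ⊆ c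
⊑⇒⊆ (true ∷ t) (true ∷ c) r Vec.here = Vec.here
⊑⇒⊆ (true ∷ t) (true ∷ c) r (Vec.there i) = Vec.there (⊑⇒⊆ t c r i)
⊑⇒⊆ (false ∷ t) (_ ∷ c) r (Vec.there i) = Vec.there (⊑⇒⊆ t c r i)

⊆⇒⊑ : ∀ {n} (t c : Word n) → t ⊆ c → (t ⊑ c) ≡ true
⊆⇒⊑ [] [] r = refl
⊆⇒⊑ (true ∷ t) (false ∷ c) r with r Vec.here
... | ()
⊆⇒⊑ (true ∷ t) (true ∷ c) r = ⊆⇒⊑ t c (λ i → drop-there (r (Vec.there i)))
⊆⇒⊑ (false ∷ t) (_ ∷ c) r = ⊆⇒⊑ t c (λ i → drop-there (r (Vec.there i)))

∑ᴸ : ∀ {n} → (Word n → ℤ) → List (Word n) → ℤ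
∑ᴸ f List.[] = 0ℤ
∑ᴸ f (c List.∷ cs) = f c ⊹ ∑ᴸ f cs

∑ᴸ-++ : ∀ {n} (f : Word n → ℤ) cs cs′ → ∑ᴸ f (cs List.++ cs′) ≡ ∑ᴸ f cs ⊹ ∑ᴸ f cs′
∑ᴸ-++ f List.[] cs′ = sym (ℤP.+-identityˡ _)
∑ᴸ-++ f (c List.∷ cs) cs′ = trans (cong (f c ⊹_) (∑ᴸ-++ f cs cs′)) (sym (ℤP.+-assoc (f c) (∑ᴸ f cs) (∑ᴸ f cs′)))

∑ᴸ-map : ∀ {n} (f : Word (suc n) → ℤ) b cs → ∑ᴸ f (List.map (b ∷_) cs) ≡ ∑ᴸ (λ c → f (b ∷ c)) cs
∑ᴸ-map f b List.[] = refl
∑ᴸ-map f b (c List.∷ cs) = cong (f (b ∷ c) ⊹_) (∑ᴸ-map f b cs)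

∑ᴸ-allWords : ∀ {n} (f : Word n → ℤ) → ∑ᴸ f (allWords n) ≡ ∑ f
∑ᴸ-allWords {zero} f = trans (ℤP.+-identityʳ (f [])) (sym (∑-[] f))
∑ᴸ-allWords {suc n} f = trans (∑ᴸ-++ f (List.map (false ∷_) (allWords n)) (List.map (true ∷_) (allWords n)))
  (trans (cong₂ _⊹_ (trans (∑ᴸ-map f false (allWords n)) (∑ᴸ-allWords (λ c → f (false ∷ c)))) (trans (∑ᴸ-map f true (allWords n)) (∑ᴸ-allWords (λ c → f (true ∷ c)))))
    (sym (∑-∷ f)))

blocks≡ : ∀ {n} (C : Code n) w t cs →
  + blocksContaining (List.map support (List.filter (λ c → (C c ∧ (wt c ≡ᵇ w)) BoolP.≟ true) cs)) t ≡ ∑ᴸ (λ c → ⟦ C c ⟧ ⋆ (⟦ t ⊑ c ⟧ ⋆ ⟦ # c ≡ᵇ w ⟧)) cs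
blocks≡ C w t List.[] = refl
blocks≡ C w t (c List.∷ cs) with C c ∧ (wt c ≡ᵇ w) in eq
... | false = trans (blocks≡ C w t cs) (sym (trans (cong (_⊹ _) (vanish (C c) (# c ≡ᵇ w) (trans (cong (λ a → C c ∧ (a ≡ᵇ w)) (sym (#-wt c))) eq))) (ℤP.+-identityˡ _)))
  where
  vanish : ∀ a b → a ∧ b ≡ false → ⟦ a ⟧ ⋆ (⟦ t ⊑ c ⟧ ⋆ ⟦ b ⟧) ≡ 0ℤ
  vanish false b _ = ℤP.*-zeroˡ (⟦ t ⊑ c ⟧ ⋆ ⟦ b ⟧)
  vanish true false _ = trans (ℤP.*-identityˡ (⟦ t ⊑ c ⟧ ⋆ 0ℤ)) (ℤP.*-zeroʳ ⟦ t ⊑ c ⟧)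
... | true with t ⊆? support c
...   | yes s = cong₂ _⊹_ (sym (present (C c) (# c ≡ᵇ w) (t ⊑ c) (trans (cong (λ a → C c ∧ (a ≡ᵇ w)) (sym (#-wt c))) eq) (⊆⇒⊑ t c (subst (t ⊆_) (support≡ c) s)))) (blocks≡ C w t cs)
  where
  present : ∀ a b e → a ∧ b ≡ true → e ≡ true → ⟦ a ⟧ ⋆ (⟦ e ⟧ ⋆ ⟦ b ⟧) ≡ 1ℤ
  present true true true _ _ = refl
...   | no ¬s = trans (blocks≡ C w t cs) (sym (trans (cong (_⊹ _) (absent (t ⊑ c) refl)) (ℤP.+-identityˡ _)))
  where
  absent : ∀ e → (t ⊑ c) ≡ e → ⟦ C c ⟧ ⋆ (⟦ e ⟧ ⋆ ⟦ # c ≡ᵇ w ⟧) ≡ 0ℤ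
  absent true r = ⊥-elim (¬s (subst (t ⊆_) (sym (support≡ c)) (⊑⇒⊆ t c r)))
  absent false _ = trans (cong (⟦ C c ⟧ ⋆_) (ℤP.*-zeroˡ ⟦ # c ≡ᵇ w ⟧)) (ℤP.*-zeroʳ ⟦ C c ⟧)

supportDesign-count : ∀ {n} (C : Code n) w t → + blocksContaining (supportDesign C w) t ≡ ∑ (λ c → ⟦ C c ⟧ ⋆ (⟦ t ⊑ c ⟧ ⋆ ⟦ # c ≡ᵇ w ⟧))
supportDesign-count {n} C w t = trans (blocks≡ C w t (allWords n)) (∑ᴸ-allWords (λ c → ⟦ C c ⟧ ⋆ (⟦ t ⊑ c ⟧ ⋆ ⟦ # c ≡ᵇ w ⟧)))

-- The upper bound on w is a lower bound on n - w, which is again a multiple of 4; so w and n - w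
-- both have the form d plus a multiple of 4.
weight-position : ∀ m w → 4 ∣ w → 4 * suc m + 4 ≤ w → w ≤ 24 * suc m ∸ (4 * suc m + 4) →
  ∃ λ j → ∃ λ l → j + l ≡ 2 + four m × w ≡ 8 + four m + four j
weight-position m w 4∣w d≤w w≤n∸d = combine 4∣w (∣m+n∣m⇒∣n (subst (4 ∣_) (sym w+) (divides (6 * suc m) (arith m))) 4∣w)
  where
  n d : ℕ
  n = 24 * suc m
  d = 4 * suc m + 4
  arith : ∀ a → 24 * suc a ≡ 6 * suc a * 4
  arith = solveℕ-∀
  d≡ : d ≡ 8 + four m
  d≡ = trans (arith′ m) (cong (8 ℕ.+_) (sym (four≡ m)))
    where
    arith′ : ∀ a → 4 * suc a + 4 ≡ 8 + 4 * a
    arith′ = solveℕ-∀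
  d≤n : d ≤ n
  d≤n = subst (d ≤_) (arith″ m) (ℕP.m≤m+n d (20 * m + 16))
    where
    arith″ : ∀ a → 4 * suc a + 4 + (20 * a + 16) ≡ 24 * suc a
    arith″ = solveℕ-∀
  w+ : w + (n ∸ w) ≡ n
  w+ = ℕP.m+[n∸m]≡n (ℕP.≤-trans w≤n∸d (ℕP.m∸n≤m n d))
  d≤n∸w : d ≤ n ∸ w
  d≤n∸w = ℕP.m+n≤o⇒m≤o∸n d (subst (_≤ n) (ℕP.+-comm w d) (ℕP.m≤o∸n⇒m+n≤o w d≤n w≤n∸d))
  combine : 4 ∣ w → 4 ∣ n ∸ w → ∃ λ j → ∃ λ l → j + l ≡ 2 + four m × w ≡ 8 + four m + four j
  combine (divides a r) (divides b r′) = forget (complementary-weights m a b r r′ w+ (subst (_≤ w) d≡ d≤w) (subst (_≤ n ∸ w) d≡ d≤n∸w))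
    where
    forget : (∃ λ j → ∃ λ l → j + l ≡ 2 + four m × w ≡ 8 + four m + four j × n ∸ w ≡ 8 + four m + four l) → ∃ λ j → ∃ λ l → j + l ≡ 2 + four m × w ≡ 8 + four m + four j
    forget (j , l , p , q , _) = j , l , p , q

module NoDesign (m′ : ℕ) (refuted-m : refuted m′ ≡ true) (C : Code (24 * suc m′)) (ext : IsExtremalDESD (suc m′) C) where
  open Extremal m′ C ext
  open Strength m′ C ext
  open Transfer m′ C ext
  open Refutation m′ refuted-m C ext

  count≡λ : ∀ w λ′ → (∀ t → ∣ t ∣ ≡ 8 → blocksContaining (supportDesign C w) t ≡ λ′) → ∀ t → # t ≡ 8 → count w t ≡ + λ′
  count≡λ w λ′ design t t≡8 = trans (sym (supportDesign-count C w t)) (cong +_ (design t (trans (∣∣≡# t) t≡8)))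

  const : ∀ w → IsTDesign 8 (supportDesign C w) → Const 8 w
  const w (λ′ , design) t t≡8 = ℤP.i≡j⇒i-j≡0 (trans (count≡λ w λ′ design t t≡8) (sym (count≡λ w λ′ design (segment n (# t)) (trans (#-seg t) t≡8))))

  no-design : ∀ w → (∃ λ j → ∃ λ l → j + l ≡ N × w ≡ d + four j) → ¬ IsTDesign 8 (supportDesign C w)
  no-design w (j , l , j+l , w≡) design = Design.absurd (transfer j l j+l (subst (Const 8) w≡ (const w design)))

theorem3p2 : (m : ℕ) → 1 ≤ m → m ≤ 153 → (C : Code (24 * m)) → IsExtremalDESD m C →
    (w : ℕ) → 4 ∣ w → 4 * m + 4 ≤ w → w ≤ 24 * m ∸ (4 * m + 4) →
    ¬ IsTDesign 8 (supportDesign C w)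
theorem3p2 (suc m′) _ m≤153 C ext w 4∣w d≤w w≤n∸d =
  NoDesign.no-design m′ (allBelow-sound 153 refuted all-refuted m′ m≤153) C ext w (weight-position m′ w 4∣w d≤w w≤n∸d)
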